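{- There is a parameterized function in $\mathrm{para\text{ - }FNL}^{\uparrow}$ that maps every $((G,s,t),k)$, where $G$ is a network with designated vertices $s$ and $t$ and $k\in\mathbb N$ is the parameter, to a $0$-$1$-flow from $s$ to $t$ in $G$ of value $k$, if such a flow exists, or to a maximum $0$-$1$-flow from $s$ to $t$ in $G$ otherwise.
   Context: A network is a digraph $G=(V,E)$ with two designated vertices $s,t\in V$ such that between any two different vertices $u,v$ at most one of the edges $(u,v)$, $(v,u)$ is present. A $0$-$1$-flow from $s$ to $t$ is a mapping $f\colon E\to\{0,1\}$ with $\sum_{(u,v)\in E}f(u,v)=\sum_{(v,w)\in E}f(v,w)$ for all $v\in V\setminus\{s,t\}$. Its value is $|f|=\sum_{(s,v)\in E}f(s,v)-\sum_{(w,s)\in E}f(w,s)$. A parameterized function is a mapping $F\colon\Sigma^*\times\mathbb N\to\Sigma^*\times\mathbb N$ such that for some $b\colon\mathbb N\to\mathbb N$ we have $k'\le b(k)$ whenever $F(w,k)=(w',k')$ (the output parameter is irrelevant for the claim and may be taken to be $0$). $F$ is linear if $|F(w,k)|\le f(k)\cdot|w|$ for some computable $f$. $\mathrm{para\text{ - }FNL}$ is the class of parameterized functions $F$ computed by a nondeterministic Turing machine with read-only input tape and write-only output tape that on input $(w,k)$ uses at most $f(k)+O(\log|w|)$ work tape cells for some computable $f$, where all halting computations lead to $F(w,k)$ on the output tape. $F\in\mathrm{para\text{ - }FNL}^{\uparrow}$ if there are an initial function $I\in\mathrm{para\text{ - }FNL}$, a linear iterator function $L\in\mathrm{para\text{ -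 }FNL}$, and a computable $r\colon\mathbb N\to\mathbb N$ with $F(w,k)=L^{r(k)}(I(w,k))$, where $L^{r}$ is the $r$-fold composition of $L$ with itself. -}

module Defs where

open import Algebra.Properties.CommutativeMonoid.Sum using (sum)
open import Data.Bool using (Bool; true; false; if_then_else_; T)
open import Data.Fin using (Fin; toℕ)
open import Data.Integer as ℤ using (ℤ; +_)
open import Data.List using (List; []; _∷_; _++_; length; map; replicate; concat; tabulate; fromMaybe)
open import Data.List.Membership.Propositional using (_∈_)
open import Data.Maybe using (Maybe)
open import Data.Nat using (ℕ; zero; suc; pred; _+_; _*_; _≤_; _⊓_)
open import Data.Nat.Logarithm using (⌈log₂_⌉)
open import Data.Nat.Properties using (+-0-commutativeMonoid)
open import Data.Product using (Σ-syntax; _×_; _,_; ∃-syntax; proj₁; proj₂)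
open import Data.Vec as Vec using (Vec)
open import Function using (_↔_)
open import Function.Endo.Propositional using (_^_)
open import Relation.Binary.Construct.Closure.ReflexiveTransitive using (Star)
open import Relation.Binary.PropositionalEquality using (_≡_; _≢_)
open import Relation.Nullary using (¬_)

Finite : Set → Set
Finite A = ∃[ n ] (A ↔ Fin n)

-- Words over the alphabet Σ = {0,1}.
Word : Set
Word = List Bool

------------------------------------------------------------------------
-- Nondeterministic Turing machines

data Move : Set where
  left stay right : Move

-- The input stands between the two end markers ⊢ and ⊣.
data InputSymbol : Set where
  ⊢ ⊣ : InputSymbol
  sym : Bool → InputSymbol

record Action (State Symbol : Set) (tapes : ℕ) : Set where
  field
    next      : State
    inputMove : Move
    work      : Vec (Symbol × Move) tapes
    emit      : Maybe Bool

record Machine : Set₁ where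
  field
    State         : Set
    Symbol        : Set
    tapes         : ℕ
    finite-State  : Finite State
    finite-Symbol : Finite Symbol
    start         : State
    blank         : Symbol
    δ             : State → InputSymbol → Vec Symbol tapes → List (Action State Symbol tapes)

-- The visited part of a two-way infinite tape: the cells to the left of the
-- head (nearest first), the scanned cell, the cells to the right of the head.
-- It never shrinks, so its size is the number of cells used so far.
record Tape (Symbol : Set) : Set where
  constructor tape
  field
    lefts   : List Symbol
    scanned : Symbol
    rights  : List Symbol

tapeSize : ∀ {S} → Tape S → ℕ
tapeSize (tape ls _ rs) = length ls + suc (length rs)

module _ {S : Set} (blank : S) where

  moveTape : Move → Tape S → Tape S
  moveTape stay  t                    = t
  moveTape left  (tape []       a rs) = tape [] blank (a ∷ rs)
  moveTape left  (tape (l ∷ ls) a rs) = tape ls l (a ∷ rs)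
  moveTape right (tape ls a [])       = tape (a ∷ ls) blank []
  moveTape right (tape ls a (r ∷ rs)) = tape (a ∷ ls) r rs

  updateTape : S × Move → Tape S → Tape S
  updateTape (a , m) (tape ls _ rs) = moveTape m (tape ls a rs)

-- Input head position 0 is ⊢, position i (1 ≤ i ≤ length x) is the i-th input
-- symbol, position length x + 1 is ⊣.
readInput : Word → ℕ → InputSymbol
readInput x       zero          = ⊢
readInput []      (suc _)       = ⊣
readInput (b ∷ _) (suc zero)    = sym b
readInput (_ ∷ x) (suc (suc i)) = readInput x (suc i)

-- The input head cannot leave the marked region.
moveInput : Word → Move → ℕ → ℕ
moveInput x left  i = pred i
moveInput x stay  i = i
moveInput x right i = suc i ⊓ suc (length x)

module Run (M : Machine) where
  open Machine M

  record Config : Set where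
    field
      state  : State
      head   : ℕ
      works  : Vec (Tape Symbol) tapes
      output : Word

  open Config public

  initial : Config
  initial = record
    { state  = start
    ; head   = 0
    ; works  = Vec.replicate tapes (tape [] blank [])
    ; output = []
    }

  actions : Word → Config → List (Action State Symbol tapes)
  actions x c = δ (state c) (readInput x (head c)) (Vec.map Tape.scanned (works c))

  perform : Word → Config → Action State Symbol tapes → Config
  perform x c a = record
    { state  = Action.next a
    ; head   = moveInput x (Action.inputMove a) (head c)
    ; works  = Vec.zipWith (updateTape blank) (Action.work a) (works c)
    ; output = output c ++ fromMaybe (Action.emit a)
    }

  Step : Word → Config → Config → Set
  Step x c c′ = c′ ∈ map (perform x c) (actions x c)

  Reachable : Word → Config → Set
  Reachable x c = Star (Step x) initial c

  Halted : Word → Config → Set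
  Halted x c = actions x c ≡ []

  space : Config → ℕ
  space c = Vec.sum (Vec.map tapeSize (works c))

-- Some computation on x halts, and every halting computation outputs y.
-- Computations are allowed to run forever.
Yields : Machine → Word → Word → Set
Yields M x y =
    (∃[ c ] (Reachable x c × Halted x c))
  × (∀ c → Reachable x c → Halted x c → output c ≡ y)
  where open Run M

UsesSpace : Machine → Word → ℕ → Set
UsesSpace M x b = ∀ c → Reachable x c → space c ≤ b
  where open Run M

Deterministic : Machine → Set
Deterministic M = ∀ q a v → length (δ q a v) ≤ 1
  where open Machine M

unary : ℕ → Word
unary k = replicate k true

Computable : (ℕ → ℕ) → Set₁
Computable f = ∃[ M ] (Deterministic M × (∀ k → Yields M (unary k) (unary (f k))))

------------------------------------------------------------------------
-- Parameterized functions

-- How a pair (w , k) is written on the input and output tapes: 1ᵏ 0 w.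
pair : Word × ℕ → Word
pair (w , k) = unary k ++ false ∷ w

Parameterized : (Word × ℕ → Word × ℕ) → Set
Parameterized F = Σ[ b ∈ (ℕ → ℕ) ] (∀ w k → proj₂ (F (w , k)) ≤ b k)

Linear : (Word × ℕ → Word × ℕ) → Set₁
Linear F = ∃[ f ] (Computable f × (∀ w k → length (proj₁ (F (w , k))) ≤ f k * length w))

-- The space bound f(k) + O(log |w|) is written f(k) + c ⌈log₂ |w|⌉; additive
-- constants are absorbed by f, and ⌈log₂ 0⌉ = 0 in the library.
ParaFNL : (Word × ℕ → Word × ℕ) → Set₁
ParaFNL F = Parameterized F ×
  ∃[ M ] ∃[ f ] ∃[ c ] (Computable f × (∀ w k →
      Yields M (pair (w , k)) (pair (F (w , k)))
    × UsesSpace M (pair (w , k)) (f k + c * ⌈log₂ length w ⌉)))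

ParaFNL↑ : (Word × ℕ → Word × ℕ) → Set₁
ParaFNL↑ F = Parameterized F ×
  ∃[ I ] ∃[ L ] ∃[ r ] (ParaFNL I × ParaFNL L × Linear L × Computable r ×
    (∀ w k → F (w , k) ≡ (_^_ (Word × ℕ) L (r k)) (I (w , k))))

------------------------------------------------------------------------
-- Networks and 0-1-flows

Matrix : ℕ → Set
Matrix n = Fin n → Fin n → Bool

-- Loops are not excluded, and s and t may coincide.
record Network (n : ℕ) : Set where
  field
    edge           : Matrix n
    s t            : Fin n
    noAntiparallel : ∀ u v → u ≢ v → ¬ (T (edge u v) × T (edge v u))

∑ : ∀ {n} → (Fin n → Bool) → ℕ
∑ p = sum +-0-commutativeMonoid (λ v → if p v then 1 else 0)

outflow inflow : ∀ {n} → Matrix n → Fin n → ℕ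
outflow f v = ∑ (λ w → f v w)
inflow  f v = ∑ (λ u → f u v)

-- A mapping E → {0,1} is represented by its extension by 0 to all of V × V.
record Flow {n} (G : Network n) : Set where
  open Network G
  field
    flow         : Matrix n
    support      : ∀ u v → T (flow u v) → T (edge u v)
    conservation : ∀ v → v ≢ s → v ≢ t → inflow flow v ≡ outflow flow v

open Flow public using (flow)

value : ∀ {n} {G : Network n} → Flow G → ℤ
value {G = G} φ = + outflow (flow φ) s ℤ.- + inflow (flow φ) s
  where open Network G

Maximum : ∀ {n} {G : Network n} → Flow G → Set
Maximum {G = G} φ = ∀ (ψ : Flow G) → value ψ ℤ.≤ value φ

-- The entries row by row.
encodeMatrix : ∀ {n} → Matrix n → Word
encodeMatrix A = concat (tabulate (λ u → tabulate (A u)))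

-- 1ⁿ 0 1ˢ 0 1ᵗ 0 followed by the adjacency matrix.
encodeNetwork : ∀ {n} → Network n → Word
encodeNetwork {n} G =
  unary n ++ false ∷ unary (toℕ s) ++ false ∷ unary (toℕ t) ++ false ∷ encodeMatrix edge
  where open Network G

{-# OPTIONS --safe #-}

-- Starting from the zero flow, k augmentations along paths of the residual graph
-- give a flow of value k or a maximum flow.  The iterator makes one augmentation
-- and decreases the parameter; at parameter 0 it outputs the flow, so k + 1
-- iterations suffice.  Between iterations a word consists of 1ⁿ01ˢ01ᵗ0 and, for
-- all u and v, the bit of the edge (u , v) followed by its residual bit.
--
-- All halting computations must agree, so the augmenting path has to be canonical
-- and its absence has to be certified.  Inductive counting (Immerman,
-- Szelepcsényi) gives the number of vertices reachable from s in l steps, for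
-- each l, and with it a unique predecessor of a vertex in each level; the path is
-- followed from t back to s.  The residual bit of (u , v) after the augmentation
-- is obtained by following the path once for each pair (u , v).
--
-- The machines are compiled from commands that work on a fixed number of
-- registers.  Their bits are the tracks of a single work tape, so the space used
-- is the number of bits of the largest register value.  A wrong guess diverges.
module Submission where

open import Defs
open import Algebra.Properties.CommutativeMonoid.Sum using () renaming (sum to sumOver)
open import Data.Bool using (Bool; true; false; _∧_; _∨_; not; _xor_; if_then_else_; T)
open import Data.Bool.Properties using (∨-identityʳ; ∨-zeroʳ; ∧-zeroʳ; ∨-assoc; xor-same)
open import Data.Empty using (⊥; ⊥-elim)
open import Data.Fin as Fin using (Fin; zero; suc; toℕ; fromℕ; fromℕ<; inject₁; #_)
open import Data.Fin.Properties as Fin using (+↔⊎; *↔×; 1↔⊤; 2↔Bool; 0↔⊥; toℕ-injective; toℕ<n; toℕ-fromℕ; toℕ-fromℕ<; toℕ-inject₁)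
open import Data.Integer as ℤ using (ℤ; +_; -[1+_])
open import Data.Integer.Properties as ℤ using ()
open import Data.Integer.Solver using () renaming (module +-*-Solver to ℤ-Solver)
open import Data.List using (List; []; _∷_; _++_; length; map; replicate; drop; concat; tabulate; fromMaybe; _ʳ++_)
open import Data.List.Membership.Propositional using (_∈_)
open import Data.List.Properties using (++-assoc; ++-identityʳ; length-++; length-map; length-replicate; length-ʳ++)
open import Data.List.Relation.Unary.Any using (here; there)
open import Data.Maybe as Maybe using (Maybe; just; nothing)
open import Data.Nat as ℕ using (ℕ; zero; suc; pred; _+_; _*_; _∸_; _^_; _≤_; _<_; z≤n; s≤s; _≟_; _<?_; _≤?_; _⊓_; ⌈_/2⌉)
open import Data.Nat.Induction using (<-wellFounded)
open import Data.Nat.Logarithm using (⌈log₂_⌉)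
open import Data.Nat.Logarithm.Core using (⌈log2⌉)
open import Data.Nat.Properties as ℕ
open import Algebra.Properties.CommutativeSemigroup +-commutativeSemigroup using (x∙yz≈y∙xz)
open import Data.Nat.Solver using (module +-*-Solver)
open import Data.Product using (_×_; _,_; ∃-syntax; proj₁; proj₂)
open import Data.Product.Function.NonDependent.Propositional using (_×-↔_)
open import Data.Sum using (_⊎_; inj₁; inj₂)
open import Data.Sum.Function.Propositional using (_⊎-↔_)
open import Data.Unit using (⊤; tt)
open import Data.Vec as Vec using ()
open import Function using (_↔_; mk↔ₛ′; id; _∘_; const)
open import Function.Construct.Composition using (_↔-∘_)
open import Function.Construct.Identity using (↔-id)
open import Function.Construct.Symmetry using (↔-sym)
open import Function.Endo.Propositional using () renaming (_^_ to power)
open import Induction.WellFounded using (Acc; acc)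
open import Relation.Binary.Construct.Closure.ReflexiveTransitive using (Star; ε; _◅_; _◅◅_)
open import Relation.Binary.PropositionalEquality renaming (sym to ≡-sym)
open import Relation.Nullary using (¬_; yes; no; ⌊_⌋; contradiction)

-- Automata over a store and their simulation by machines

-- `ParaFNL` asks for an output on every word, not only on encoded networks. Hence the initial
-- function and the iterator are total functions on words with defaults for missing bits, `s` and
-- `t` may lie outside the vertex range, and every command is specified on arbitrary input. An entry
-- is written only where the input has one; this keeps the words from growing and gives linearity.
--
-- The residual matrix is stored instead of the flow because the search runs in it and the flow can
-- be read off: an edge carries flow when its residual bit is off. Neither the new matrix nor a
-- table of level sizes fits on the work tape, so they are recomputed whenever they are consulted.
-- The path is determined in the old matrix although pushes change the matrix; this is sound because
-- a push changes only entries at a vertex that the remaining part of the path has left behind.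
--
-- If `t` is unreachable, nothing is pushed and the vertices reached from `s` form a cut that
-- certifies maximality, so surplus iterations do no harm.
--
-- The parameter stands in unary on the input tape, so head positions take about log(k + |w|) bits;
-- this is bounded by k plus log |w| plus a constant.

Tup : Set → ℕ → Set
Tup A zero    = ⊤
Tup A (suc m) = A × Tup A m

-- Tuples are nested pairs: with eta for pairs, reading and writing at a literal index computes even
-- if the tail is unknown, so that most of the register bookkeeping below holds by `refl`.
get : ∀ {m} {A : Set} → Fin m → Tup A m → A
get zero    (a , _) = a
get (suc i) (_ , t) = get i t

set : ∀ {m} {A : Set} → Fin m → A → Tup A m → Tup A m
set zero    a (_ , t) = a , t
set (suc i) a (b , t) = b , set i a t

const-tup : ∀ {A : Set} → A → ∀ m → Tup A m
const-tup a zero    = tt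
const-tup a (suc m) = a , const-tup a m

finite-⊥ : Finite ⊥
finite-⊥ = 0 , ↔-sym 0↔⊥

finite-⊤ : Finite ⊤
finite-⊤ = 1 , ↔-sym 1↔⊤

finite-Bool : Finite Bool
finite-Bool = 2 , ↔-sym 2↔Bool

finite-⊎ : ∀ {A B} → Finite A → Finite B → Finite (A ⊎ B)
finite-⊎ (m , f) (n , g) = m + n , ↔-sym +↔⊎ ↔-∘ (f ⊎-↔ g)

finite-× : ∀ {A B} → Finite A → Finite B → Finite (A × B)
finite-× (m , f) (n , g) = m * n , ↔-sym *↔× ↔-∘ (f ×-↔ g)

finite-Tup : ∀ {A} → Finite A → ∀ m → Finite (Tup A m)
finite-Tup f zero    = finite-⊤
finite-Tup f (suc m) = finite-× f (finite-Tup f m)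

finite-↔ : ∀ {A B} → A ↔ B → Finite B → Finite A
finite-↔ f (n , g) = n , g ↔-∘ f

finite-Maybe : ∀ {A} → Finite A → Finite (Maybe A)
finite-Maybe f = finite-↔ (mk↔ₛ′
  (λ { nothing → inj₁ tt ; (just a) → inj₂ a })
  (λ { (inj₁ tt) → nothing ; (inj₂ a) → just a })
  (λ { (inj₁ tt) → refl ; (inj₂ a) → refl })
  (λ { nothing → refl ; (just a) → refl })) (finite-⊎ finite-⊤ f)

-- A store lists its columns least significant first: column j holds the j-th
-- bits of all the registers.
record Store (m : ℕ) : Set where
  constructor store
  field
    pos     : ℕ
    columns : List (Tup Bool m)
    out     : Word
open Store public

-- `scan e r c f` is a transducer run once over the columns, least significant first: `f` sees the
-- carry and a whole column and returns the next carry and the new bit of `r`. If `e` is set, a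
-- carry left at the end opens a new column.
data Instr (m : ℕ) : Set where
  coin : Instr m
  look : (InputSymbol → Bool × Move × Maybe Bool) → Instr m
  scan : (extend : Bool) → Fin m → (carry : Bool) → (Bool → Tup Bool m → Bool × Bool) → Instr m

extension : ∀ {m} → Bool → Fin m → Bool → List (Tup Bool m)
extension {m} true  r true  = set r true (const-tup false m) ∷ []
extension     true  r false = []
extension     false r c     = []

scanColumns : ∀ {m} → Bool → Fin m → (Bool → Tup Bool m → Bool × Bool) → Bool →
              List (Tup Bool m) → List (Tup Bool m)
scanColumns e r f c []       = extension e r c
scanColumns e r f c (a ∷ as) = set r (proj₂ (f c a)) a ∷ scanColumns e r f (proj₁ (f c a)) as

scanCarry : ∀ {m} → (Bool → Tup Bool m → Bool × Bool) → Bool → List (Tup Bool m) → Bool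
scanCarry f c []       = c
scanCarry f c (a ∷ as) = scanCarry f (proj₁ (f c a)) as

emitTo : Word → Maybe Bool → Word
emitTo o nothing  = o
emitTo o (just b) = o ++ b ∷ []

emitTo-++ : ∀ o e → o ++ fromMaybe e ≡ emitTo o e
emitTo-++ o nothing  = ++-identityʳ o
emitTo-++ o (just b) = refl

-- The continuation `mk` rebuilds the surrounding record, so that stores of bits and states with
-- number registers share this function and agree on `look` by computation.
evalLook : ∀ {A : Set} → Word → (InputSymbol → Bool × Move × Maybe Bool) →
           (ℕ → Word → A) → ℕ → Word → Bool × A
evalLook x f mk p o with f (readInput x p)
... | b , mv , e = b , mk (moveInput x mv p) (emitTo o e)

evalInstr : ∀ {m} → Word → Instr m → Store m → Bool × Store m
evalInstr x coin           d = false , d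
evalInstr x (look f)       (store p cs o) = evalLook x f (λ p′ o′ → store p′ cs o′) p o
evalInstr x (scan e r c f) (store p cs o) = scanCarry f c cs , store p (scanColumns e r f c cs) o

-- For `coin` the resulting bit is left free, which is the only source of nondeterminism; the bit
-- that `evalInstr` gives there is a placeholder.
Sem : ∀ {m} → Word → Instr m → Store m → Bool → Store m → Set
Sem x coin             d b d′ = d′ ≡ d
Sem x i@(look _)       d b d′ = evalInstr x i d ≡ (b , d′)
Sem x i@(scan _ _ _ _) d b d′ = evalInstr x i d ≡ (b , d′)

record Automaton (m : ℕ) : Set₁ where
  field
    Node   : Set
    finite : Finite Node
    begin  : Node
    instr  : Node → Instr m
    next   : Node → Bool → Maybe Node

-- A scan leaves the blank cell to the left of the columns, runs to the first blank on the right and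
-- comes back. The bit is the carry on the way out and the final carry, deciding the branch, on the
-- way home.
data Phase : Set where
  idle : Phase
  scanning returning : Bool → Phase

finite-Phase : Finite Phase
finite-Phase = finite-↔ (mk↔ₛ′
  (λ { idle → inj₁ tt ; (scanning c) → inj₂ (inj₁ c) ; (returning c) → inj₂ (inj₂ c) })
  (λ { (inj₁ tt) → idle ; (inj₂ (inj₁ c)) → scanning c ; (inj₂ (inj₂ c)) → returning c })
  (λ { (inj₁ tt) → refl ; (inj₂ (inj₁ c)) → refl ; (inj₂ (inj₂ c)) → refl })
  (λ { idle → refl ; (scanning c) → refl ; (returning c) → refl }))
  (finite-⊎ finite-⊤ (finite-⊎ finite-Bool finite-Bool))

module Simulation {m : ℕ} (A : Automaton m) where
  open Automaton A

  Cell : Set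
  Cell = Maybe (Tup Bool m)

  Control : Set
  Control = Maybe (Node × Phase)

  Act : Set
  Act = Action Control Cell 1

  idling : Maybe Node → Control
  idling = Maybe.map (_, idle)

  quiet : Control → Cell → Move → Act
  quiet s z mv = record { next = s ; inputMove = stay ; work = (z , mv) Vec.∷ Vec.[] ; emit = nothing }

  looking : (Bool → Maybe Node) → Cell → Bool × Move × Maybe Bool → Act
  looking k z (b , mv , e) =
    record { next = idling (k b) ; inputMove = mv ; work = (z , stay) Vec.∷ Vec.[] ; emit = e }

  endCell : Bool → Fin m → Bool → Cell
  endCell true  r true  = just (set r true (const-tup false m))
  endCell true  r false = nothing
  endCell false r c     = nothing

  act : Node → Phase → Instr m → InputSymbol → Cell → List Act
  act q idle coin a z = quiet (idling (next q true)) z stay ∷ quiet (idling (next q false)) z stay ∷ []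
  act q idle (look f) a z = looking (next q) z (f a) ∷ []
  act q idle (scan e r c f) a z = quiet (just (q , scanning c)) z right ∷ []
  act q (scanning c) (scan e r _ f) a (just v) =
    quiet (just (q , scanning (proj₁ (f c v)))) (just (set r (proj₂ (f c v)) v)) right ∷ []
  act q (scanning c) (scan e r _ f) a nothing =
    quiet (just (q , returning c)) (endCell e r c) left ∷ []
  act q (returning c) (scan e r _ f) a (just v) = quiet (just (q , returning c)) (just v) left ∷ []
  act q (returning c) (scan e r _ f) a nothing = quiet (idling (next q c)) nothing stay ∷ []
  act q _ _ a z = []

  machine : Machine
  machine = record
    { State         = Control
    ; Symbol        = Cell
    ; tapes         = 1
    ; finite-State  = finite-Maybe (finite-× finite finite-Phase)
    ; finite-Symbol = finite-Maybe (finite-Tup finite-Bool m)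
    ; start         = just (begin , idle)
    ; blank         = nothing
    ; δ             = λ { nothing a _ → [] ; (just (q , ph)) a (z Vec.∷ _) → act q ph (instr q) a z }
    }

  open Run machine public

  data Exec (x : Word) : Maybe Node → Store m → Store m → Set where
    done : ∀ {d} → Exec x nothing d d
    step : ∀ {q d b d′ d″} → Sem x (instr q) d b d′ → Exec x (next q b) d′ d″ → Exec x (just q) d d″

  config : Control → ℕ → Tape Cell → Word → Config
  config s h t o = record { state = s ; head = h ; works = t Vec.∷ Vec.[] ; output = o }

  -- A tape never shrinks, so the blank met at the right end stays visited after a scan. The flag
  -- records whether it is there: a scan that extends turns it into the new column.
  pad : Bool → List Cell
  pad false = []
  pad true  = nothing ∷ []

  focus : List Cell → List Cell → Tape Cell
  focus ls []       = tape ls nothing []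
  focus ls (z ∷ zs) = tape ls z zs

  back : List (Tup Bool m) → List Cell → Tape Cell
  back []       rs = tape [] nothing rs
  back (v ∷ vs) rs = tape (map just vs ++ nothing ∷ []) (just v) rs

  moveRight : ∀ ls z rs → moveTape nothing right (tape ls z rs) ≡ focus (z ∷ ls) rs
  moveRight ls z []      = refl
  moveRight ls z (_ ∷ _) = refl

  moveLeft : ∀ vs z rs → moveTape nothing left (tape (map just vs ++ nothing ∷ []) z rs) ≡ back vs (z ∷ rs)
  moveLeft []      z rs = refl
  moveLeft (_ ∷ _) z rs = refl

  cells : List (Tup Bool m) → Bool → List Cell
  cells cs t = map just cs ++ pad t

  home : Control → Store m → Bool → Config
  home s (store p cs o) t = config s p (tape [] nothing (cells cs t)) o

  scanned : Node → Bool → List (Tup Bool m) → List (Tup Bool m) → Store m → Bool → Config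
  scanned q c vs as (store p _ o) t =
    config (just (q , scanning c)) p (focus (map just vs ++ nothing ∷ []) (cells as t)) o

  returned : Node → Bool → List (Tup Bool m) → List (Tup Bool m) → Store m → Bool → Config
  returned q c vs as (store p _ o) t =
    config (just (q , returning c)) p (back vs (cells as t)) o

  successors : Word → Config → List Config
  successors x c = map (perform x c) (actions x c)

  perform-quiet : ∀ x s h ls z rs o s′ z′ mv →
    perform x (config s h (tape ls z rs) o) (quiet s′ z′ mv) ≡
    config s′ h (moveTape nothing mv (tape ls z′ rs)) o
  perform-quiet x s h ls z rs o s′ z′ mv = cong (config s′ h _) (++-identityʳ o)

  keepPad : Bool → Bool → Bool
  keepPad true true = false
  keepPad _    _    = true

  endCells : ∀ e r (f : Bool → Tup Bool m → Bool × Bool) c →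
             endCell e r c ∷ [] ≡ cells (scanColumns e r f c []) (keepPad e c)
  endCells true  r f true  = refl
  endCells true  r f false = refl
  endCells false r f true  = refl
  endCells false r f false = refl

  focus-pad : ∀ ls t → focus ls (pad t) ≡ tape ls nothing []
  focus-pad ls true  = refl
  focus-pad ls false = refl

  step-scan : ∀ x q e r i f d t → instr q ≡ scan e r i f →
    successors x (home (just (q , idle)) d t) ≡
    scanned q i [] (columns d) d t ∷ []
  step-scan x q e r i f (store p cs o) t eq rewrite eq
    | perform-quiet x (just (q , idle)) p [] nothing (cells cs t) o (just (q , scanning i)) nothing right
    | moveRight [] nothing (cells cs t) = refl

  step-scanning : ∀ x q e r i f c vs a as d t → instr q ≡ scan e r i f →
    successors x (scanned q c vs (a ∷ as) d t) ≡
    scanned q (proj₁ (f c a)) (set r (proj₂ (f c a)) a ∷ vs) as d t ∷ []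
  step-scanning x q e r i f c vs a as (store p cs o) t eq rewrite eq
    | perform-quiet x (just (q , scanning c)) p (map just vs ++ nothing ∷ []) (just a) (cells as t) o
        (just (q , scanning (proj₁ (f c a)))) (just (set r (proj₂ (f c a)) a)) right
    | moveRight (map just vs ++ nothing ∷ []) (just (set r (proj₂ (f c a)) a)) (cells as t) = refl

  step-turn : ∀ x q e r i f c vs d t → instr q ≡ scan e r i f →
    successors x (scanned q c vs [] d t) ≡
    returned q c vs (scanColumns e r f c []) d (keepPad e c) ∷ []
  step-turn x q e r i f c vs (store p cs o) t eq
    rewrite eq | focus-pad (map just vs ++ nothing ∷ []) t
    | perform-quiet x (just (q , scanning c)) p (map just vs ++ nothing ∷ []) nothing [] o
        (just (q , returning c)) (endCell e r c) left
    | moveLeft vs (endCell e r c) []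
    | endCells e r f c = refl

  step-returning : ∀ x q e r i f c v vs as d t → instr q ≡ scan e r i f →
    successors x (returned q c (v ∷ vs) as d t) ≡
    returned q c vs (v ∷ as) d t ∷ []
  step-returning x q e r i f c v vs as (store p cs o) t eq rewrite eq
    | perform-quiet x (just (q , returning c)) p (map just vs ++ nothing ∷ []) (just v) (cells as t) o
        (just (q , returning c)) (just v) left
    | moveLeft vs (just v) (cells as t) = refl

  step-home : ∀ x q e r i f c as d t → instr q ≡ scan e r i f →
    successors x (returned q c [] as d t) ≡
    home (idling (next q c)) (record d { columns = as }) t ∷ []
  step-home x q e r i f c as (store p cs o) t eq rewrite eq
    | perform-quiet x (just (q , returning c)) p [] nothing (cells as t) o
        (idling (next q c)) nothing stay = refl

  step-look : ∀ x q f d t → instr q ≡ look f →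
    successors x (home (just (q , idle)) d t) ≡
    home (idling (next q (proj₁ (evalInstr x (look f) d)))) (proj₂ (evalInstr x (look f) d)) t ∷ []
  step-look x q f (store p cs o) t eq rewrite eq with f (readInput x p)
  ... | b , mv , e = cong (λ o′ → config (idling (next q b)) (moveInput x mv p) (tape [] nothing (cells cs t)) o′ ∷ []) (emitTo-++ o e)

  step-coin : ∀ x q d t → instr q ≡ coin →
    successors x (home (just (q , idle)) d t) ≡
    home (idling (next q true)) d t ∷ home (idling (next q false)) d t ∷ []
  step-coin x q (store p cs o) t eq rewrite eq
    | perform-quiet x (just (q , idle)) p [] nothing (cells cs t) o (idling (next q true)) nothing stay
    | perform-quiet x (just (q , idle)) p [] nothing (cells cs t) o (idling (next q false)) nothing stay
    = refl

  only : ∀ {x c c′} → successors x c ≡ c′ ∷ [] → Step x c c′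
  only eq = subst (_ ∈_) (≡-sym eq) (here refl)

  run-returning : ∀ x q e r i f c vs as d t → instr q ≡ scan e r i f →
    Star (Step x) (returned q c vs as d t) (home (idling (next q c)) (record d { columns = vs ʳ++ as }) t)
  run-returning x q e r i f c []       as d t eq = only (step-home x q e r i f c as d t eq) ◅ ε
  run-returning x q e r i f c (v ∷ vs) as d t eq =
    only (step-returning x q e r i f c v vs as d t eq) ◅ run-returning x q e r i f c vs (v ∷ as) d t eq

  run-scanning : ∀ x q e r i f c vs as d t → instr q ≡ scan e r i f →
    ∃[ t′ ] Star (Step x) (scanned q c vs as d t)
      (home (idling (next q (scanCarry f c as))) (record d { columns = vs ʳ++ scanColumns e r f c as }) t′)
  run-scanning x q e r i f c vs []       d t eq =
    _ , only (step-turn x q e r i f c vs d t eq) ◅ run-returning x q e r i f c vs _ d _ eq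
  run-scanning x q e r i f c vs (a ∷ as) d t eq with
    run-scanning x q e r i f (proj₁ (f c a)) (set r (proj₂ (f c a)) a ∷ vs) as d t eq
  ... | t′ , run = t′ , only (step-scanning x q e r i f c vs a as d t eq) ◅ run

  run-instr : ∀ x q d b d′ t → Sem x (instr q) d b d′ →
    ∃[ t′ ] Star (Step x) (home (just (q , idle)) d t) (home (idling (next q b)) d′ t′)
  run-instr x q d b d′ t sem = go (instr q) refl sem where
    go : ∀ i → instr q ≡ i → Sem x i d b d′ →
      ∃[ t′ ] Star (Step x) (home (just (q , idle)) d t) (home (idling (next q b)) d′ t′)
    go coin eq refl = t , member b ◅ ε where
      member : ∀ b → Step x (home (just (q , idle)) d t) (home (idling (next q b)) d t)
      member b = subst (_ ∈_) (≡-sym (step-coin x q d t eq)) (pick b) where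
        pick : ∀ b → home (idling (next q b)) d t ∈ _
        pick true  = here refl
        pick false = there (here refl)
    go (look f) eq refl = t , only (step-look x q f d t eq) ◅ ε
    go (scan e r i f) eq refl with run-scanning x q e r i f i [] (columns d) d t eq
    ... | t′ , run = t′ , only (step-scan x q e r i f d t eq) ◅ run

  run-exec : ∀ x mq d d′ t → Exec x mq d d′ →
    ∃[ t′ ] Star (Step x) (home (idling mq) d t) (home nothing d′ t′)
  run-exec x nothing  d d′ t done = t , ε
  run-exec x (just q) d d′ t (step {b = b} {d′ = d₁} s ex) with run-instr x q d b d₁ t s
  ... | t₁ , run₁ with run-exec x (next q b) d₁ d′ t₁ ex
  ... | t₂ , run₂ = t₂ , run₁ ◅◅ run₂

  initialStore : Store m
  initialStore = store 0 [] []

  complete : ∀ x d → Exec x (just begin) initialStore d →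
    ∃[ c ] (Reachable x c × Halted x c × output c ≡ out d)
  complete x d ex with run-exec x (just begin) initialStore d false ex
  ... | t , run = _ , run , refl , refl

  -- `J` is an invariant of the stores between instructions. It yields both that every halting
  -- configuration stems from a complete execution and that the space stays bounded.
  module Invariant (x : Word) (J : Maybe Node → Store m → Set) (bound : ℕ)
    (J-begin : J (just begin) initialStore)
    (J-step : ∀ {q d b d′} → J (just q) d → Sem x (instr q) d b d′ → J (next q b) d′)
    (J-bound : ∀ {q d} → J q d → length (columns d) ≤ bound) where

    -- J holds and every way to finish extends to a complete execution.
    Good : Maybe Node → Store m → Set
    Good q d = J q d × (∀ d′ → Exec x q d d′ → Exec x (just begin) initialStore d′)

    -- In the middle of a scan `d` is still the store before the instruction; the columns already
    -- rewritten, followed by the outcome for the others, must be what the whole scan yields on `d`.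
    data Inv : Config → Set where
      at-home : ∀ {q d t} → Good q d → Inv (home (idling q) d t)
      at-scan : ∀ {q e r i f c vs as d t} → instr q ≡ scan e r i f → Good (just q) d →
        vs ʳ++ scanColumns e r f c as ≡ scanColumns e r f i (columns d) →
        scanCarry f c as ≡ scanCarry f i (columns d) →
        length vs + length as ≤ bound → Inv (scanned q c vs as d t)
      at-return : ∀ {q e r i f c vs as d t} → instr q ≡ scan e r i f → Good (just q) d →
        vs ʳ++ as ≡ scanColumns e r f i (columns d) →
        c ≡ scanCarry f i (columns d) →
        length vs + length as ≤ bound → Inv (returned q c vs as d t)

    good-step : ∀ {q d b d′} → Good (just q) d → Sem x (instr q) d b d′ → Good (next q b) d′
    good-step (j , g) s = J-step j s , λ d″ ex → g d″ (step s ex)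

    scan-sem : ∀ {q e r i f} → instr q ≡ scan e r i f → ∀ d →
      Sem x (instr q) d (scanCarry f i (columns d)) (record d { columns = scanColumns e r f i (columns d) })
    scan-sem eq d rewrite eq = refl

    scan-good : ∀ {q e r i f} → instr q ≡ scan e r i f → ∀ {d} → Good (just q) d →
      Good (next q (scanCarry f i (columns d))) (record d { columns = scanColumns e r f i (columns d) })
    scan-good eq {d} g = good-step g (scan-sem eq d)

    sole : ∀ {c c′ c″} → successors x c ≡ c″ ∷ [] → Step x c c′ → c′ ≡ c″
    sole {c′ = c′} eq s with subst (c′ ∈_) eq s
    ... | here refl = refl

    preserve : ∀ {c c′} → Inv c → Step x c c′ → Inv c′
    preserve (at-home {q = nothing} g) ()
    preserve {c′ = c′} (at-home {q = just q} {d} {t} g) s = go (instr q) refl s where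
      go : ∀ {c′} i → instr q ≡ i → Step x (home (just (q , idle)) d t) c′ → Inv c′
      go {c′} coin eq s with subst (c′ ∈_) (step-coin x q d t eq) s
      ... | here refl = at-home (good-step g (subst (λ i → Sem x i d true d) (≡-sym eq) refl))
      ... | there (here refl) = at-home (good-step g (subst (λ i → Sem x i d false d) (≡-sym eq) refl))
      go (look f) eq s with sole (step-look x q f d t eq) s
      ... | refl = at-home {d = proj₂ r} {t} (good-step g (subst (λ i → Sem x i d (proj₁ r) (proj₂ r)) (≡-sym eq) refl))
        where r = evalInstr x (look f) d
      go (scan e r i f) eq s with sole (step-scan x q e r i f d t eq) s
      ... | refl = at-scan {vs = []} {columns d} {d} {t} eq g refl refl (J-bound (proj₁ g))
    preserve (at-scan {q} {e} {r} {i} {f} {c} {vs} {[]} {d} {t} eq g p₁ p₂ p₃) s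
      with sole (step-turn x q e r i f c vs d t eq) s
    -- The turn may add a column, so the bound comes from the store that the finished scan leaves
    -- behind.
    ... | refl = at-return {vs = vs} {d = d} {keepPad e c} eq g p₁ p₂ (≤-trans (≤-reflexive len) (J-bound (proj₁ (scan-good eq g)))) where
      len : length vs + length (scanColumns e r f c []) ≡ length (scanColumns e r f i (columns d))
      len = trans (≡-sym (length-ʳ++ vs)) (cong length p₁)
    preserve (at-scan {q} {e} {r} {i} {f} {c} {vs} {a ∷ as} {d} {t} eq g p₁ p₂ p₃) s
      with sole (step-scanning x q e r i f c vs a as d t eq) s
    ... | refl = at-scan {vs = set r (proj₂ (f c a)) a ∷ vs} {as} {d} {t} eq g p₁ p₂ (subst (_≤ bound) (+-suc (length vs) (length as)) p₃)
    preserve (at-return {q} {e} {r} {i} {f} {c} {[]} {as} {d} {t} eq g refl refl p₃) s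
      with sole (step-home x q e r i f c as d t eq) s
    ... | refl = at-home (scan-good eq g)
    preserve (at-return {q} {e} {r} {i} {f} {c} {v ∷ vs} {as} {d} {t} eq g p₁ p₂ p₃) s
      with sole (step-returning x q e r i f c v vs as d t eq) s
    ... | refl = at-return {vs = vs} {v ∷ as} {d} {t} eq g p₁ p₂ (subst (_≤ bound) (≡-sym (+-suc (length vs) (length as))) p₃)

    reachable-inv : ∀ {c} → Reachable x c → Inv c
    reachable-inv run = go (at-home {q = just begin} {d = initialStore} {t = false} (J-begin , λ _ ex → ex)) run where
      go : ∀ {c c′} → Inv c → Star (Step x) c c′ → Inv c′
      go i ε        = i
      go i (s ◅ ss) = go (preserve i s) ss

    moving : ∀ {c c′ : Config} → successors x c ≡ c′ ∷ [] → Halted x c → ⊥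
    moving {c} eq h with actions x c
    moving () refl | []

    sound : ∀ c → Reachable x c → Halted x c →
      ∃[ d ] (Exec x (just begin) initialStore d × output c ≡ out d)
    sound c run = go (reachable-inv run) where
      go : ∀ {c} → Inv c → Halted x c → ∃[ d ] (Exec x (just begin) initialStore d × output c ≡ out d)
      go (at-home {q = nothing} {d} (_ , g)) _ = d , g d done , refl
      go (at-home {q = just q} {d} {t} _) h = ⊥-elim (alive (instr q) refl h) where
        alive : ∀ i → instr q ≡ i → Halted x (home (just (q , idle)) d t) → ⊥
        alive coin eq h rewrite eq with h
        ... | ()
        alive (look f) eq h = moving (step-look x q f d t eq) h
        alive (scan e r i f) eq h = moving (step-scan x q e r i f d t eq) h
      go (at-scan {vs = vs} {as = []} {d} {t} eq _ _ _ _) h =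
        ⊥-elim (moving (step-turn x _ _ _ _ _ _ vs d t eq) h)
      go (at-scan {vs = vs} {as = a ∷ as} {d} {t} eq _ _ _ _) h =
        ⊥-elim (moving (step-scanning x _ _ _ _ _ _ vs a as d t eq) h)
      go (at-return {vs = []} {as} {d} {t} eq _ _ _ _) h =
        ⊥-elim (moving (step-home x _ _ _ _ _ _ as d t eq) h)
      go (at-return {vs = v ∷ vs} {as} {d} {t} eq _ _ _ _) h =
        ⊥-elim (moving (step-returning x _ _ _ _ _ _ v vs as d t eq) h)

    length-cells : ∀ cs t → length (cells cs t) ≤ suc (length cs)
    length-cells []       true  = ≤-refl
    length-cells []       false = z≤n
    length-cells (_ ∷ cs) t     = s≤s (length-cells cs t)

    size-focus : ∀ ls zs k → length zs ≤ suc k → tapeSize (focus ls zs) ≤ length ls + suc k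
    size-focus ls []       k p = +-monoʳ-≤ (length ls) (s≤s z≤n)
    size-focus ls (z ∷ zs) k p = +-monoʳ-≤ (length ls) p

    length-done : ∀ vs → length (map (just {A = Tup Bool m}) vs ++ nothing ∷ []) ≡ suc (length vs)
    length-done []       = refl
    length-done (_ ∷ vs) = cong suc (length-done vs)

    size-back : ∀ vs zs → tapeSize (back vs zs) ≡ length vs + suc (length zs)
    size-back []       zs = refl
    size-back (v ∷ vs) zs = cong (_+ suc (length zs)) (length-done vs)

    -- The two extra cells are the blank home cell and at most one visited blank to the right of the
    -- columns.
    space-bound : ∀ c → Reachable x c → space c ≤ bound + 2
    space-bound c run = go (reachable-inv run) where
      wrap : ∀ {n} → n ≤ bound + 2 → n + 0 ≤ bound + 2
      wrap {n} p = subst (_≤ bound + 2) (≡-sym (+-identityʳ n)) p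
      total : ∀ {k} → k ≤ bound → suc (suc k) ≤ bound + 2
      total p = subst (_≤ bound + 2) (+-comm _ 2) (+-monoˡ-≤ 2 p)
      go : ∀ {c} → Inv c → space c ≤ bound + 2
      go (at-home {d = d} {t} (j , _)) =
        wrap (≤-trans (s≤s (length-cells (columns d) t)) (total (J-bound j)))
      go (at-scan {vs = vs} {as} {d} {t} _ _ _ _ p) =
        wrap (≤-trans (size-focus _ (cells as t) (length as) (length-cells as t))
          (≤-trans (≤-reflexive (trans (cong (_+ suc (length as)) (length-done vs)) (cong suc (+-suc (length vs) (length as))))) (total p)))
      go (at-return {vs = vs} {as} {d} {t} _ _ _ _ p) =
        wrap (≤-trans (≤-reflexive (size-back vs (cells as t)))
          (≤-trans (+-monoʳ-≤ (length vs) (s≤s (length-cells as t)))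
            (≤-trans (≤-reflexive (trans (+-suc (length vs) (suc (length as))) (cong suc (+-suc (length vs) (length as))))) (total p))))

-- Commands

data Op (m : ℕ) : Set where
  setc     : Fin m → Bool → Op m
  copy differ : Fin m → Fin m → Op m
  inc      : Fin m → Op m

data Prim (m : ℕ) : Set where
  coin : Prim m
  look : (InputSymbol → Bool × Move × Maybe Bool) → Prim m
  op   : Op m → Prim m

infixr 5 _⨟_
data Cmd (m : ℕ) : Set where
  skip  : Cmd m
  _⨟_   : Cmd m → Cmd m → Cmd m
  cond  : Prim m → Cmd m → Cmd m → Cmd m
  while : Prim m → Cmd m → Cmd m

-- The meaning of the primitives is a parameter, so that one set of rules serves both for columns of
-- bits and for registers holding numbers.
module BigStep {m : ℕ} {S : Set} (sem : Prim m → S → Bool → S → Set) where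

  data Eval : Cmd m → S → S → Set where
    skip    : ∀ {σ} → Eval skip σ σ
    seq     : ∀ {C D σ ρ τ} → Eval C σ ρ → Eval D ρ τ → Eval (C ⨟ D) σ τ
    cond-t  : ∀ {p C D σ ρ τ} → sem p σ true ρ → Eval C ρ τ → Eval (cond p C D) σ τ
    cond-f  : ∀ {p C D σ ρ τ} → sem p σ false ρ → Eval D ρ τ → Eval (cond p C D) σ τ
    while-t : ∀ {p C σ ρ υ τ} → sem p σ true ρ → Eval C ρ υ → Eval (while p C) υ τ → Eval (while p C) σ τ
    while-f : ∀ {p C σ τ} → sem p σ false τ → Eval (while p C) σ τ

incBit : ∀ {m} → Fin m → Bool → Tup Bool m → Bool × Bool
incBit r c v = c ∧ get r v , c xor get r v

-- Each operation is a single scan. `setc` starts with carry `b`, writes it into the lowest column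
-- and zeros above it. `differ` writes `r` back unchanged and collects the differences in the carry.
-- `inc` is ripple-carry addition, whose final carry reports overflow.
opInstr : ∀ {m} → Op m → Instr m
opInstr (setc r b) = scan false r b (λ c v → false , c)
opInstr (copy r q) = scan false r false (λ c v → false , get q v)
opInstr (differ r q) = scan false r false (λ c v → c ∨ (get r v xor get q v) , get r v)
opInstr (inc r)    = scan false r true (incBit r)

primInstr : ∀ {m} → Prim m → Instr m
primInstr coin     = coin
primInstr (look f) = look f
primInstr (op o)   = opInstr o

link : ∀ {A B : Set} → (A → B) → Maybe B → Maybe A → Maybe B
link f e nothing  = e
link f e (just a) = just (f a)

link-link : ∀ {A B C : Set} (g : B → C) (f : A → B) e e′ z →
            link g e (link f e′ z) ≡ link (g ∘ f) (link g e e′) z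
link-link g f e e′ nothing  = refl
link-link g f e e′ (just _) = refl

-- One point per occurrence of a primitive; in `cond` and `while` the point `nothing` is the test.
-- In the results of `entry` and `after`, `nothing` means that the command is left, and `link`
-- replaces it by whatever follows.
Point : ∀ {m} → Cmd m → Set
Point skip         = ⊥
Point (C ⨟ D)      = Point C ⊎ Point D
Point (cond p C D) = Maybe (Point C ⊎ Point D)
Point (while p C)  = Maybe (Point C)

finite-Point : ∀ {m} (C : Cmd m) → Finite (Point C)
finite-Point skip         = finite-⊥
finite-Point (C ⨟ D)      = finite-⊎ (finite-Point C) (finite-Point D)
finite-Point (cond p C D) = finite-Maybe (finite-⊎ (finite-Point C) (finite-Point D))
finite-Point (while p C)  = finite-Maybe (finite-Point C)

entry : ∀ {m} (C : Cmd m) → Maybe (Point C)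
entry skip         = nothing
entry (C ⨟ D)      = link inj₁ (link inj₂ nothing (entry D)) (entry C)
entry (cond p C D) = just nothing
entry (while p C)  = just nothing

prim : ∀ {m} (C : Cmd m) → Point C → Prim m
prim (C ⨟ D)      (inj₁ q)        = prim C q
prim (C ⨟ D)      (inj₂ q)        = prim D q
prim (cond p C D) nothing         = p
prim (cond p C D) (just (inj₁ q)) = prim C q
prim (cond p C D) (just (inj₂ q)) = prim D q
prim (while p C)  nothing         = p
prim (while p C)  (just q)        = prim C q

after : ∀ {m} (C : Cmd m) → Point C → Bool → Maybe (Point C)
after (C ⨟ D)      (inj₁ q)        b     = link inj₁ (link inj₂ nothing (entry D)) (after C q b)
after (C ⨟ D)      (inj₂ q)        b     = link inj₂ nothing (after D q b)
after (cond p C D) nothing         true  = link (just ∘ inj₁) nothing (entry C)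
after (cond p C D) nothing         false = link (just ∘ inj₂) nothing (entry D)
after (cond p C D) (just (inj₁ q)) b     = link (just ∘ inj₁) nothing (after C q b)
after (cond p C D) (just (inj₂ q)) b     = link (just ∘ inj₂) nothing (after D q b)
after (while p C)  nothing         true  = link just (just nothing) (entry C)
after (while p C)  nothing         false = nothing
after (while p C)  (just q)        b     = link just (just nothing) (after C q b)

module Compilation {m : ℕ} (A : Automaton m) (x : Word) where
  open Automaton A
  open Simulation A using (Exec; done; step)
  open BigStep {m} {Store m} (λ p → Sem x (primInstr p))

  -- To recover a derivation of a `while` loop from an execution, one recurses on what remains after
  -- the body, which is no syntactic subterm; the length gives this recursion its measure.
  data Timed : ℕ → Maybe Node → Store m → Store m → Set where
    done : ∀ {d} → Timed 0 nothing d d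
    step : ∀ {k q d b d′ d″} → Sem x (instr q) d b d′ → Timed k (next q b) d′ d″ → Timed (suc k) (just q) d d″

  timed : ∀ {q d d′} → Exec x q d d′ → ∃[ k ] Timed k q d d′
  timed done = 0 , done
  timed (step s ex) = _ , step s (proj₂ (timed ex))

  -- A subcommand as it sits inside a larger program: its points are placed by `ι`, and control
  -- passes to `e` when it is left.
  record Embeds (C : Cmd m) (ι : Point C → Node) (e : Maybe Node) : Set where
    field
      instr-ι : ∀ q → instr (ι q) ≡ primInstr (prim C q)
      next-ι  : ∀ q b → next (ι q) b ≡ link ι e (after C q b)
  open Embeds

  embeds-seq₁ : ∀ {C D ι e} → Embeds (C ⨟ D) ι e → Embeds C (ι ∘ inj₁) (link (ι ∘ inj₂) e (entry D))
  instr-ι (embeds-seq₁ E) q = instr-ι E (inj₁ q)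
  next-ι (embeds-seq₁ {C} {D} {ι} {e} E) q b = trans (next-ι E (inj₁ q) b)
    (trans (link-link ι inj₁ e _ (after C q b))
      (cong (λ z → link (ι ∘ inj₁) z (after C q b)) (link-link ι inj₂ e nothing (entry D))))

  embeds-seq₂ : ∀ {C D ι e} → Embeds (C ⨟ D) ι e → Embeds D (ι ∘ inj₂) e
  instr-ι (embeds-seq₂ E) q = instr-ι E (inj₂ q)
  next-ι (embeds-seq₂ {C} {D} {ι} {e} E) q b =
    trans (next-ι E (inj₂ q) b) (link-link ι inj₂ e nothing (after D q b))

  embeds-cond₁ : ∀ {p C D ι e} → Embeds (cond p C D) ι e → Embeds C (ι ∘ just ∘ inj₁) e
  instr-ι (embeds-cond₁ E) q = instr-ι E (just (inj₁ q))
  next-ι (embeds-cond₁ {p} {C} {D} {ι} {e} E) q b =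
    trans (next-ι E (just (inj₁ q)) b) (link-link ι (just ∘ inj₁) e nothing (after C q b))

  embeds-cond₂ : ∀ {p C D ι e} → Embeds (cond p C D) ι e → Embeds D (ι ∘ just ∘ inj₂) e
  instr-ι (embeds-cond₂ E) q = instr-ι E (just (inj₂ q))
  next-ι (embeds-cond₂ {p} {C} {D} {ι} {e} E) q b =
    trans (next-ι E (just (inj₂ q)) b) (link-link ι (just ∘ inj₂) e nothing (after D q b))

  embeds-while : ∀ {p C ι e} → Embeds (while p C) ι e → Embeds C (ι ∘ just) (just (ι nothing))
  instr-ι (embeds-while E) q = instr-ι E (just q)
  next-ι (embeds-while {p} {C} {ι} {e} E) q b =
    trans (next-ι E (just q) b) (link-link ι just e (just nothing) (after C q b))

  entry-seq : ∀ (C D : Cmd m) (ι : Point (C ⨟ D) → Node) e →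
    link ι e (entry (C ⨟ D)) ≡ link (ι ∘ inj₁) (link (ι ∘ inj₂) e (entry D)) (entry C)
  entry-seq C D ι e = trans (link-link ι inj₁ e _ (entry C))
    (cong (λ z → link (ι ∘ inj₁) z (entry C)) (link-link ι inj₂ e nothing (entry D)))

  sem-at : ∀ {q p d b d′} → instr q ≡ primInstr p → Sem x (primInstr p) d b d′ → Sem x (instr q) d b d′
  sem-at eq s rewrite eq = s

  run⇒exec : ∀ {C : Cmd m} {ι e d d′ d″} → Embeds C ι e → Eval C d d′ → Exec x e d′ d″ → Exec x (link ι e (entry C)) d d″
  run⇒exec E skip ex = ex
  run⇒exec {C = C ⨟ D} {ι} {e} E (seq r₁ r₂) ex rewrite entry-seq C D ι e =
    run⇒exec (embeds-seq₁ {C} {D} {ι} {e} E) r₁ (run⇒exec (embeds-seq₂ {C} {D} {ι} {e} E) r₂ ex)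
  run⇒exec {C = cond p C D} {ι} {e} E (cond-t s r) ex = step (sem-at {p = p} (instr-ι E nothing) s)
    (subst (λ z → Exec x z _ _) (≡-sym (trans (next-ι E nothing true) (link-link ι (just ∘ inj₁) e nothing (entry C))))
      (run⇒exec (embeds-cond₁ {p} {C} {D} {ι} {e} E) r ex))
  run⇒exec {C = cond p C D} {ι} {e} E (cond-f s r) ex = step (sem-at {p = p} (instr-ι E nothing) s)
    (subst (λ z → Exec x z _ _) (≡-sym (trans (next-ι E nothing false) (link-link ι (just ∘ inj₂) e nothing (entry D))))
      (run⇒exec (embeds-cond₂ {p} {C} {D} {ι} {e} E) r ex))
  run⇒exec {C = while p C} {ι} {e} E (while-t s r r′) ex = step (sem-at {p = p} (instr-ι E nothing) s)
    (subst (λ z → Exec x z _ _) (≡-sym (trans (next-ι E nothing true) (link-link ι just e (just nothing) (entry C))))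
      (run⇒exec (embeds-while {p} {C} {ι} {e} E) r (run⇒exec E r′ ex)))
  run⇒exec {C = while p C} {ι} {e} E (while-f s) ex = step (sem-at {p = p} (instr-ι E nothing) s)
    (subst (λ z → Exec x z _ _) (≡-sym (next-ι E nothing false)) ex)

  exec⇒run : ∀ (C : Cmd m) {ι e k d d″} → Embeds C ι e → Timed k (link ι e (entry C)) d d″ →
    ∃[ d′ ] ∃[ l ] (l ≤ k × Eval C d d′ × Timed l e d′ d″)
  exec⇒run skip E ex = _ , _ , ≤-refl , skip , ex
  exec⇒run (C ⨟ D) {ι} {e} E ex rewrite entry-seq C D ι e with exec⇒run C (embeds-seq₁ {C} {D} {ι} {e} E) ex
  ... | _ , _ , p₁ , r₁ , ex₁ with exec⇒run D (embeds-seq₂ {C} {D} {ι} {e} E) ex₁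
  ... | _ , _ , p₂ , r₂ , ex₂ = _ , _ , ≤-trans p₂ p₁ , seq r₁ r₂ , ex₂
  exec⇒run (cond p C D) {ι} {e} E (step {b = true} s ex)
    rewrite instr-ι E nothing | next-ι E nothing true | link-link ι (just ∘ inj₁) e nothing (entry C)
    with exec⇒run C (embeds-cond₁ {p} {C} {D} {ι} {e} E) ex
  ... | _ , _ , p₁ , r , ex₁ = _ , _ , m≤n⇒m≤1+n p₁ , cond-t s r , ex₁
  exec⇒run (cond p C D) {ι} {e} E (step {b = false} s ex)
    rewrite instr-ι E nothing | next-ι E nothing false | link-link ι (just ∘ inj₂) e nothing (entry D)
    with exec⇒run D (embeds-cond₂ {p} {C} {D} {ι} {e} E) ex
  ... | _ , _ , p₁ , r , ex₁ = _ , _ , m≤n⇒m≤1+n p₁ , cond-f s r , ex₁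
  exec⇒run (while p C) {ι} {e} {d″ = d″} E ex = loop _ ≤-refl ex where
    loop : ∀ n {k d} → k ≤ n → Timed k (just (ι nothing)) d d″ →
      ∃[ d′ ] ∃[ l ] (l ≤ k × Eval (while p C) d d′ × Timed l e d′ d″)
    loop zero    ()       (step _ _)
    loop (suc n) (s≤s le) (step {b = false} s ex) rewrite instr-ι E nothing | next-ι E nothing false =
      _ , _ , m≤n⇒m≤1+n ≤-refl , while-f s , ex
    loop (suc n) (s≤s le) (step {b = true} s ex)
      rewrite instr-ι E nothing | next-ι E nothing true | link-link ι just e (just nothing) (entry C)
      with exec⇒run C (embeds-while {p} {C} {ι} {e} E) ex
    ... | _ , _ , p₁ , r , ex₁ with loop n (≤-trans p₁ le) ex₁
    ... | _ , _ , p₂ , r′ , ex₂ = _ , _ , m≤n⇒m≤1+n (≤-trans p₂ p₁) , while-t s r r′ , ex₂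

-- Columns of bits as binary numbers

bit : Bool → ℕ
bit true  = 1
bit false = 0

combine : ∀ {m} → Tup Bool m → Tup ℕ m → Tup ℕ m
combine {zero}  _       _       = _
combine {suc m} (b , c) (v , t) = bit b + 2 * v , combine c t

values : ∀ {m} → List (Tup Bool m) → Tup ℕ m
values {m} []       = const-tup 0 m
values     (c ∷ cs) = combine c (values cs)

get-combine : ∀ {m} i (c : Tup Bool m) t → get i (combine c t) ≡ bit (get i c) + 2 * get i t
get-combine zero    c t = refl
get-combine (suc i) c t = get-combine i (proj₂ c) (proj₂ t)

set-combine : ∀ {m} i b (c : Tup Bool m) v t → combine (set i b c) (set i v t) ≡ set i (bit b + 2 * v) (combine c t)
set-combine zero    b c v t = refl
set-combine (suc i) b c v t = cong (_ ,_) (set-combine i b (proj₂ c) v (proj₂ t))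

set-get : ∀ {m} {A : Set} i (t : Tup A m) → set i (get i t) t ≡ t
set-get zero    t = refl
set-get (suc i) t = cong (_ ,_) (set-get i (proj₂ t))

get-const : ∀ {m} {A : Set} (a : A) (i : Fin m) → get i (const-tup a m) ≡ a
get-const a zero    = refl
get-const a (suc i) = get-const a i

set-const : ∀ {m} {A : Set} (a : A) (i : Fin m) → set i a (const-tup a m) ≡ const-tup a m
set-const a zero    = refl
set-const a (suc i) = cong (a ,_) (set-const a i)

combine-const : ∀ m → combine (const-tup false m) (const-tup 0 m) ≡ const-tup 0 m
combine-const zero    = refl
combine-const (suc m) = cong (0 ,_) (combine-const m)

scanValue : ∀ {m} → (Bool → Tup Bool m → Bool × Bool) → Bool → List (Tup Bool m) → ℕ
scanValue f c []       = 0
scanValue f c (a ∷ as) = bit (proj₂ (f c a)) + 2 * scanValue f (proj₁ (f c a)) as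

values-scan : ∀ {m} (r : Fin m) f c cs →
  values (scanColumns false r f c cs) ≡ set r (scanValue f c cs) (values cs)
values-scan r f c []       = ≡-sym (set-const 0 r)
values-scan r f c (a ∷ as) = trans (cong (combine _) (values-scan r f _ as)) (set-combine r _ a _ _)

length-scan : ∀ {m} (r : Fin m) f c cs → length (scanColumns false r f c cs) ≡ length cs
length-scan r f c []       = refl
length-scan r f c (a ∷ as) = cong suc (length-scan r f _ as)

bit-<2 : ∀ b → bit b < 2
bit-<2 true  = ≤-refl
bit-<2 false = s≤s z≤n

value-< : ∀ {m} (r : Fin m) cs → get r (values cs) < 2 ^ length cs
value-< {m} r []       = subst (_< 1) (≡-sym (get-const 0 r)) (s≤s z≤n)
value-< r (c ∷ cs) rewrite get-combine r c (values cs) = begin-strict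
  bit (get r c) + 2 * v  <⟨ +-monoˡ-< (2 * v) (bit-<2 (get r c)) ⟩
  2 + 2 * v              ≡⟨ *-suc 2 v ⟨
  2 * suc v              ≤⟨ *-monoʳ-≤ 2 (value-< r cs) ⟩
  2 * 2 ^ length cs      ∎
  where
  open ≤-Reasoning
  v = get r (values cs)

-- One column is required, since without columns there is no place for a 1.
setc-value : ∀ {m} b (cs : List (Tup Bool m)) → 0 < length cs → scanValue (λ c v → false , c) b cs ≡ bit b
setc-value b (a ∷ as) _ = trans (cong (λ z → bit b + 2 * z) (zeros as)) (+-identityʳ (bit b)) where
  zeros : ∀ {m} (cs : List (Tup Bool m)) → scanValue (λ c v → false , c) false cs ≡ 0
  zeros []       = refl
  zeros (a ∷ as) = cong (2 *_) (zeros as)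

setc-carry : ∀ {m} b (cs : List (Tup Bool m)) → 0 < length cs → scanCarry (λ c v → false , c) b cs ≡ false
setc-carry b (a ∷ as) _ = final as where
  final : ∀ {m} (cs : List (Tup Bool m)) → scanCarry (λ c v → false , c) false cs ≡ false
  final []       = refl
  final (a ∷ as) = final as

copy-value : ∀ {m} (q : Fin m) c cs → scanValue (λ _ v → false , get q v) c cs ≡ get q (values cs)
copy-value q c []       = ≡-sym (get-const 0 q)
copy-value q c (a ∷ as) = trans (cong (λ z → bit (get q a) + 2 * z) (copy-value q false as)) (≡-sym (get-combine q a _))

copy-carry : ∀ {m} (q : Fin m) cs → scanCarry (λ _ v → false , get q v) false cs ≡ false
copy-carry q []       = refl
copy-carry q (a ∷ as) = copy-carry q as

differ-value : ∀ {m} (r q : Fin m) c cs →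
  scanValue (λ c v → c ∨ (get r v xor get q v) , get r v) c cs ≡ get r (values cs)
differ-value r q c []       = ≡-sym (get-const 0 r)
differ-value r q c (a ∷ as) = trans (cong (λ z → bit (get r a) + 2 * z) (differ-value r q _ as)) (≡-sym (get-combine r a _))

bit-injective : ∀ a b v w → bit a + 2 * v ≡ bit b + 2 * w → a ≡ b × v ≡ w
bit-injective true  true  v w p = refl , *-cancelˡ-≡ v w 2 (suc-injective p)
bit-injective false false v w p = refl , *-cancelˡ-≡ v w 2 p
bit-injective true  false v w p = contradiction (≡-sym p) (even≢odd w v)
bit-injective false true  v w p = contradiction p (even≢odd v w)

neq : ℕ → ℕ → Bool
neq v w = not ⌊ v ≟ w ⌋

neq-≡ : ∀ {v w} → v ≡ w → neq v w ≡ false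
neq-≡ {v} {w} p with v ≟ w
... | yes _ = refl
... | no ¬p = contradiction p ¬p

neq-≢ : ∀ {v w} → v ≢ w → neq v w ≡ true
neq-≢ {v} {w} ¬p with v ≟ w
... | yes p = contradiction p ¬p
... | no _  = refl

neq-bit : ∀ a b v w → neq (bit a + 2 * v) (bit b + 2 * w) ≡ (a xor b) ∨ neq v w
neq-bit a b v w with bit a + 2 * v ≟ bit b + 2 * w
neq-bit a b v w | yes p with bit-injective a b v w p
... | refl , refl rewrite xor-same a = ≡-sym (neq-≡ {v} refl)
neq-bit true  true  v w | no ¬p = ≡-sym (neq-≢ (λ q → ¬p (cong (λ z → 1 + 2 * z) q)))
neq-bit false false v w | no ¬p = ≡-sym (neq-≢ (λ q → ¬p (cong (2 *_) q)))
neq-bit true  false v w | no ¬p = refl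
neq-bit false true  v w | no ¬p = refl

differ-carry : ∀ {m} (r q : Fin m) c cs →
  scanCarry (λ c v → c ∨ (get r v xor get q v) , get r v) c cs ≡ c ∨ neq (get r (values cs)) (get q (values cs))
differ-carry {m} r q c [] rewrite get-const {m} 0 r | get-const {m} 0 q = ≡-sym (∨-identityʳ c)
differ-carry r q c (a ∷ as)
  rewrite get-combine r a (values as) | get-combine q a (values as)
  | neq-bit (get r a) (get q a) (get r (values as)) (get q (values as)) =
  trans (differ-carry r q (c ∨ (get r a xor get q a)) as) (∨-assoc c _ _)

-- One column of adding a carry to a binary number. `v` and `w` are the higher parts before and
-- after, and `k` absorbs the weight of the final carry, so that the equation can be iterated over
-- the columns.
half-adder : ∀ c b v w k → w + k ≡ v + bit (c ∧ b) → bit (c xor b) + 2 * w + 2 * k ≡ bit b + 2 * v + bit c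
half-adder c b v w k p = begin
  bit (c xor b) + 2 * w + 2 * k             ≡⟨ solve 3 (λ s w k → s :+ con 2 :* w :+ con 2 :* k := s :+ con 2 :* (w :+ k)) refl (bit (c xor b)) w k ⟩
  bit (c xor b) + 2 * (w + k)               ≡⟨ cong (λ z → bit (c xor b) + 2 * z) p ⟩
  bit (c xor b) + 2 * (v + bit (c ∧ b))     ≡⟨ solve 3 (λ s v t → s :+ con 2 :* (v :+ t) := con 2 :* v :+ (s :+ con 2 :* t)) refl (bit (c xor b)) v (bit (c ∧ b)) ⟩
  2 * v + (bit (c xor b) + 2 * bit (c ∧ b)) ≡⟨ cong (_+_ (2 * v)) (adder c b) ⟩
  2 * v + (bit b + bit c)                   ≡⟨ solve 3 (λ v b c → con 2 :* v :+ (b :+ c) := b :+ con 2 :* v :+ c) refl v (bit b) (bit c) ⟩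
  bit b + 2 * v + bit c                     ∎
  where
  open ≡-Reasoning
  open +-*-Solver
  adder : ∀ c b → bit (c xor b) + 2 * bit (c ∧ b) ≡ bit b + bit c
  adder true  true  = refl
  adder true  false = refl
  adder false true  = refl
  adder false false = refl

inc-value : ∀ {m} (r : Fin m) c cs →
  scanValue (incBit r) c cs + 2 ^ length cs * bit (scanCarry (incBit r) c cs) ≡ get r (values cs) + bit c
inc-value {m} r c [] rewrite get-const {m} 0 r = +-identityʳ (bit c)
inc-value r c (a ∷ as) rewrite get-combine r a (values as) =
  trans (cong (_+_ (bit (c xor get r a) + 2 * scanValue (incBit r) (c ∧ get r a) as)) (*-assoc 2 (2 ^ length as) _))
    (half-adder c (get r a) _ (scanValue (incBit r) (c ∧ get r a) as) _ (inc-value r (c ∧ get r a) as))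

-- Registers holding numbers, and their simulation by columns

record State (m : ℕ) : Set where
  constructor state
  field
    head : ℕ
    regs : Tup ℕ m
    outp : Word
open State public

evalOp : ∀ {m} → ℕ → Op m → Tup ℕ m → Bool × Tup ℕ m
evalOp B (setc r b) t = false , set r (bit b) t
evalOp B (copy r q) t = false , set r (get q t) t
evalOp B (differ r q) t = neq (get r t) (get q t) , t
evalOp B (inc r)    t with suc (get r t) <? B
... | yes _ = false , set r (suc (get r t)) t
... | no  _ = true , set r 0 t

evalPrim : ∀ {m} → ℕ → Word → Prim m → State m → Bool × State m
evalPrim B x coin     σ = false , σ
evalPrim B x (look f) (state p t o) = evalLook x f (λ p′ o′ → state p′ t o′) p o
evalPrim B x (op u)   (state p t o) = proj₁ (evalOp B u t) , state p (proj₂ (evalOp B u t)) o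

semantics : ∀ {m} → ℕ → Word → Prim m → State m → Bool → State m → Set
semantics B x coin       σ b τ = τ ≡ σ
semantics B x p@(look _) σ b τ = evalPrim B x p σ ≡ (b , τ)
semantics B x p@(op _)   σ b τ = evalPrim B x p σ ≡ (b , τ)

abstraction : ∀ {m} → Store m → State m
abstraction (store p cs o) = state p (values cs) o

-- The final carry has weight `2 ^ length cs`, and the old and the new value are both below this
-- weight. So the carry is 1 exactly when the successor reaches it, and the new value is then 0.
inc-op : ∀ {m} (r : Fin m) cs → evalOp (2 ^ length cs) (inc r) (values cs) ≡
  (scanCarry (incBit r) true cs , set r (scanValue (incBit r) true cs) (values cs))
inc-op r cs with scanCarry (incBit r) true cs | inc-value r true cs | suc (get r (values cs)) <? 2 ^ length cs
... | false | p | yes lt = cong (λ z → false , set r z (values cs))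
  (≡-sym (trans (≡-sym (+-identityʳ _)) (trans (cong (_+_ (scanValue (incBit r) true cs)) (≡-sym (*-zeroʳ (2 ^ length cs))))
    (trans p (+-comm _ 1)))))
... | false | p | no ge = contradiction (subst (_< 2 ^ length cs) q (bounded r true cs)) ge where
  q : scanValue (incBit r) true cs ≡ suc (get r (values cs))
  q = trans (≡-sym (+-identityʳ _)) (trans (cong (_+_ (scanValue (incBit r) true cs)) (≡-sym (*-zeroʳ (2 ^ length cs))))
    (trans p (+-comm _ 1)))
  bounded : ∀ {m} (r : Fin m) c cs → scanValue (incBit r) c cs < 2 ^ length cs
  bounded r c []       = s≤s z≤n
  bounded r c (a ∷ as) = begin-strict
    bit (c xor get r a) + 2 * v  <⟨ +-monoˡ-< (2 * v) (bit-<2 (c xor get r a)) ⟩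
    2 + 2 * v                    ≡⟨ *-suc 2 v ⟨
    2 * suc v                    ≤⟨ *-monoʳ-≤ 2 (bounded r (c ∧ get r a) as) ⟩
    2 * 2 ^ length as            ∎
    where
    open ≤-Reasoning
    v = scanValue (incBit r) (c ∧ get r a) as
... | true | p | yes lt = contradiction (≤-trans lt (≤-trans (m≤n+m _ _) (≤-reflexive q))) (<-irrefl refl) where
  q : scanValue (incBit r) true cs + 2 ^ length cs ≡ suc (get r (values cs))
  q = trans (cong (_+_ (scanValue (incBit r) true cs)) (≡-sym (*-identityʳ (2 ^ length cs)))) (trans p (+-comm _ 1))
... | true | p | no ge = cong (λ z → true , set r z (values cs)) (≡-sym (n≤0⇒n≡0 (+-cancelʳ-≤ (2 ^ length cs) _ 0 le))) where
  le : scanValue (incBit r) true cs + 2 ^ length cs ≤ 2 ^ length cs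
  le = ≤-trans (≤-reflexive (trans (cong (_+_ (scanValue (incBit r) true cs)) (≡-sym (*-identityʳ (2 ^ length cs)))) (trans p (+-comm _ 1))))
    (value-< r cs)

evalOp-scan : ∀ {m} x (u : Op m) p cs o → 0 < length cs →
  evalPrim (2 ^ length cs) x (op u) (state p (values cs) o) ≡
  (proj₁ (evalInstr x (opInstr u) (store p cs o)) , abstraction (proj₂ (evalInstr x (opInstr u) (store p cs o))))
evalOp-scan x (setc r b) p cs o pos = cong₂ (λ c t → c , state p t o) (≡-sym (setc-carry b cs pos))
  (≡-sym (trans (values-scan r _ b cs) (cong (λ v → set r v (values cs)) (setc-value b cs pos))))
evalOp-scan x (copy r q) p cs o pos = cong₂ (λ c t → c , state p t o) (≡-sym (copy-carry q cs))
  (≡-sym (trans (values-scan r _ false cs) (cong (λ v → set r v (values cs)) (copy-value q false cs))))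
evalOp-scan x (differ r q) p cs o pos = cong₂ (λ c t → c , state p t o) (≡-sym (differ-carry r q false cs))
  (≡-sym (trans (values-scan r _ false cs) (trans (cong (λ v → set r v (values cs)) (differ-value r q false cs)) (set-get r (values cs)))))
evalOp-scan x (inc r) p cs o pos = trans (cong (λ z → proj₁ z , state p (proj₂ z) o) (inc-op r cs))
  (cong (λ t → scanCarry (incBit r) true cs , state p t o) (≡-sym (values-scan r _ true cs)))

-- No primitive of a command extends the tape, so the width is constant and overflow always happens
-- at the same `B`. The two levels simulate each other: `down` serves the existence of a halting
-- run, `up` the uniqueness of its output.
module Abstraction {m : ℕ} (x : Word) (width : ℕ) (width>0 : 0 < width) where
  B : ℕ
  B = 2 ^ width

  module Low  = BigStep {m} {Store m} (λ p → Sem x (primInstr p))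
  module High = BigStep {m} {State m} (semantics B x)

  eval : ∀ (p : Prim m) d → length (columns d) ≡ width →
    evalPrim B x p (abstraction d) ≡
    (proj₁ (evalInstr x (primInstr p) d) , abstraction (proj₂ (evalInstr x (primInstr p) d)))
  eval coin     d eq = refl
  eval (look f) d eq = refl
  eval (op u)   (store p cs o) refl = evalOp-scan x u p cs o width>0

  keeps-width : ∀ (p : Prim m) d → length (columns (proj₂ (evalInstr x (primInstr p) d))) ≡ length (columns d)
  keeps-width coin     d = refl
  keeps-width (look f) d = refl
  keeps-width (op (setc r b)) d = length-scan r _ b (columns d)
  keeps-width (op (copy r q)) d = length-scan r _ false (columns d)
  keeps-width (op (differ r q)) d = length-scan r _ false (columns d)
  keeps-width (op (inc r))    d = length-scan r _ true (columns d)

  graph-low : ∀ (p : Prim m) {d b d′} → Sem x (primInstr p) d b d′ → (p ≡ coin × d′ ≡ d) ⊎ evalInstr x (primInstr p) d ≡ (b , d′)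
  graph-low coin     s = inj₁ (refl , s)
  graph-low (look f) s = inj₂ s
  graph-low (op (setc r b)) s = inj₂ s
  graph-low (op (copy r q)) s = inj₂ s
  graph-low (op (differ r q)) s = inj₂ s
  graph-low (op (inc r))    s = inj₂ s

  low-eval : ∀ (p : Prim m) d → p ≢ coin →
    Sem x (primInstr p) d (proj₁ (evalInstr x (primInstr p) d)) (proj₂ (evalInstr x (primInstr p) d))
  low-eval coin     d ¬c = contradiction refl ¬c
  low-eval (look f) d ¬c = refl
  low-eval (op (setc r b)) d ¬c = refl
  low-eval (op (copy r q)) d ¬c = refl
  low-eval (op (differ r q)) d ¬c = refl
  low-eval (op (inc r))    d ¬c = refl

  width-sem : ∀ (p : Prim m) {d b d′} → Sem x (primInstr p) d b d′ → length (columns d′) ≡ length (columns d)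
  width-sem p {d} s with graph-low p s
  ... | inj₁ (_ , refl) = refl
  ... | inj₂ eq = trans (cong (length ∘ columns ∘ proj₂) (≡-sym eq)) (keeps-width p d)

  up-sem : ∀ (p : Prim m) {d b d′} → length (columns d) ≡ width → Sem x (primInstr p) d b d′ →
    semantics B x p (abstraction d) b (abstraction d′)
  up-sem coin     w refl = refl
  up-sem p@(look f) {d} w s = trans (eval p d w) (cong (λ z → proj₁ z , abstraction (proj₂ z)) s)
  up-sem p@(op u) {d} w s with graph-low p s
  ... | inj₂ eq = trans (eval p d w) (cong (λ z → proj₁ z , abstraction (proj₂ z)) eq)

  down-sem : ∀ (p : Prim m) {d b τ} → length (columns d) ≡ width → semantics B x p (abstraction d) b τ →
    ∃[ d′ ] (Sem x (primInstr p) d b d′ × abstraction d′ ≡ τ)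
  down-sem coin {d} w refl = d , refl , refl
  down-sem p@(look f) {d} {b} {τ} w s with trans (≡-sym (eval p d w)) s
  ... | refl = _ , refl , refl
  down-sem p@(op u) {d} {b} {τ} w s with trans (≡-sym (eval p d w)) s
  ... | refl = _ , low-eval p d (λ ()) , refl

  width-run : ∀ {C d d′} → Low.Eval C d d′ → length (columns d′) ≡ length (columns d)
  width-run Low.skip = refl
  width-run (Low.seq r r′) = trans (width-run r′) (width-run r)
  width-run (Low.cond-t {p} s r) = trans (width-run r) (width-sem p s)
  width-run (Low.cond-f {p} s r) = trans (width-run r) (width-sem p s)
  width-run (Low.while-t {p} s r r′) = trans (width-run r′) (trans (width-run r) (width-sem p s))
  width-run (Low.while-f {p} s) = width-sem p s

  up : ∀ {C d d′} → length (columns d) ≡ width → Low.Eval C d d′ → High.Eval C (abstraction d) (abstraction d′)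
  up w Low.skip = High.skip
  up w (Low.seq r r′) = High.seq (up w r) (up (trans (width-run r) w) r′)
  up w (Low.cond-t {p} s r) = High.cond-t (up-sem p w s) (up (trans (width-sem p s) w) r)
  up w (Low.cond-f {p} s r) = High.cond-f (up-sem p w s) (up (trans (width-sem p s) w) r)
  up w (Low.while-t {p} s r r′) = High.while-t (up-sem p w s) (up (trans (width-sem p s) w) r)
    (up (trans (width-run r) (trans (width-sem p s) w)) r′)
  up w (Low.while-f {p} s) = High.while-f (up-sem p w s)

  down : ∀ {C d σ τ} → length (columns d) ≡ width → abstraction d ≡ σ → High.Eval C σ τ →
    ∃[ d′ ] (Low.Eval C d d′ × abstraction d′ ≡ τ)
  down w refl High.skip = _ , Low.skip , refl
  down w refl (High.seq r r′) with down w refl r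
  ... | d₁ , s₁ , e₁ with down (trans (width-run s₁) w) e₁ r′
  ... | d₂ , s₂ , e₂ = d₂ , Low.seq s₁ s₂ , e₂
  down w refl (High.cond-t {p} s r) with down-sem p w s
  ... | d₁ , s₁ , e₁ with down (trans (width-sem p s₁) w) e₁ r
  ... | d₂ , s₂ , e₂ = d₂ , Low.cond-t s₁ s₂ , e₂
  down w refl (High.cond-f {p} s r) with down-sem p w s
  ... | d₁ , s₁ , e₁ with down (trans (width-sem p s₁) w) e₁ r
  ... | d₂ , s₂ , e₂ = d₂ , Low.cond-f s₁ s₂ , e₂
  down w refl (High.while-t {p} s r r′) with down-sem p w s
  ... | d₁ , s₁ , e₁ with down (trans (width-sem p s₁) w) e₁ r
  ... | d₂ , s₂ , e₂ with down (trans (width-run s₂) (trans (width-sem p s₁) w)) e₂ r′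
  ... | d₃ , s₃ , e₃ = d₃ , Low.while-t s₁ s₂ s₃ , e₃
  down w refl (High.while-f {p} s) with down-sem p w s
  ... | d₁ , s₁ , e₁ = d₁ , Low.while-f s₁ , e₁

-- Before the command starts, the machine counts its input cells in binary in
-- register 0, adding columns as needed.  This lays out logarithmically many
-- columns, whose number then stays fixed.

advance : InputSymbol → Bool × Move × Maybe Bool
advance ⊣ = false , stay , nothing
advance _ = true , right , nothing

program : ∀ {m} → Cmd (suc m) → Automaton (suc m)
program C = record
  { Node   = Maybe (Maybe (Point C))
  ; finite = finite-Maybe (finite-Maybe (finite-Point C))
  ; begin  = nothing
  ; instr  = λ { nothing → look advance
               ; (just nothing) → scan true zero true (incBit zero)
               ; (just (just q)) → primInstr (prim C q) }
  ; next   = λ { nothing true → just (just nothing)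
               ; nothing false → link (just ∘ just) nothing (entry C)
               ; (just nothing) b → just nothing
               ; (just (just q)) b → link (just ∘ just) nothing (after C q b) }
  }

layout : ∀ {m} → ℕ → List (Tup Bool (suc m))
layout zero    = []
layout (suc i) = scanColumns true zero (incBit zero) true (layout i)

values-extend : ∀ {m} c (cs : List (Tup Bool (suc m))) →
  values (scanColumns true zero (incBit zero) c cs) ≡ (proj₁ (values cs) + bit c , proj₂ (values cs))
values-extend {m} true  [] = cong (1 ,_) (combine-const m)
values-extend     false [] = refl
values-extend c ((b , a) ∷ as) rewrite values-extend (c ∧ b) as =
  cong (_, combine a (proj₂ (values as)))
    (trans (≡-sym (+-identityʳ _)) (half-adder c b v (v + bit (c ∧ b)) 0 (+-identityʳ _)))
  where v = proj₁ (values as)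

values-layout : ∀ {m} i → values (layout {m} i) ≡ (i , const-tup 0 m)
values-layout zero = refl
values-layout {m} (suc i) = trans (values-extend true (layout i))
  (cong₂ _,_ (trans (cong (λ t → proj₁ t + 1) (values-layout {m} i)) (+-comm i 1)) (cong proj₂ (values-layout i)))

length-extend : ∀ {m} c (cs : List (Tup Bool (suc m))) →
  length (scanColumns true zero (incBit zero) c cs) ≡ length cs + bit (scanCarry (incBit zero) c cs)
length-extend true  [] = refl
length-extend false [] = refl
length-extend c (a ∷ as) = cong suc (length-extend (c ∧ proj₁ a) as)

layout-mono : ∀ {m} i j → length (layout {m} i) ≤ length (layout {m} (j + i))
layout-mono i zero    = ≤-refl
layout-mono {m} i (suc j) = ≤-trans (layout-mono i j)
  (≤-trans (m≤m+n _ _) (≤-reflexive (≡-sym (length-extend true (layout {m} (j + i))))))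

layout-capacity : ∀ {m} i → i < 2 ^ length (layout {m} i)
layout-capacity {m} i = subst (_< 2 ^ length (layout {m} i)) (cong proj₁ (values-layout {m} i)) (value-< zero (layout {m} i))

-- A column is added only on overflow, that is, when the count reaches a power of two; so the width
-- is logarithmic in the count.
layout-length : ∀ {m} i → 2 ^ pred (length (layout {m} i)) ≤ suc i
layout-length zero = ≤-refl
layout-length {m} (suc i) with scanCarry (incBit zero) true (layout {m} i) | length-extend true (layout {m} i) | inc-value zero true (layout {m} i)
... | false | p | _ rewrite p | +-identityʳ (length (layout {m} i)) = m≤n⇒m≤1+n (layout-length {m} i)
... | true  | p | q rewrite p | +-comm (length (layout {m} i)) 1 = ≤-trans (m≤n+m _ _)
  (≤-trans (≤-reflexive (trans (cong (_+_ (scanValue (incBit zero) true (layout {m} i))) (≡-sym (*-identityʳ _))) q))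
    (≤-trans (≤-reflexive (trans (cong (λ t → proj₁ t + 1) (values-layout {m} i)) (+-comm i 1))) (n≤1+n _)))

readInput-inside : ∀ x i → i ≤ length x → readInput x i ≢ ⊣
readInput-inside x       zero          p       ()
readInput-inside (b ∷ x) (suc zero)    p       ()
readInput-inside (b ∷ x) (suc (suc i)) (s≤s p) = readInput-inside x (suc i) p

readInput-beyond : ∀ x i → length x < i → readInput x i ≡ ⊣
readInput-beyond []      (suc i)       p       = refl
readInput-beyond (b ∷ x) (suc (suc i)) (s≤s p) = readInput-beyond x (suc i) p

advance-inside : ∀ a → a ≢ ⊣ → advance a ≡ (true , right , nothing)
advance-inside ⊢       p = refl
advance-inside ⊣       p = contradiction refl p
advance-inside (sym _) p = refl

module Program {m : ℕ} (C : Cmd (suc m)) (x : Word) where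
  A : Automaton (suc m)
  A = program C

  open Automaton A
  open Simulation A public using (machine)
  open Simulation A using (Exec; done; step; initialStore; complete; module Invariant)
  open Compilation A x

  size : ℕ
  size = suc (length x)

  width : ℕ
  width = length (layout {m} size)

  width>0 : 0 < width
  width>0 with width | layout-capacity {m} size
  ... | zero  | s≤s ()
  ... | suc _ | _ = s≤s z≤n

  capacity : size < 2 ^ width
  capacity = layout-capacity {m} size

  open Abstraction {suc m} x width width>0

  counted : ℕ → Store (suc m)
  counted i = store i (layout i) []

  advance-step : ∀ i cs → i ≤ length x → evalInstr x (look advance) (store {suc m} i cs []) ≡ (true , store (suc i) cs [])
  advance-step i cs p rewrite advance-inside (readInput x i) (readInput-inside x i p) =
    cong (λ j → true , store j cs []) (m≤n⇒m⊓n≡m (s≤s p))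

  advance-stop : ∀ cs → evalInstr x (look advance) (store {suc m} size cs []) ≡ (false , store size cs [])
  advance-stop cs rewrite readInput-beyond x size ≤-refl = refl

  command : Maybe Node
  command = link (just ∘ just) nothing (entry C)

  prelude-in : ∀ j i → i + j ≡ size → ∀ {d} → Exec x command (counted size) d → Exec x (just nothing) (counted i) d
  prelude-in zero i eq ex with trans (≡-sym (+-identityʳ i)) eq
  ... | refl = step (advance-stop _) ex
  prelude-in (suc j) i eq ex = step (advance-step i _ i≤) (step refl (prelude-in j (suc i) (trans (≡-sym (+-suc i j)) eq) ex))
    where
    i≤ : i ≤ length x
    i≤ = ≤-pred (≤-trans (m≤m+n (suc i) j) (≤-reflexive (trans (≡-sym (+-suc i j)) eq)))

  prelude-out : ∀ j i → i + j ≡ size → ∀ {d} → Exec x (just nothing) (counted i) d → Exec x command (counted size) d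
  prelude-out zero i eq (step s ex) with trans (≡-sym (+-identityʳ i)) eq
  ... | refl with trans (≡-sym (advance-stop _)) s
  ... | refl = ex
  prelude-out (suc j) i eq (step s ex) with trans (≡-sym (advance-step i (layout i) i≤)) s
    where
    i≤ : i ≤ length x
    i≤ = ≤-pred (≤-trans (m≤m+n (suc i) j) (≤-reflexive (trans (≡-sym (+-suc i j)) eq)))
  prelude-out (suc j) i eq (step s (step refl ex)) | refl = prelude-out j (suc i) (trans (≡-sym (+-suc i j)) eq) ex

  -- While the input is being counted the whole store is known; afterwards only the width is
  -- retained, which is all that the space bound and the simulation use.
  Layout : Maybe Node → Store (suc m) → Set
  Layout (just nothing)        d = ∃[ i ] (i ≤ size × d ≡ counted i)
  Layout (just (just nothing)) d = ∃[ i ] (suc i ≤ size × d ≡ store (suc i) (layout i) [])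
  Layout _                     d = length (columns d) ≡ width

  layout-step : ∀ {q d b d′} → Layout (just q) d → Sem x (instr q) d b d′ → Layout (next q b) d′
  layout-step {nothing} (i , i≤ , refl) s with i ≤? length x
  ... | yes p with trans (≡-sym (advance-step i (layout i) p)) s
  ... | refl = i , s≤s p , refl
  layout-step {nothing} (i , i≤ , refl) s | no ¬p with ≤-antisym i≤ (≰⇒> ¬p)
  ... | refl with trans (≡-sym (advance-stop (layout size))) s
  ... | refl with entry C
  ... | nothing = refl
  ... | just _  = refl
  layout-step {just nothing} (i , i≤ , refl) refl = suc i , i≤ , refl
  layout-step {just (just q)} {b = b} w s with after C q b
  ... | nothing = trans (width-sem (prim C q) s) w
  ... | just _  = trans (width-sem (prim C q) s) w

  layout-bound : ∀ {q d} → Layout q d → length (columns d) ≤ width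
  layout-bound {just nothing}         (i , i≤ , refl) =
    subst (λ z → length (layout {m} i) ≤ length (layout {m} z)) (m∸n+n≡m i≤) (layout-mono {m} i (size ∸ i))
  layout-bound {just (just nothing)}  (i , i≤ , refl) =
    subst (λ z → length (layout {m} i) ≤ length (layout {m} z)) (m∸n+n≡m (≤-trans (n≤1+n i) i≤)) (layout-mono {m} i (size ∸ i))
  layout-bound {just (just (just _))} w = ≤-reflexive w
  layout-bound {nothing}              w = ≤-reflexive w

  open Invariant x Layout width (0 , z≤n , refl) (λ {q} → layout-step {q}) (λ {q} → layout-bound {q})

  embeds : Embeds C (just ∘ just) nothing
  embeds = record { instr-ι = λ _ → refl ; next-ι = λ _ _ → refl }

  initialState : State (suc m)
  initialState = state size (size , const-tup 0 m) []

  counted-state : abstraction (counted size) ≡ initialState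
  counted-state = cong (λ t → state size t []) (values-layout size)

  -- Big-step derivations describe terminating runs, and these are the ones `Yields` constrains;
  -- diverging guesses have no derivation at all.
  yields : ∀ y → (∃[ τ ] High.Eval C initialState τ) → (∀ τ → High.Eval C initialState τ → outp τ ≡ y) →
           Yields machine x y
  yields y (τ , r) all = halting , outputs where
    halting : _
    halting with down refl counted-state r
    ... | d , r′ , _ with complete x d (prelude-in size 0 refl (run⇒exec embeds r′ done))
    ... | c , reach , halted , _ = c , reach , halted
    outputs : _
    outputs c reach halted with sound c reach halted
    ... | d , ex , eq with exec⇒run C embeds (proj₂ (timed (prelude-out size 0 refl ex)))
    ... | _ , _ , _ , r′ , done = trans eq (all (abstraction d) (subst (λ σ → High.Eval C σ (abstraction d)) counted-state (up refl r′)))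

  space : UsesSpace machine x (width + 2)
  space = space-bound

-- Logarithms and the space bound

n≤2^⌈log2⌉n : ∀ n (a : Acc _<_ n) → n ≤ 2 ^ ⌈log2⌉ n a
n≤2^⌈log2⌉n 0 a = z≤n
n≤2^⌈log2⌉n 1 a = ≤-refl
n≤2^⌈log2⌉n (suc (suc n)) (acc rs) = begin
  suc (suc n)                            ≤⟨ s≤s (s≤s (n≤2*⌈n/2⌉ n)) ⟩
  2 + 2 * ⌈ n /2⌉                        ≡⟨ *-suc 2 ⌈ n /2⌉ ⟨
  2 * suc ⌈ n /2⌉                        ≤⟨ *-monoʳ-≤ 2 (n≤2^⌈log2⌉n (suc ⌈ n /2⌉) (rs (⌈n/2⌉<n n))) ⟩
  2 * 2 ^ ⌈log2⌉ (suc ⌈ n /2⌉) (rs (⌈n/2⌉<n n)) ∎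
  where
  open ≤-Reasoning
  n≤2*⌈n/2⌉ : ∀ n → n ≤ 2 * ⌈ n /2⌉
  n≤2*⌈n/2⌉ 0 = z≤n
  n≤2*⌈n/2⌉ 1 = s≤s z≤n
  n≤2*⌈n/2⌉ (suc (suc n)) = ≤-trans (s≤s (s≤s (n≤2*⌈n/2⌉ n))) (≤-reflexive (≡-sym (*-suc 2 ⌈ n /2⌉)))

n<2^n : ∀ n → n < 2 ^ n
n<2^n zero    = s≤s z≤n
n<2^n (suc n) = ≤-trans (+-mono-≤ (≤-trans (s≤s z≤n) (n<2^n n)) (n<2^n n))
  (≤-reflexive (cong (_+_ (2 ^ n)) (≡-sym (+-identityʳ (2 ^ n)))))

-- The counter reaches about `k + l`, because the unary parameter precedes the word. With
-- `k < 2 ^ k` the parameter leaves the logarithm and contributes linearly; the constants and `k`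
-- together fit under a multiple of `suc k`, a shape covered by `computable-multiple`.
width-bound : ∀ l k W → 2 ^ pred W ≤ suc (suc (suc (k + l))) → W + 2 ≤ 7 * suc k + 1 * ⌈log₂ l ⌉
width-bound l k W p = ≤-trans (+-monoˡ-≤ 2 W≤) (≤-trans (≤-reflexive (rearrange k ⌈log₂ l ⌉)) (+-mono-≤ k≤ (≤-reflexive (≡-sym (+-identityʳ _)))))
  where
  e : ℕ
  e = ⌈log₂ l ⌉
  two : 2 ^ pred W < 2 ^ (suc (suc (suc k)) + e)
  two = begin-strict
    2 ^ pred W                     ≤⟨ p ⟩
    suc (suc (suc (k + l)))        <⟨ s≤s (s≤s (s≤s (s≤s (+-monoʳ-≤ k (n≤2^⌈log2⌉n l (<-wellFounded l)))))) ⟩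
    4 + (k + 2 ^ e)                ≤⟨ +-monoʳ-≤ 4 (+-monoˡ-≤ (2 ^ e) (<⇒≤ (n<2^n k))) ⟩
    4 + (2 ^ k + 2 ^ e)            ≤⟨ mult (2 ^ k) (2 ^ e) (m^n>0 2 k) (m^n>0 2 e) ⟩
    8 * (2 ^ k * 2 ^ e)            ≡⟨ cong (8 *_) (≡-sym (^-distribˡ-+-* 2 k e)) ⟩
    8 * 2 ^ (k + e)                ≡⟨ ^-distribˡ-+-* 2 3 (k + e) ⟨
    2 ^ (3 + (k + e))              ∎
    where
    open ≤-Reasoning
    mult : ∀ a b → 0 < a → 0 < b → 4 + (a + b) ≤ 8 * (a * b)
    mult (suc a) (suc b) _ _ = begin
      4 + (suc a + suc b)               ≤⟨ m≤m+n _ (2 + 7 * a + 7 * b + 8 * (a * b)) ⟩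
      4 + (suc a + suc b) + (2 + 7 * a + 7 * b + 8 * (a * b))
        ≡⟨ solve 2 (λ a b → con 4 :+ ((con 1 :+ a) :+ (con 1 :+ b)) :+ (con 2 :+ con 7 :* a :+ con 7 :* b 
             :+ con 8 :* (a :* b)) := con 8 :* ((con 1 :+ a) :* (con 1 :+ b))) refl a b ⟩
      8 * (suc a * suc b)               ∎
      where
      open +-*-Solver
  W≤ : W ≤ suc (suc (suc k) + e)
  W≤ with W ≤? suc (suc (suc k) + e)
  ... | yes q = q
  ... | no ¬q = contradiction (<-≤-trans two (^-monoʳ-≤ 2 (pred-mono-≤ (≰⇒> ¬q)))) (<-irrefl refl)
  rearrange : ∀ k e → suc (suc (suc k) + e) + 2 ≡ (5 + k) + e
  rearrange k e = trans (+-comm _ 2) refl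
  k≤ : 5 + k ≤ 7 * suc k
  k≤ = ≤-trans (+-mono-≤ {5} {7} (s≤s (s≤s (s≤s (s≤s (s≤s z≤n))))) (m≤m+n k (6 * k))) (≤-reflexive (≡-sym (*-suc 7 k)))


-- Writes suc d symbols on ⊢ and on every input symbol; the state counts the
-- symbols still to be written.
multiplier : ℕ → Machine
multiplier d = record
  { State = Fin (suc d) ; Symbol = Bool ; tapes = 0
  ; finite-State = suc d , ↔-id _ ; finite-Symbol = finite-Bool
  ; start = fromℕ d ; blank = false
  ; δ = λ { q ⊣ _ → [] ; q ⊢ _ → emit q ∷ [] ; q (sym _) _ → emit q ∷ [] }
  }
  where
  emit : Fin (suc d) → Action (Fin (suc d)) Bool 0
  emit zero    = record { next = fromℕ d ; inputMove = right ; work = Vec.[] ; emit = just true }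
  emit (suc q) = record { next = inject₁ q ; inputMove = stay ; work = Vec.[] ; emit = just true }

module _ (M : Machine) (det : Deterministic M) (x : Word) where
  open Run M

  private
    sole-member : ∀ {A : Set} {a b : A} (l : List A) → length l ≤ 1 → a ∈ l → b ∈ l → a ≡ b
    sole-member (_ ∷ [])    _        (here refl) (here refl) = refl
    sole-member (_ ∷ _ ∷ _) (s≤s ()) _           _

    stuck : ∀ {c c′} → Halted x c → ¬ Step x c c′
    stuck h s rewrite h with s
    ... | ()

  -- `Yields` speaks of all halting computations; for a deterministic machine a single halting run
  -- settles them.
  deterministic-halt : ∀ {c a b} → Star (Step x) c a → Halted x a → Star (Step x) c b → Halted x b → a ≡ b
  deterministic-halt ε         h ε           h′ = refl
  deterministic-halt ε         h (s ◅ _)     h′ = contradiction s (stuck h)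
  deterministic-halt (s ◅ _)   h ε           h′ = contradiction s (stuck h′)
  deterministic-halt {c} (s ◅ ss) h (s′ ◅ ss′) h′
    with sole-member (map (perform x c) (actions x c)) (subst (_≤ 1) (≡-sym (length-map _ (actions x c))) (det _ _ _)) s s′
  ... | refl = deterministic-halt ss h ss′ h′

computable-multiple : ∀ d → Computable (λ k → suc d * suc k)
computable-multiple d = multiplier d , det , λ k → (_ , reach k , halted k) , λ c r h →
  trans (cong (Run.output {multiplier d}) (deterministic-halt (multiplier d) det (unary k) r h (reach k) (halted k)))
    (cong (λ n → replicate n true) (≡-sym (*-comm (suc d) (suc k))))
  where
  open Run (multiplier d)
  det : Deterministic (multiplier d)
  det q ⊢       v = ≤-refl
  det q ⊣       v = z≤n
  det q (sym b) v = ≤-refl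
  at : Fin (suc d) → ℕ → Word → Config
  at q i o = record { state = q ; head = i ; works = Vec.[] ; output = o }
  config : Fin (suc d) → ℕ → ℕ → Config
  config q i n = at q i (replicate n true)
  append-true : ∀ n → replicate n true ++ true ∷ [] ≡ replicate (suc n) true
  append-true zero    = refl
  append-true (suc n) = cong (true ∷_) (append-true n)
  module _ (k : ℕ) where
    inside : ∀ i → i ≤ k → readInput (unary k) i ≢ ⊣
    inside i p = readInput-inside (unary k) i (subst (i ≤_) (≡-sym (length-replicate k)) p)
    move-right : ∀ i → i ≤ k → moveInput (unary k) right i ≡ suc i
    move-right i p rewrite length-replicate k {x = true} = m≤n⇒m⊓n≡m (s≤s p)
    next-symbol : ∀ i n → i ≤ k → Step (unary k) (config zero i n) (config (fromℕ d) (suc i) (suc n))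
    next-symbol i n p with readInput (unary k) i | inside i p
    ... | ⊢     | _ = here (cong₂ (at (fromℕ d)) (≡-sym (move-right i p)) (≡-sym (append-true n)))
    ... | ⊣     | q = contradiction refl q
    ... | sym _ | _ = here (cong₂ (at (fromℕ d)) (≡-sym (move-right i p)) (≡-sym (append-true n)))
    same-symbol : ∀ q i n → i ≤ k → Step (unary k) (config (suc q) i n) (config (inject₁ q) i (suc n))
    same-symbol q i n p with readInput (unary k) i | inside i p
    ... | ⊢     | _ = here (cong (at (inject₁ q) i) (≡-sym (append-true n)))
    ... | ⊣     | q = contradiction refl q
    ... | sym _ | _ = here (cong (at (inject₁ q) i) (≡-sym (append-true n)))
    write : ∀ l q i n → toℕ q ≡ l → i ≤ k → Star (Step (unary k)) (config q i n) (config (fromℕ d) (suc i) (suc l + n))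
    write zero    zero    i n eq p = next-symbol i n p ◅ ε
    write (suc l) (suc q) i n eq p = same-symbol q i n p ◅
      subst (λ z → Star (Step (unary k)) (config (inject₁ q) i (suc n)) (config (fromℕ d) (suc i) z)) (cong suc (+-suc l n))
      (write l (inject₁ q) i (suc n) (trans (toℕ-inject₁ q) (suc-injective eq)) p)
    prefix : ∀ i → i ≤ suc k → Star (Step (unary k)) (config (fromℕ d) 0 0) (config (fromℕ d) i (i * suc d))
    prefix zero    p = ε
    prefix (suc i) p = prefix i (≤-trans (n≤1+n i) p) ◅◅ write d (fromℕ d) i (i * suc d) (toℕ-fromℕ d) (≤-pred p)
    reach : Reachable (unary k) (config (fromℕ d) (suc k) (suc k * suc d))
    reach = prefix (suc k) ≤-refl
    halted : Halted (unary k) (config (fromℕ d) (suc k) (suc k * suc d))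
    halted rewrite readInput-beyond (unary k) (suc k) (s≤s (≤-reflexive (length-replicate k))) = refl

-- Derived commands and a logic for them

perform! : ∀ {m} → Prim m → Cmd m
perform! p = cond p skip skip

set! : ∀ {m} → Fin m → Bool → Cmd m
set! r b = perform! (op (setc r b))

copy! : ∀ {m} → Fin m → Fin m → Cmd m
copy! r q = perform! (op (copy r q))

-- An endless loop plays the role of rejection: all halting computations have to give the right
-- output, while computations that run forever are permitted.
fail : ∀ {m} → Cmd m
fail = while (look (λ _ → true , stay , nothing)) skip

incr : ∀ {m} → Fin m → Cmd m
incr r = cond (op (inc r)) fail skip

ifEqual : ∀ {m} → Fin m → Fin m → Cmd m → Cmd m → Cmd m
ifEqual r q C D = cond (op (differ r q)) D C

-- The final reset returns the counter to 0, so that specifications of the surrounding commands can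
-- expect 0 in every scratch register. The bound is read from `q` again in each round.
for : ∀ {m} → Fin m → Fin m → Cmd m → Cmd m
for r q C = set! r false ⨟ while (op (differ r q)) (C ⨟ incr r) ⨟ set! r false

setReg : ∀ {m} → Fin m → ℕ → State m → State m
setReg r v (state p t o) = state p (set r v t) o

reg : ∀ {m} → Fin m → State m → ℕ
reg r σ = get r (regs σ)

set-set : ∀ {m} {A : Set} i (a b : A) (t : Tup A m) → set i a (set i b t) ≡ set i a t
set-set zero    a b t = refl
set-set (suc i) a b t = cong (_ ,_) (set-set i a b (proj₂ t))

module Logic {m : ℕ} (B : ℕ) (x : Word) where
  open BigStep {m} {State m} (semantics B x) public

  -- Having the same outcomes carries existence and uniqueness of the final state through a single
  -- derivation. `Det` compares with `skip`; a comparison with `fail` says that no run ends.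
  record Same (C : Cmd m) (σ : State m) (D : Cmd m) (τ : State m) : Set where
    constructor same
    field
      to   : ∀ {ρ} → Eval C σ ρ → Eval D τ ρ
      from : ∀ {ρ} → Eval D τ ρ → Eval C σ ρ
  open Same public

  Det : Cmd m → State m → State m → Set
  Det C σ τ = Same C σ skip τ

  det-eval : ∀ {C σ τ} → Det C σ τ → Eval C σ τ
  det-eval d = from d skip

  det-unique : ∀ {C σ τ ρ} → Det C σ τ → Eval C σ ρ → ρ ≡ τ
  det-unique d e with to d e
  ... | skip = refl

  mkDet : ∀ {C σ τ} → Eval C σ τ → (∀ {ρ} → Eval C σ ρ → ρ ≡ τ) → Det C σ τ
  to   (mkDet e u) e′ with u e′
  ... | refl = skip
  from (mkDet e u) skip = e

  det-skip : ∀ {σ} → Det skip σ σ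
  det-skip = same id id

  det-≡ : ∀ {C σ τ τ′} → τ ≡ τ′ → Det C σ τ → Det C σ τ′
  det-≡ refl d = d

  infixr 4 _▷_
  _▷_ : ∀ {C D E σ ρ τ} → Det C σ ρ → Same D ρ E τ → Same (C ⨟ D) σ E τ
  to   (d ▷ e) (seq r r′) with det-unique d r
  ... | refl = to e r′
  from (d ▷ e) r = seq (det-eval d) (from e r)

  record Decides (p : Prim m) (σ : State m) (b : Bool) (ρ : State m) : Set where
    constructor decides
    field
      holds : semantics B x p σ b ρ
      only′ : ∀ {b′ ρ′} → semantics B x p σ b′ ρ′ → (b′ , ρ′) ≡ (b , ρ)
  open Decides

  look-decides : ∀ {f σ b ρ} → evalPrim B x (look f) σ ≡ (b , ρ) → Decides (look f) σ b ρ
  look-decides eq = decides eq (λ eq′ → trans (≡-sym eq′) eq)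

  op-decides : ∀ {u σ b ρ} → evalPrim B x (op u) σ ≡ (b , ρ) → Decides (op u) σ b ρ
  op-decides eq = decides eq (λ eq′ → trans (≡-sym eq′) eq)

  cond-yes : ∀ {p C D E σ ρ τ} → Decides p σ true ρ → Same C ρ E τ → Same (cond p C D) σ E τ
  to   (cond-yes d e) (cond-t s r) with only′ d s
  ... | refl = to e r
  to   (cond-yes d e) (cond-f s r) with only′ d s
  ... | ()
  from (cond-yes d e) r = cond-t (holds d) (from e r)

  cond-no : ∀ {p C D E σ ρ τ} → Decides p σ false ρ → Same D ρ E τ → Same (cond p C D) σ E τ
  to   (cond-no d e) (cond-f s r) with only′ d s
  ... | refl = to e r
  to   (cond-no d e) (cond-t s r) with only′ d s
  ... | ()
  from (cond-no d e) r = cond-f (holds d) (from e r)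

  while-no : ∀ {p C σ ρ} → Decides p σ false ρ → Det (while p C) σ ρ
  to   (while-no d) (while-t s r r′) with only′ d s
  ... | ()
  to   (while-no d) (while-f s) with only′ d s
  ... | refl = skip
  from (while-no d) skip = while-f (holds d)

  while-yes : ∀ {p C E σ ρ υ τ} → Decides p σ true ρ → Det C ρ υ → Same (while p C) υ E τ → Same (while p C) σ E τ
  to   (while-yes d c e) (while-t s r r′) with only′ d s
  ... | refl with det-unique c r
  ... | refl = to e r′
  to   (while-yes d c e) (while-f s) with only′ d s
  ... | ()
  from (while-yes d c e) r = while-t (holds d) (det-eval c) (from e r)

  do-op : ∀ u σ → Det (perform! (op u)) σ (proj₂ (evalPrim B x (op u) σ))
  do-op u σ with proj₁ (evalPrim B x (op u) σ) in eq
  ... | true  = cond-yes (op-decides (cong (_, proj₂ (evalPrim B x (op u) σ)) eq)) det-skip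
  ... | false = cond-no (op-decides (cong (_, proj₂ (evalPrim B x (op u) σ)) eq)) det-skip

  do-set : ∀ r b {σ} → Det (set! r b) σ (setReg r (bit b) σ)
  do-set r b = do-op (setc r b) _

  do-copy : ∀ r q {σ} → Det (copy! r q) σ (setReg r (reg q σ) σ)
  do-copy r q = do-op (copy r q) _

  do-look : ∀ {f σ b ρ} → evalPrim B x (look f) σ ≡ (b , ρ) → Det (perform! (look f)) σ ρ
  do-look {b = true}  eq = cond-yes (look-decides eq) det-skip
  do-look {b = false} eq = cond-no (look-decides eq) det-skip

  fail-diverges : ∀ {σ τ} → ¬ Eval fail σ τ
  fail-diverges (while-t s r r′) = fail-diverges r′

  incr-eval : ∀ (r : Fin m) σ → suc (reg r σ) < B → evalPrim B x (op (inc r)) σ ≡ (false , setReg r (suc (reg r σ)) σ)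
  incr-eval r σ lt with suc (get r (regs σ)) <? B
  ... | yes _ = refl
  ... | no ¬p = contradiction lt ¬p

  do-incr : ∀ (r : Fin m) {σ} → suc (reg r σ) < B → Det (incr r) σ (setReg r (suc (reg r σ)) σ)
  do-incr r {σ} lt = cond-no (op-decides (incr-eval r σ lt)) det-skip

  incr-unique : ∀ (r : Fin m) {σ τ} → Eval (incr r) σ τ → τ ≡ setReg r (suc (reg r σ)) σ
  incr-unique r (cond-t s e) = contradiction e fail-diverges
  incr-unique r {σ} (cond-f s e) with suc (get r (regs σ)) <? B
  incr-unique r (cond-f refl skip) | yes _ = refl
  incr-unique r (cond-f () e) | no _

  ifEqual-yes : ∀ {r q C D E σ τ} → reg r σ ≡ reg q σ → Same C σ E τ → Same (ifEqual r q C D) σ E τ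
  ifEqual-yes {r} {q} {σ = σ} eq = cond-no (op-decides (cong (_, σ) (neq-≡ eq)))

  ifEqual-no : ∀ {r q C D E σ τ} → reg r σ ≢ reg q σ → Same D σ E τ → Same (ifEqual r q C D) σ E τ
  ifEqual-no {r} {q} {σ = σ} ne = cond-yes (op-decides (cong (_, σ) (neq-≢ ne)))

  module For (r q : Fin m) (C : Cmd m) (N : ℕ) where

    loop : Cmd m
    loop = while (op (differ r q)) (C ⨟ incr r)

    -- Bodies may toss coins, so a good run of the loop is exhibited by choosing one outcome per
    -- round; this feeds `for-eval`. Its counterpart `for-invariant` speaks of every run that ends,
    -- and `for-det` combines both for deterministic bodies.
    data Iter (σ : State m) : ℕ → State m → Set where
      none : Iter σ 0 σ
      more : ∀ {i ρ τ} → Iter σ i ρ → reg r ρ ≡ i → reg q ρ ≡ N → Eval C ρ τ → reg r τ ≡ i →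
             Iter σ (suc i) (setReg r (suc i) τ)

    iter-loop : ∀ {σ i ρ τ} → N < B → i ≤ N → Iter σ i ρ → Eval loop ρ τ → Eval loop σ τ
    iter-loop lt i≤ none e = e
    iter-loop lt i≤ (more {ρ = ρ} it refl refl c eq) e = iter-loop lt (<⇒≤ i≤) it
      (while-t (cong (_, ρ) (neq-≢ (<⇒≢ i≤)))
        (seq c (subst (λ j → Eval (incr r) _ (setReg r (suc j) _)) eq
          (det-eval (do-incr r (subst (λ j → suc j < B) (≡-sym eq) (≤-<-trans i≤ lt)))))) e)

    for-eval : ∀ {σ ρ} → N < B → Iter (setReg r 0 σ) N ρ → reg r ρ ≡ N → reg q ρ ≡ N →
               Eval (for r q C) σ (setReg r 0 ρ)
    for-eval {ρ = ρ} lt it eq eq′ = seq (det-eval (do-set r false))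
      (seq (iter-loop lt ≤-refl it (while-f (cong (_, ρ) (neq-≡ (trans eq (≡-sym eq′))))))
        (det-eval (do-set r false)))

    for-invariant : (I : ℕ → State m → Set) →
      (∀ {i σ} → I i σ → reg r σ ≡ i × reg q σ ≡ N) →
      (∀ {i σ τ} → i < N → I i σ → Eval C σ τ → reg r τ ≡ i × I (suc i) (setReg r (suc i) τ)) →
      ∀ {σ τ} → I 0 (setReg r 0 σ) → Eval (for r q C) σ τ → ∃[ ρ ] (I N ρ × τ ≡ setReg r 0 ρ)
    for-invariant I regs-I step-I {σ} init (seq a (seq l b)) with det-unique (do-set r false) a
    ... | refl with go z≤n init l
      where
      go : ∀ {i σ τ} → i ≤ N → I i σ → Eval loop σ τ → I N τ
      go {σ = σ} i≤ inv (while-f s) with reg r σ ≟ reg q σ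
      ... | yes p with s
      ... | refl = subst (λ j → I j σ) (trans (≡-sym (proj₁ (regs-I inv))) (trans p (proj₂ (regs-I inv)))) inv
      go i≤ inv (while-f ()) | no ¬p
      go {σ = σ} i≤ inv (while-t s e e′) with reg r σ ≟ reg q σ
      go i≤ inv (while-t () e e′) | yes p
      go i≤ inv (while-t refl (seq c d) e′) | no ¬p
        with ≤∧≢⇒< i≤ (λ eq → ¬p (trans (proj₁ (regs-I inv)) (trans eq (≡-sym (proj₂ (regs-I inv))))))
      ... | i< with step-I i< inv c | incr-unique r d
      ... | eq , inv′ | refl = go i< (subst (λ j → I _ (setReg r (suc j) _)) (≡-sym eq) inv′) e′
    ... | inv = _ , inv , det-unique (do-set r false) b

    for-det : (st end : ℕ → State m) →
      (∀ i → reg r (st i) ≡ i × reg q (st i) ≡ N) →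
      (∀ i → i < N → Det C (st i) (end i)) →
      (∀ i → reg r (end i) ≡ i × setReg r (suc i) (end i) ≡ st (suc i)) →
      N < B → ∀ {σ τ} → setReg r 0 σ ≡ st 0 → setReg r 0 (st N) ≡ τ → Det (for r q C) σ τ
    for-det st end regs-st body next lt {σ} {τ} init refl = mkDet
      (for-eval lt (subst (λ ρ → Iter ρ N (st N)) (≡-sym init) (iterate N ≤-refl)) (proj₁ (regs-st N)) (proj₂ (regs-st N)))
      (λ e → outcome (for-invariant (λ i σ → σ ≡ st i) (λ { {i} refl → regs-st i })
        (λ { {i} i< refl e → (trans (cong (reg r) (det-unique (body i i<) e)) (proj₁ (next i))) ,
               trans (cong (setReg r (suc i)) (det-unique (body i i<) e)) (proj₂ (next i)) }) init e))
      where
      iterate : ∀ i → i ≤ N → Iter (st 0) i (st i)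
      iterate zero    i≤ = none
      iterate (suc i) i≤ = subst (Iter (st 0) (suc i)) (proj₂ (next i))
        (more (iterate i (<⇒≤ i≤)) (proj₁ (regs-st i)) (proj₂ (regs-st i)) (det-eval (body i i≤)) (proj₁ (next i)))
      outcome : ∀ {ρ} → ∃[ υ ] (υ ≡ st N × ρ ≡ setReg r 0 υ) → ρ ≡ setReg r 0 (st N)
      outcome (_ , refl , eq) = eq

  open For public using (none; more; for-eval; for-invariant; for-det)

-- Levels of a graph and canonical predecessors

module Levels (n s : ℕ) (E : ℕ → ℕ → Bool) where

  anyBelow : ℕ → (ℕ → Bool) → Bool
  anyBelow zero    p = false
  anyBelow (suc k) p = anyBelow k p ∨ p k

  countBelow : ℕ → (ℕ → Bool) → ℕ
  countBelow zero    p = 0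
  countBelow (suc k) p = if p k then suc (countBelow k p) else countBelow k p

  below : ℕ → ℕ → Bool
  below v k = ⌊ v <? k ⌋

  -- The vertices reachable in at most l steps.
  R : ℕ → ℕ → Bool
  R zero    v = below v n ∧ not (neq v s)
  R (suc l) v = R l v ∨ (below v n ∧ anyBelow n (λ u → R l u ∧ E u v))

  -- The last vertex u < k of level l with an edge to v, or v if there is none.
  best : ℕ → ℕ → ℕ → ℕ
  best l v zero    = v
  best l v (suc k) = if R l k then (if neq k v ∧ E k v then k else best l v k) else best l v k

  -- The content of the register `rSelf` after the vertices below `k` have been handled: the bit
  -- telling whether `v` has turned up among them as a member of level `l`.
  self : ℕ → ℕ → ℕ → ℕ
  self l v zero    = 0
  self l v (suc k) = if R l k then (if neq k v then self l v k else 1) else self l v k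

  -- A vertex already in the level is its own parent: a path may be shorter than the number of
  -- levels, and the walk back then waits.
  parent : ℕ → ℕ → ℕ
  parent l v = if R l v then v else best l v n

  found : ℕ → ℕ → Bool
  found l v = R l v ∨ neq (best l v n) v

  level-size : ℕ → ℕ
  level-size l = countBelow n (R l)

  below-true : ∀ {v k} → below v k ≡ true → v < k
  below-true {v} {k} eq with v <? k
  ... | yes p = p
  below-true () | no _

  below-intro : ∀ {v k} → v < k → below v k ≡ true
  below-intro {v} {k} p with v <? k
  ... | yes _ = refl
  ... | no ¬p = contradiction p ¬p

  neq-false : ∀ {v w} → neq v w ≡ false → v ≡ w
  neq-false {v} {w} eq with v ≟ w
  ... | yes p = p
  neq-false () | no _

  neq-true : ∀ {v w} → neq v w ≡ true → v ≢ w
  neq-true {v} {w} eq with v ≟ w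
  neq-true () | yes _
  ... | no ¬p = ¬p

  any-elim : ∀ k p → anyBelow k p ≡ true → ∃[ u ] (u < k × p u ≡ true)
  any-elim (suc k) p eq with p k in pk
  ... | true  = k , ≤-refl , pk
  ... | false with any-elim k p (trans (≡-sym (∨-identityʳ _)) eq)
  ... | u , u< , pu = u , m≤n⇒m≤1+n u< , pu

  any-intro : ∀ k p {u} → u < k → p u ≡ true → anyBelow k p ≡ true
  any-intro (suc k) p {u} u< pu with u ≟ k
  ... | yes refl = trans (cong (anyBelow k p ∨_) pu) (∨-zeroʳ _)
  ... | no u≢k   = cong (_∨ p k) (any-intro k p (≤∧≢⇒< (≤-pred u<) u≢k) pu)

  ∧-elim : ∀ {a b} → a ∧ b ≡ true → a ≡ true × b ≡ true
  ∧-elim {true} {true} refl = refl , refl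

  ∨-elim : ∀ {a b} → a ∨ b ≡ true → a ≡ true ⊎ b ≡ true
  ∨-elim {true}  _  = inj₁ refl
  ∨-elim {false} eq = inj₂ eq

  R-suc-elim : ∀ l {v} → R (suc l) v ≡ true →
    R l v ≡ true ⊎ (v < n × ∃[ u ] (R l u ≡ true × E u v ≡ true))
  R-suc-elim l {v} eq with ∨-elim {R l v} eq
  ... | inj₁ p = inj₁ p
  ... | inj₂ p with ∧-elim {below v n} p
  ... | v< , a with any-elim n _ a
  ... | u , _ , q = inj₂ (below-true v< , u , ∧-elim {R l u} q)

  R-below : ∀ l {v} → R l v ≡ true → v < n
  R-below zero    eq = below-true (proj₁ (∧-elim eq))
  R-below (suc l) {v} eq with R-suc-elim l {v} eq
  ... | inj₁ p       = R-below l p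
  ... | inj₂ (p , _) = p

  R-weaken : ∀ l {v} → R l v ≡ true → R (suc l) v ≡ true
  R-weaken l eq rewrite eq = refl

  R-edge : ∀ l {u v} → R l u ≡ true → E u v ≡ true → v < n → R (suc l) v ≡ true
  R-edge l {u} {v} Ru Euv v< = trans (cong (R l v ∨_) (trans (cong (_∧ anyBelow n (λ w → R l w ∧ E w v)) (below-intro v<))
    (any-intro n _ (R-below l Ru) (trans (cong (_∧ E u v) Ru) Euv)))) (∨-zeroʳ (R l v))

  R-start : ∀ {v} → R 0 v ≡ true → v ≡ s
  R-start {v} eq with neq v s in e | proj₂ (∧-elim {below v n} eq)
  ... | false | _ = neq-false e
  ... | true  | ()

  best-candidate : ∀ l v k → best l v k ≡ v ⊎ (best l v k < k × best l v k ≢ v × R l (best l v k) ≡ true × E (best l v k) v ≡ true)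
  best-candidate l v zero = inj₁ refl
  best-candidate l v (suc k) with R l k in Rk | neq k v in kv | E k v in Ek | best-candidate l v k
  ... | true  | true  | true  | _      = inj₂ (≤-refl , neq-true kv , Rk , Ek)
  ... | true  | true  | false | inj₁ e = inj₁ e
  ... | true  | true  | false | inj₂ (p , q) = inj₂ (m≤n⇒m≤1+n p , q)
  ... | true  | false | _     | inj₁ e = inj₁ e
  ... | true  | false | _     | inj₂ (p , q) = inj₂ (m≤n⇒m≤1+n p , q)
  ... | false | _     | _     | inj₁ e = inj₁ e
  ... | false | _     | _     | inj₂ (p , q) = inj₂ (m≤n⇒m≤1+n p , q)

  best-found : ∀ l v k {u} → u < k → R l u ≡ true → u ≢ v → E u v ≡ true → best l v k ≢ v
  best-found l v (suc k) {u} u< Ru u≢v Euv with u ≟ k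
  ... | yes refl rewrite Ru | neq-≢ u≢v | Euv = u≢v
  ... | no u≢k with R l k | neq k v in kv | E k v | best-found l v k (≤∧≢⇒< (≤-pred u<) u≢k) Ru u≢v Euv
  ... | true  | true  | true  | _ = neq-true kv
  ... | true  | true  | false | p = p
  ... | true  | false | _     | p = p
  ... | false | _     | _     | p = p

  self-final : ∀ l v k → self l v k ≡ bit (R l v ∧ below v k)
  self-final l v zero with R l v
  ... | true  = refl
  ... | false = refl
  self-final l v (suc k) with k ≟ v
  self-final l v (suc k) | yes refl with R l k | self-final l k k
  ... | true  | _ rewrite below-intro {k} {suc k} ≤-refl = refl
  ... | false | p = p
  self-final l v (suc k) | no k≢v = trans (collapse (R l k)) (trans (self-final l v k) (cong (λ z → bit (R l v ∧ z)) shift))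
    where
    collapse : ∀ b → (if b then self l v k else self l v k) ≡ self l v k
    collapse true  = refl
    collapse false = refl
    shift : below v k ≡ below v (suc k)
    shift with v <? k | v <? suc k
    ... | yes _ | yes _ = refl
    ... | no _  | no _  = refl
    ... | yes p | no ¬q = contradiction (m≤n⇒m≤1+n p) ¬q
    ... | no ¬p | yes q = contradiction (≤∧≢⇒< (≤-pred q) (λ e → k≢v (≡-sym e))) ¬p

  self-end : ∀ l v → self l v n ≡ bit (R l v)
  self-end l v = trans (self-final l v n) (cong bit absorb)
    where
    absorb : R l v ∧ below v n ≡ R l v
    absorb with R l v in eq
    ... | true  = below-intro (R-below l eq)
    ... | false = refl

  bool-≡ : ∀ {a b} → (a ≡ true → b ≡ true) → (b ≡ true → a ≡ true) → a ≡ b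
  bool-≡ {true}  f g = ≡-sym (f refl)
  bool-≡ {false} {true}  f g = g refl
  bool-≡ {false} {false} f g = refl

  -- `best` signals the lack of a predecessor by returning `v`. This is unambiguous where it
  -- matters: if `v` is outside level `l`, a predecessor in the level differs from `v`, and if `v`
  -- is inside, the first disjunct decides.
  found-next : ∀ l v → v < n → found l v ≡ R (suc l) v
  found-next l v v< = bool-≡ forth back
    where
    forth : found l v ≡ true → R (suc l) v ≡ true
    forth eq with ∨-elim {R l v} eq
    ... | inj₁ p = R-weaken l p
    ... | inj₂ p with best-candidate l v n
    ... | inj₁ e = contradiction e (neq-true p)
    ... | inj₂ (_ , _ , Ru , Euv) = R-edge l Ru Euv v<
    back : R (suc l) v ≡ true → found l v ≡ true
    back eq with R l v in Rv | R-suc-elim l {v} eq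
    ... | true  | _ = refl
    ... | false | inj₁ ()
    ... | false | inj₂ (_ , u , Ru , Euv) = neq-≢ (best-found l v n (R-below l Ru) Ru
      (λ { refl → contradiction (trans (≡-sym Ru) Rv) (λ ()) }) Euv)

  count-cong : ∀ k {p q} → (∀ v → v < k → p v ≡ q v) → countBelow k p ≡ countBelow k q
  count-cong zero    eq = refl
  count-cong (suc k) {p} {q} eq rewrite eq k ≤-refl | count-cong k {p} {q} (λ v v< → eq v (m≤n⇒m≤1+n v<)) = refl

  count-≤ : ∀ k p → countBelow k p ≤ k
  count-≤ zero    p = z≤n
  count-≤ (suc k) p with p k
  ... | true  = s≤s (count-≤ k p)
  ... | false = m≤n⇒m≤1+n (count-≤ k p)

  parent-bound : ∀ {B} l v → n < B → v < B → parent l v < B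
  parent-bound l v n<B v<B with R l v
  ... | true  = v<B
  ... | false with best-candidate l v n
  ... | inj₁ e rewrite e = v<B
  ... | inj₂ (p , _) = <-trans p n<B

-- The commands for the augmentation

-- The registers are ordered by the nesting of the commands that use them, so
-- that the registers of the surrounding commands form an arbitrary tail in the
-- specification of a command.
Reg : Set
Reg = Fin 28

rJ₀ rJ₁ rP rQ rN rBase rS rO rZ rY rG rJ rU rCnt rSelf rV rL rC rPar rFound rC′ rI rX rM rVal rA rB rT : Reg
rJ₀ = # 0
rJ₁ = # 1
rP = # 2
rQ = # 3
rN = # 4
rBase = # 5
rS = # 6
rO = # 7
rZ = # 8
rY = # 9
rG = # 10
rJ = # 11
rU = # 12
rCnt = # 13
rSelf = # 14
rV = # 15
rL = # 16
rC = # 17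
rPar = # 18
rFound = # 19
rC′ = # 20
rI = # 21
rX = # 22
rM = # 23
rVal = # 24
rA = # 25
rB = # 26
rT = # 27

isOne : InputSymbol → Bool
isOne (sym b) = b
isOne _       = false

notLeftEnd : InputSymbol → Bool
notLeftEnd ⊢ = false
notLeftEnd _ = true

one? : Prim 28
one? = look (λ a → isOne a , stay , nothing)

right! rewind : Cmd 28
right! = perform! (look (λ _ → false , right , nothing))
rewind = while (look (λ a → notLeftEnd a , (if notLeftEnd a then left else stay) , nothing)) skip

-- Moves the head from ⊢ to the pair of bits for (P , Q).
seek : Cmd 28
seek = for rJ₀ rBase right! ⨟ for rJ₀ rP (for rJ₁ rN (right! ⨟ right!)) ⨟ for rJ₀ rQ (right! ⨟ right!)

tidy : Cmd 28
tidy = rewind ⨟ set! rP false ⨟ set! rQ false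

-- The step right after `seek` passes the edge bit, so the residual bit is tested. `tidy` comes
-- before either branch, so the branches start with the head on the left marker and cleared scratch
-- registers.
ifEdge : Reg → Reg → Cmd 28 → Cmd 28 → Cmd 28
ifEdge r q C D = copy! rP r ⨟ copy! rQ q ⨟ seek ⨟ right! ⨟ cond one? (tidy ⨟ C) (tidy ⨟ D)

-- The last toss that comes up true decides the value; if there is none, the value is 0.
guess : Reg → Cmd 28
guess r = set! r false ⨟ for rZ rN (cond coin (copy! r rZ) skip)

-- Fails unless it guesses a path of at most L edges from S to U.
walk : Cmd 28
walk = guess rY ⨟ ifEqual rY rS skip fail ⨟
  for rJ rL (cond coin (guess rG ⨟ ifEdge rY rG (copy! rY rG ⨟ set! rG false) fail) skip) ⨟
  ifEqual rY rU skip fail ⨟ set! rY false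

-- The head position of the first bit of the pair (u , v), when the pairs start
-- at position b and form rows of length n.
row : ℕ → ℕ → ℕ → ℕ
row n b zero    = b
row n b (suc u) = n * 2 + row n b u

place : ℕ → ℕ → ℕ → ℕ → ℕ
place n b u v = v * 2 + row n b u

module Seeking (B : ℕ) (x : Word) (n b : ℕ) (n<B : n < B) (b<B : b < B)
  (E : ℕ → ℕ → Bool) (E-spec : ∀ u v → isOne (readInput x (suc (place n b u v))) ≡ E u v) where
  open Logic {28} B x public

  -- On a word shorter than the header promises, the head gets stuck on the right marker. Positions
  -- past the end read as that marker too, so the truncated position can be treated as the intended
  -- one.
  clamp : ℕ → ℕ
  clamp p = p ⊓ suc (length x)

  clamp-suc : ∀ p M → suc (p ⊓ M) ⊓ M ≡ suc p ⊓ M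
  clamp-suc p M with ≤-total p M
  ... | inj₁ le rewrite m≤n⇒m⊓n≡m le = refl
  ... | inj₂ ge rewrite m≥n⇒m⊓n≡n ge | m≥n⇒m⊓n≡n (n≤1+n M) = ≡-sym (m≥n⇒m⊓n≡n (m≤n⇒m≤1+n ge))

  readInput-clamp : ∀ p → readInput x (clamp p) ≡ readInput x p
  readInput-clamp p with ≤-total p (suc (length x))
  ... | inj₁ le rewrite m≤n⇒m⊓n≡m le = refl
  ... | inj₂ ge rewrite m≥n⇒m⊓n≡n ge = trans (readInput-beyond x _ ≤-refl) (≡-sym (readInput-beyond x p ge))

  do-right : ∀ {p t o} → Det right! (state (clamp p) t o) (state (clamp (suc p)) t o)
  do-right {p} {t} {o} = do-look (cong (λ h → false , state h t o) (clamp-suc p _))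

  do-right₂ : ∀ {p t o} → Det (right! ⨟ right!) (state (clamp p) t o) (state (clamp (suc (suc p))) t o)
  do-right₂ {p} = do-right {p} ▷ do-right {suc p}

  do-rewind : ∀ h {t o} → Det rewind (state h t o) (state 0 t o)
  do-rewind zero    = while-no (look-decides refl)
  do-rewind (suc h) {t} {o} = while-yes (look-decides (test (readInput x (suc h)) (inner x h))) det-skip (do-rewind h)
    where
    inner : ∀ x h → notLeftEnd (readInput x (suc h)) ≡ true
    inner []      h       = refl
    inner (_ ∷ _) zero    = refl
    inner (_ ∷ x) (suc h) = inner x h
    test : ∀ a → notLeftEnd a ≡ true →
      _≡_ {A = Bool × State 28} (notLeftEnd a , state (moveInput x (if notLeftEnd a then left else stay) (suc h)) t o) (true , state h t o)
    test a eq = cong (λ z → z , state (moveInput x (if z then left else stay) (suc h)) t o) eq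

  do-seek : ∀ {u v rest o} → u < B → v < B →
    Det seek (state 0 (0 , 0 , u , v , n , b , rest) o) (state (clamp (place n b u v)) (0 , 0 , u , v , n , b , rest) o)
  do-seek {u} {v} {rest} {o} u<B v<B =
    for-det rJ₀ rBase right! b
      (λ i → state (clamp i) (i , 0 , u , v , n , b , rest) o)
      (λ i → state (clamp (suc i)) (i , 0 , u , v , n , b , rest) o)
      (λ i → refl , refl) (λ i _ → do-right {i}) (λ i → refl , refl) b<B refl refl
    ▷ for-det rJ₀ rP (for rJ₁ rN (right! ⨟ right!)) u
      (λ i → state (clamp (row n b i)) (i , 0 , u , v , n , b , rest) o)
      (λ i → state (clamp (row n b (suc i))) (i , 0 , u , v , n , b , rest) o)
      (λ i → refl , refl)
      (λ i _ → for-det rJ₁ rN (right! ⨟ right!) n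
        (λ j → state (clamp (j * 2 + row n b i)) (i , j , u , v , n , b , rest) o)
        (λ j → state (clamp (suc j * 2 + row n b i)) (i , j , u , v , n , b , rest) o)
        (λ j → refl , refl) (λ j _ → do-right₂ {j * 2 + row n b i}) (λ j → refl , refl) n<B refl refl)
      (λ i → refl , refl) u<B refl refl
    ▷ for-det rJ₀ rQ (right! ⨟ right!) v
      (λ j → state (clamp (j * 2 + row n b u)) (j , 0 , u , v , n , b , rest) o)
      (λ j → state (clamp (suc j * 2 + row n b u)) (j , 0 , u , v , n , b , rest) o)
      (λ j → refl , refl) (λ j _ → do-right₂ {j * 2 + row n b u}) (λ j → refl , refl) v<B refl refl

  do-tidy : ∀ {h p q rest o} → Det tidy (state h (0 , 0 , p , q , rest) o) (state 0 (0 , 0 , 0 , 0 , rest) o)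
  do-tidy {h} = do-rewind h ▷ do-set rP false ▷ do-set rQ false

  frame : Tup ℕ 22 → Word → State 28
  frame rest o = state 0 (0 , 0 , 0 , 0 , n , b , rest) o

  infix 9 ↑_
  ↑_ : Fin 22 → Reg
  ↑ i = suc (suc (suc (suc (suc (suc i)))))

  edge-test : ∀ u v {t o e} → E u v ≡ e → evalPrim B x one? (state (clamp (suc (place n b u v))) t o) ≡
              (e , state (clamp (suc (place n b u v))) t o)
  edge-test u v {t} {o} eq = cong (_, state (clamp (suc (place n b u v))) t o)
    (trans (cong isOne (readInput-clamp (suc (place n b u v)))) (trans (E-spec u v) eq))

  edge-prefix : ∀ i j {rest o C D F τ} → get i rest < B → get j rest < B →
    let u = get i rest ; v = get j rest in
    Same (cond one? (tidy ⨟ C) (tidy ⨟ D)) (state (clamp (suc (place n b u v))) (0 , 0 , u , v , n , b , rest) o) F τ →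
    Same (ifEdge (↑ i) (↑ j) C D) (frame rest o) F τ
  edge-prefix i j u<B v<B s = do-copy rP (↑ i) ▷ do-copy rQ (↑ j) ▷ do-seek u<B v<B ▷ do-right ▷ s

  edge-yes : ∀ i j {rest o C D F τ} → get i rest < B → get j rest < B → E (get i rest) (get j rest) ≡ true →
    Same C (frame rest o) F τ → Same (ifEdge (↑ i) (↑ j) C D) (frame rest o) F τ
  edge-yes i j u<B v<B e s = edge-prefix i j u<B v<B
    (cond-yes (look-decides (edge-test (get i _) (get j _) e)) (do-tidy ▷ s))

  edge-no : ∀ i j {rest o C D F τ} → get i rest < B → get j rest < B → E (get i rest) (get j rest) ≡ false →
    Same D (frame rest o) F τ → Same (ifEdge (↑ i) (↑ j) C D) (frame rest o) F τ
  edge-no i j u<B v<B e s = edge-prefix i j u<B v<B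
    (cond-no (look-decides (edge-test (get i _) (get j _) e)) (do-tidy ▷ s))

-- Decides membership of V in the level L + 1 and finds the parent of V, given
-- that C is the size of level L: only a run that guesses all vertices of the
-- level correctly finds C of them.
member : Cmd 28
member = copy! rPar rV ⨟
  for rU rN (cond coin (walk ⨟ incr rCnt ⨟ ifEqual rU rV (set! rSelf true) (ifEdge rU rV (copy! rPar rU) skip)) skip) ⨟
  ifEqual rCnt rC skip fail ⨟
  ifEqual rSelf rO (ifEqual rPar rV skip (set! rFound true)) (copy! rPar rV ⨟ set! rFound true) ⨟
  set! rSelf false ⨟ set! rCnt false

-- Computes the size C of level I by inductive counting.
count : Cmd 28
count = for rV rN (ifEqual rV rS (incr rC) skip) ⨟
  for rL rI (for rV rN (member ⨟ ifEqual rFound rO skip (incr rC′) ⨟ set! rFound false ⨟ set! rPar false) ⨟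
    copy! rC rC′ ⨟ set! rC′ false)

-- Guessed walks find exactly the vertices of a level

module Searching (B : ℕ) (x : Word) (n b s : ℕ) (n<B : n < B) (b<B : b < B)
  (E : ℕ → ℕ → Bool) (E-spec : ∀ u v → isOne (readInput x (suc (place n b u v))) ≡ E u v) where
  open Seeking B x n b n<B b<B E E-spec public
  open Levels n s E public

  guessing : ℕ → Tup ℕ 19 → Word → State 28
  guessing z rest o = frame (s , 0 , z , rest) o

  deep : Fin 19 → Reg
  deep i = ↑ (suc (suc (suc i)))

  -- The coin comes up true exactly in the round in which the counter is `g`.
  guess-eval : ∀ i {g rest o} → g < n → Eval (guess (deep i)) (guessing 0 rest o) (guessing 0 (set i g rest) o)
  guess-eval i {g} {rest} {o} g<n = seq (det-eval (do-set (deep i) false))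
    (for-eval (rZ) rN _ n n<B (subst (λ k → Iter k (guessing k (set i g rest) o)) (m+[n∸m]≡n g<n) (after-g (n ∸ suc g))) refl refl)
    where
    open For rZ rN (cond coin (copy! (deep i) rZ) skip) n using () renaming (Iter to Iter′)
    Iter : ℕ → State 28 → Set
    Iter = Iter′ (guessing 0 (set i 0 rest) o)
    before-g : ∀ j → Iter j (guessing j (set i 0 rest) o)
    before-g zero    = none
    before-g (suc j) = more (before-g j) refl refl (cond-f {ρ = guessing j (set i 0 rest) o} refl skip) refl
    after-g : ∀ j → Iter (suc g + j) (guessing (suc g + j) (set i g rest) o)
    after-g zero rewrite +-identityʳ g = subst (λ t → Iter (suc g) (guessing (suc g) t o)) (set-set i g 0 rest)
      (more (before-g g) refl refl (cond-t {ρ = guessing g (set i 0 rest) o} refl (det-eval (do-copy (deep i) rZ))) refl)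
    after-g (suc j) rewrite +-suc g j = more (after-g j) refl refl (cond-f {ρ = guessing (suc g + j) (set i g rest) o} refl skip) refl

  guess-range : ∀ i {rest o τ} → 0 < n → Eval (guess (deep i)) (guessing 0 rest o) τ →
    ∃[ g ] (g < n × τ ≡ guessing 0 (set i g rest) o)
  guess-range i {rest} {o} 0<n (seq a e) with det-unique (do-set (deep i) false) a
  ... | refl with for-invariant rZ rN _ n (λ j σ → ∃[ g ] (g < n × σ ≡ guessing j (set i g rest) o))
      (λ { (g , _ , refl) → refl , refl }) step (0 , 0<n , refl) e
    where
    step : ∀ {j σ τ} → j < n → ∃[ g ] (g < n × σ ≡ guessing j (set i g rest) o) → Eval (cond coin (copy! (deep i) rZ) skip) σ τ →
      reg rZ τ ≡ j × ∃[ g ] (g < n × setReg rZ (suc j) τ ≡ guessing (suc j) (set i g rest) o)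
    step {j} j<n (g , g<n , refl) (cond-t refl c) with det-unique (do-copy (deep i) rZ) c
    ... | refl = refl , j , j<n , cong (λ t → guessing (suc j) t o) (set-set i j g rest)
    step j<n (g , g<n , refl) (cond-f refl skip) = refl , g , g<n , refl
  ... | _ , (g , g<n , refl) , refl = g , g<n , refl

  walking : ℕ → ℕ → ℕ → ℕ → Tup ℕ 15 → Word → State 28
  walking y g j u rest o = guessing 0 (y , g , j , u , rest) o

  hop : Cmd 28
  hop = cond coin (guess rG ⨟ ifEdge rY rG (copy! rY rG ⨟ set! rG false) fail) skip

  hop-edge : ∀ {y g j u rest o} → y < n → g < n → E y g ≡ true →
    Det (ifEdge rY rG (copy! rY rG ⨟ set! rG false) fail) (walking y g j u rest o) (walking g 0 j u rest o)
  hop-edge y< g< e = edge-yes (# 3) (# 4) (<-trans y< n<B) (<-trans g< n<B) e (do-copy rY rG ▷ do-set rG false)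

  module _ (u cnt sf v l : ℕ) (rest : Tup ℕ 11) (o : Word) (u<n : u < n) (l<B : l < B) where

    private
      onPath : ℕ → ℕ → ℕ → State 28
      onPath y g j = walking y g j u (cnt , sf , v , l , rest) o

    walk-eval : R l u ≡ true → Eval walk (onPath 0 0 0) (onPath 0 0 0)
    walk-eval Ru = seq (guess-eval (# 0) (R-below 0 start))
      (seq (det-eval (ifEqual-yes refl det-skip))
        (seq (for-eval rJ rL _ l l<B (path l u ≤-refl Ru) refl refl)
          (seq (det-eval (ifEqual-yes refl det-skip)) (det-eval (do-set rY false)))))
      where
      -- The first guess has to produce `s`, hence `s` must be a vertex below `n`. On arbitrary
      -- input this is known only because the level is not empty.
      origin : ∀ i {y} → R i y ≡ true → R 0 s ≡ true
      origin zero Ry with R-start Ry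
      ... | refl = Ry
      origin (suc i) {y} Ry with R-suc-elim i {y} Ry
      ... | inj₁ p = origin i p
      ... | inj₂ (_ , _ , p , _) = origin i p
      start : R 0 s ≡ true
      start = origin l Ru
      open For rJ rL hop l using () renaming (Iter to Iter′)
      path : ∀ i y → i ≤ l → R i y ≡ true → Iter′ (onPath s 0 0) i (onPath y 0 i)
      path zero y i≤ Ry with R-start Ry
      ... | refl = none
      path (suc i) y i≤ Ry with R-suc-elim i {y} Ry
      ... | inj₁ p = more (path i y (<⇒≤ i≤) p) refl refl (cond-f {ρ = onPath y 0 i} refl skip) refl
      ... | inj₂ (y< , w , Rw , Ewy) = more (path i w (<⇒≤ i≤) Rw) refl refl
        (cond-t {ρ = onPath w 0 i} refl (seq (guess-eval (# 1) y<) (det-eval (hop-edge (R-below i Rw) y< Ewy)))) refl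

    walk-sound : ∀ {τ} → Eval walk (onPath 0 0 0) τ → R l u ≡ true × τ ≡ onPath 0 0 0
    walk-sound (seq g e) with guess-range (# 0) (≤-<-trans z≤n u<n) g
    walk-sound (seq g (seq c (seq f (seq c′ r)))) | y , y<n , refl with y ≟ s
    ... | no y≢s = contradiction (to (ifEqual-no {C = skip} y≢s (same id id)) c) fail-diverges
    ... | yes refl with det-unique (ifEqual-yes {D = fail} refl det-skip) c
    ... | refl with for-invariant rJ rL hop l (λ j σ → ∃[ y ] (R j y ≡ true × σ ≡ onPath y 0 j))
        (λ { (_ , _ , refl) → refl , refl }) step (s , trans (cong (_∧ not (neq s s)) (below-intro y<n)) (cong not (neq-≡ {s} refl)) , refl) f
      where
      step : ∀ {j σ τ} → j < l → ∃[ y ] (R j y ≡ true × σ ≡ onPath y 0 j) → Eval hop σ τ →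
        reg rJ τ ≡ j × ∃[ y ] (R (suc j) y ≡ true × setReg rJ (suc j) τ ≡ onPath y 0 (suc j))
      step {j} j<l (y , Ry , refl) (cond-f refl skip) = refl , y , R-weaken j Ry , refl
      step {j} j<l (y , Ry , refl) (cond-t refl (seq g e)) with guess-range (# 1) (≤-<-trans z≤n u<n) g
      ... | w , w<n , refl with E y w in Eyw
      ... | true with det-unique (hop-edge (R-below j Ry) w<n Eyw) e
      ... | refl = refl , w , R-edge j Ry Eyw w<n , refl
      step {j} j<l (y , Ry , refl) (cond-t refl (seq g e)) | w , w<n , refl | false =
        contradiction 
          (to (edge-no (# 3) (# 4) {C = copy! rY rG ⨟ set! rG false} {F = fail} (<-trans (R-below j Ry) n<B) (<-trans w<n n<B) Eyw (same id id)) e)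
          fail-diverges
    ... | _ , (y , Ry , refl) , refl with y ≟ u
    ... | no y≢u = contradiction (to (ifEqual-no {C = skip} y≢u (same id id)) c′) fail-diverges
    ... | yes refl with det-unique (ifEqual-yes {D = fail} refl det-skip) c′
    ... | refl = Ry , det-unique (do-set rY false) r

    do-walk : R l u ≡ true → Det walk (onPath 0 0 0) (onPath 0 0 0)
    do-walk Ru = mkDet (walk-eval Ru) (λ e → proj₂ (walk-sound e))

-- Inductive counting

module Counting (B : ℕ) (x : Word) (n b s : ℕ) (n<B : n < B) (b<B : b < B)
  (E : ℕ → ℕ → Bool) (E-spec : ∀ u v → isOne (readInput x (suc (place n b u v))) ≡ E u v) where
  open Searching B x n b s n<B b<B E E-spec public

  selecting : ℕ → ℕ → ℕ → ℕ → ℕ → ℕ → ℕ → ℕ → Tup ℕ 8 → Word → State 28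
  selecting u cnt sf v l c p f rest o = walking 0 0 0 u (cnt , sf , v , l , c , p , f , rest) o

  take-vertex : Cmd 28
  take-vertex = walk ⨟ incr rCnt ⨟ ifEqual rU rV (set! rSelf true) (ifEdge rU rV (copy! rPar rU) skip)

  do-take : ∀ {u cnt sf v l c p f rest o} → u < n → l < B → v < B → suc cnt < B → R l u ≡ true →
    Det take-vertex (selecting u cnt sf v l c p f rest o)
      (selecting u (suc cnt) (if neq u v then sf else 1) v l c (if neq u v ∧ E u v then u else p) f rest o)
  do-take {u} {cnt} {sf} {v} {l} {c} {p} {f} {rest} {o} u<n l<B v<B cnt< Ru =
    do-walk u cnt sf v l (c , p , f , rest) o u<n l<B Ru ▷ do-incr rCnt cnt< ▷ finish
    where
    finish : Det (ifEqual rU rV (set! rSelf true) (ifEdge rU rV (copy! rPar rU) skip))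
      (selecting u (suc cnt) sf v l c p f rest o)
      (selecting u (suc cnt) (if neq u v then sf else 1) v l c (if neq u v ∧ E u v then u else p) f rest o)
    finish with u ≟ v
    ... | yes u≡v = ifEqual-yes u≡v (do-set rSelf true)
    ... | no u≢v with E u v in Euv
    ... | true  = ifEqual-no u≢v (edge-yes (# 6) (# 9) (<-trans u<n n<B) v<B Euv (do-copy rPar rU))
    ... | false = ifEqual-no u≢v (edge-no (# 6) (# 9) (<-trans u<n n<B) v<B Euv det-skip)

  module _ (l v f : ℕ) (rest : Tup ℕ 8) (o : Word) (l<B : l < B) (v<B : v < B) where

    private
      select : ℕ → ℕ → ℕ → ℕ → State 28
      select u cnt sf p = selecting u cnt sf v l (level-size l) p f rest o

      listed : ℕ → ℕ
      listed k = countBelow k (R l)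

      step : Cmd 28
      step = cond coin take-vertex skip

      exact : ℕ → State 28
      exact k = select k (listed k) (self l v k) (best l v k)

      listed-bound : ∀ {k} → k < n → suc (listed k) < B
      listed-bound k<n = ≤-<-trans (≤-trans (s≤s (count-≤ _ (R l))) k<n) n<B

      open For rU rN step n using (Iter)

      collect : ∀ k → k ≤ n → Iter (exact 0) k (exact k)
      collect zero    k≤ = none
      collect (suc k) k≤ with R l k in Rk
      ... | true  = more (collect k (<⇒≤ k≤)) refl refl
        (cond-t {ρ = exact k} refl (det-eval (do-take k≤ l<B v<B (listed-bound k≤) Rk))) refl
      ... | false = more (collect k (<⇒≤ k≤)) refl refl (cond-f {ρ = exact k} refl skip) refl

      -- Fewer vertices than possible were found, or the results are right.
      Partial : ℕ → State 28 → Set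
      Partial k σ = ∃[ cnt ] ∃[ sf ] ∃[ p ] (σ ≡ select k cnt sf p × cnt ≤ listed k ×
        (cnt ≡ listed k → sf ≡ self l v k × p ≡ best l v k))

      -- Passing over a member of the level loses it for good: the count then stays strictly behind
      -- and the last clause is vacuous. Conversely, a walk that ends certifies membership, so the
      -- count can never run ahead.
      partial-step : ∀ {k σ τ} → k < n → Partial k σ → Eval step σ τ →
        reg rU τ ≡ k × Partial (suc k) (setReg rU (suc k) τ)
      partial-step {k} k<n (cnt , sf , p , refl , le , eqs) (cond-f refl skip) with R l k
      ... | true  = refl , cnt , sf , p , refl , m≤n⇒m≤1+n le , λ eq → contradiction (≤-reflexive (≡-sym eq)) (<⇒≱ (s≤s le))
      ... | false = refl , cnt , sf , p , refl , le , eqs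
      partial-step {k} k<n (cnt , sf , p , refl , le , eqs) (cond-t refl e@(seq w _))
        with proj₁ (walk-sound k cnt sf v l (level-size l , p , f , rest) o k<n l<B w)
      ... | Rk with det-unique (do-take k<n l<B v<B (≤-<-trans (s≤s le) (listed-bound k<n)) Rk) e
      ... | refl rewrite Rk = refl , suc cnt , _ , _ , refl , s≤s le , λ eq →
        cong (λ z → if neq k v then z else 1) (proj₁ (eqs (suc-injective eq))) ,
        cong (λ z → if neq k v ∧ E k v then k else z) (proj₂ (eqs (suc-injective eq)))

      conclude : Cmd 28
      conclude = ifEqual rSelf rO (ifEqual rPar rV skip (set! rFound true)) (copy! rPar rV ⨟ set! rFound true) ⨟
        set! rSelf false ⨟ set! rCnt false

    do-member : ∀ {p} → f ≡ 0 → Det member (select 0 0 0 p)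
      (selecting 0 0 0 v l (level-size l) (parent l v) (bit (found l v)) rest o)
    do-member {p} refl = do-copy rPar rV ▷ mkDet
      (seq (for-eval rU rN step n n<B (collect n ≤-refl) refl refl)
        (seq (det-eval (ifEqual-yes refl det-skip)) (det-eval done)))
      sound
      where
      done : Det conclude (select 0 (level-size l) (self l v n) (best l v n))
        (selecting 0 0 0 v l (level-size l) (parent l v) (bit (found l v)) rest o)
      done rewrite self-end l v with R l v
      ... | true  = ifEqual-no (λ ()) (do-copy rPar rV ▷ do-set rFound true) ▷ do-set rSelf false ▷ do-set rCnt false
      ... | false with best l v n ≟ v
      ... | yes eq = ifEqual-yes refl (ifEqual-yes eq det-skip) ▷ do-set rSelf false ▷ do-set rCnt false
      ... | no ne  = ifEqual-yes refl (ifEqual-no ne (do-set rFound true)) ▷ do-set rSelf false ▷ do-set rCnt false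
      sound : ∀ {τ} → Eval (for rU rN step ⨟ ifEqual rCnt rC skip fail ⨟ conclude) (select 0 0 0 v) τ → τ ≡ _
      sound (seq e (seq c d)) with for-invariant rU rN step n Partial (λ { (_ , _ , _ , refl , _) → refl , refl })
        partial-step (0 , 0 , v , refl , z≤n , λ _ → refl , refl) e
      ... | _ , (cnt , sf , p , refl , le , eqs) , refl with cnt ≟ level-size l
      ... | no ne = contradiction (to (ifEqual-no {C = skip} ne (same id id)) c) fail-diverges
      ... | yes eq with eqs eq
      ... | refl , refl with det-unique (ifEqual-yes {D = fail} eq det-skip) c
      ... | refl rewrite eq = det-unique done d

  counting : ℕ → ℕ → ℕ → ℕ → ℕ → Tup ℕ 6 → Word → State 28
  counting v l c c′ i rest o = selecting 0 0 0 v l c 0 0 (c′ , i , rest) o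

  do-count : ∀ {i rest o} → i < B →
    Det count (counting 0 0 0 0 i rest o) (counting 0 0 (level-size i) 0 i rest o)
  do-count {i} {rest} {o} i<B =
    for-det rV rN _ n (λ k → counting k 0 (countBelow k isStart) 0 i rest o)
      (λ k → counting k 0 (countBelow (suc k) isStart) 0 i rest o) (λ k → refl , refl) count-start (λ k → refl , refl)
      n<B refl (cong (λ c → counting 0 0 c 0 i rest o) size₀)
    ▷ for-det rL rI _ i (λ l → counting 0 l (level-size l) 0 i rest o) (λ l → counting 0 l (level-size (suc l)) 0 i rest o)
      (λ l → refl , refl) next-level (λ l → refl , refl) i<B refl refl
    where
    isStart : ℕ → Bool
    isStart v = not (neq v s)
    size₀ : countBelow n isStart ≡ level-size 0
    size₀ = count-cong n (λ v v<n → cong (_∧ isStart v) (≡-sym (below-intro v<n)))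
    fits : ∀ p {k} → k < n → suc (countBelow k p) < B
    fits p k<n = ≤-<-trans (≤-trans (s≤s (count-≤ _ p)) k<n) n<B
    count-start : ∀ k → k < n → Det (ifEqual rV rS (incr rC) skip)
      (counting k 0 (countBelow k isStart) 0 i rest o) (counting k 0 (countBelow (suc k) isStart) 0 i rest o)
    count-start k k<n with k ≟ s
    ... | yes eq = ifEqual-yes eq (do-incr rC (fits isStart k<n))
    ... | no ne  = ifEqual-no ne det-skip
    next-level : ∀ l → l < i →
      Det (for rV rN (member ⨟ ifEqual rFound rO skip (incr rC′) ⨟ set! rFound false ⨟ set! rPar false) ⨟ copy! rC rC′ ⨟ set! rC′ false)
        (counting 0 l (level-size l) 0 i rest o) (counting 0 l (level-size (suc l)) 0 i rest o)
    next-level l l<i =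
      for-det rV rN _ n (λ k → counting k l (level-size l) (countBelow k (found l)) i rest o)
        (λ k → counting k l (level-size l) (countBelow (suc k) (found l)) i rest o) (λ k → refl , refl)
        count-found (λ k → refl , refl) n<B refl refl
      ▷ do-copy rC rC′
      ▷ det-≡ (cong (λ c → counting 0 l c 0 i rest o) (count-cong n (λ v v<n → found-next l v v<n))) (do-set rC′ false)
      where
      count-found : ∀ k → k < n → Det (member ⨟ ifEqual rFound rO skip (incr rC′) ⨟ set! rFound false ⨟ set! rPar false)
        (counting k l (level-size l) (countBelow k (found l)) i rest o)
        (counting k l (level-size l) (countBelow (suc k) (found l)) i rest o)
      count-found k k<n = do-member l k 0 _ o (<-trans l<i i<B) (<-trans k<n n<B) refl ▷ tally ▷ do-set rFound false ▷ do-set rPar false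
        where
        tally : Det (ifEqual rFound rO skip (incr rC′))
          (selecting 0 0 0 k l (level-size l) (parent l k) (bit (found l k)) (countBelow k (found l) , i , rest) o)
          (selecting 0 0 0 k l (level-size l) (parent l k) (bit (found l k)) (countBelow (suc k) (found l) , i , rest) o)
        tally with found l k
        ... | true  = ifEqual-no (λ ()) (do-incr rC′ (fits (found l) k<n))
        ... | false = ifEqual-yes refl det-skip

-- There is no primitive for decrementing. The last value that a counter running below `I` takes is
-- `pred I`, and for `I = 0` the register `P` keeps its 0.
decrLevel : Cmd 28
decrLevel = for rJ₀ rI (copy! rP rJ₀) ⨟ copy! rI rP ⨟ set! rP false

-- Applies to Val, the entry (A , B) of the residual matrix, the effect of
-- pushing a unit along the edge from Par to X.
pushVal : Cmd 28
pushVal = ifEqual rPar rX skip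
  (ifEqual rPar rA (ifEqual rX rB (set! rVal false) skip) skip ⨟
   ifEqual rPar rB (ifEqual rX rA (set! rVal true) skip) skip)

-- The size of the lower level is counted anew from level 0 at each step back, since the sizes of
-- all levels cannot be kept in logarithmic space.
backStep : Cmd 28
backStep = decrLevel ⨟ count ⨟ copy! rV rX ⨟ copy! rL rI ⨟ member ⨟ pushVal ⨟ copy! rX rPar ⨟
  set! rV false ⨟ set! rL false ⨟ set! rC false ⨟ set! rPar false ⨟ set! rFound false

augmentVal : Cmd 28
augmentVal = copy! rX rT ⨟ copy! rI rN ⨟ for rM rN backStep ⨟ set! rI false ⨟ set! rX false

bitOf : InputSymbol → Maybe Bool
bitOf (sym b) = just b
bitOf _       = nothing

-- Both emissions depend on the presence of an input bit at their position. So a truncated matrix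
-- yields an equally truncated one, whatever `n` claims.
entryPair : Cmd 28
entryPair = ifEdge rA rB (set! rVal true) skip ⨟ augmentVal ⨟ copy! rP rA ⨟ copy! rQ rB ⨟ seek ⨟
  perform! (look (λ a → false , right , bitOf a)) ⨟
  ifEqual rVal rO (perform! (look (λ a → false , stay , Maybe.map (const false) (bitOf a))))
                  (perform! (look (λ a → false , stay , Maybe.map (const true) (bitOf a)))) ⨟
  tidy ⨟ set! rVal false

matrixPairs : Cmd 28
matrixPairs = for rA rN (for rB rN entryPair)

-- The entry (a , b) of a residual matrix after pushing a unit along (p , x).
pushBit : ℕ → ℕ → ℕ → ℕ → Bool → Bool
pushBit p x a b w =
  if neq p x ∧ (not (neq p b) ∧ not (neq x a)) then true else
  if neq p x ∧ (not (neq p a) ∧ not (neq x b)) then false else w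

push : ℕ → ℕ → (ℕ → ℕ → Bool) → ℕ → ℕ → Bool
push p x r a b = pushBit p x a b (r a b)

module Pushing (n s t : ℕ) (E : ℕ → ℕ → Bool) where
  open Levels n s E

  -- The walk from t back to s, which waits at t until t leaves the level.
  vertex : ℕ → ℕ
  vertex zero    = t
  vertex (suc m) = parent (n ∸ suc m) (vertex m)

  residual : ℕ → ℕ → ℕ → Bool
  residual zero    = E
  residual (suc m) = push (vertex (suc m)) (vertex m) (residual m)

module Augmenting (B : ℕ) (x : Word) (n b s t : ℕ) (n<B : n < B) (b<B : b < B) (t<B : t < B)
  (E : ℕ → ℕ → Bool) (E-spec : ∀ u v → isOne (readInput x (suc (place n b u v))) ≡ E u v) where
  open Counting B x n b s n<B b<B E E-spec public
  open Pushing n s t E public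

  vertex-bound : ∀ m → vertex m < B
  vertex-bound zero    = t<B
  vertex-bound (suc m) = parent-bound (n ∸ suc m) (vertex m) n<B (vertex-bound m)

  module _ (u v : ℕ) (u<n : u < n) (v<n : v < n) (o : Word) where

    private
      u<B : u < B
      u<B = <-trans u<n n<B
      v<B : v < B
      v<B = <-trans v<n n<B

      augmenting : ℕ → ℕ → ℕ → Bool → State 28
      augmenting i y m w = counting 0 0 0 0 i (y , m , bit w , u , v , t , tt) o

    do-decr : ∀ {i y m w} → i < B → Det decrLevel (augmenting i y m w) (augmenting (pred i) y m w)
    do-decr {i} {y} {m} {w} i<B = for-det rJ₀ rI (copy! rP rJ₀) i
      (λ k → at k (pred k)) (λ k → at k k) (λ k → refl , refl) (λ k _ → do-copy rP rJ₀) (λ k → refl , refl) i<B refl refl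
      ▷ do-copy rI rP ▷ do-set rP false
      where
      at : ℕ → ℕ → State 28
      at k p = state 0 (k , 0 , p , proj₂ (proj₂ (proj₂ (regs (augmenting i y m w))))) o

    do-push : ∀ {l c p f i y m} (r : ℕ → ℕ → Bool) →
      let found-at w = selecting 0 0 0 y l c p f (0 , i , y , m , bit w , u , v , t , tt) o in
      Det pushVal (found-at (r u v)) (found-at (push p y r u v))
    do-push {l} {c} {p} {f} {i} {y} {m} r with p ≟ y
    ... | yes p≡y = ifEqual-yes p≡y det-skip
    ... | no p≢y with p ≟ u | y ≟ v | p ≟ v | y ≟ u
    -- The command applies its two rules one after the other, `pushBit` picks one of them. Both
    -- could fire only for `p ≡ y`, which the first test has excluded.
    ... | yes p≡u | _       | yes p≡v | yes y≡u = contradiction (trans p≡u (≡-sym y≡u)) p≢y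
    ... | yes p≡u | yes y≡v | yes p≡v | _       = contradiction (trans p≡v (≡-sym y≡v)) p≢y
    ... | yes p≡u | yes y≡v | no p≢v  | _       = ifEqual-no p≢y (ifEqual-yes p≡u (ifEqual-yes y≡v (do-set rVal false)) ▷ ifEqual-no p≢v det-skip)
    ... | yes p≡u | no y≢v  | yes p≡v | no y≢u  = ifEqual-no p≢y (ifEqual-yes p≡u (ifEqual-no y≢v det-skip) ▷ ifEqual-yes p≡v (ifEqual-no y≢u det-skip))
    ... | yes p≡u | no y≢v  | no p≢v  | _       = ifEqual-no p≢y (ifEqual-yes p≡u (ifEqual-no y≢v det-skip) ▷ ifEqual-no p≢v det-skip)
    ... | no p≢u  | _       | yes p≡v | yes y≡u = ifEqual-no p≢y (ifEqual-no p≢u det-skip ▷ ifEqual-yes p≡v (ifEqual-yes y≡u (do-set rVal true)))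
    ... | no p≢u  | _       | yes p≡v | no y≢u  = ifEqual-no p≢y (ifEqual-no p≢u det-skip ▷ ifEqual-yes p≡v (ifEqual-no y≢u det-skip))
    ... | no p≢u  | _       | no p≢v  | _       = ifEqual-no p≢y (ifEqual-no p≢u det-skip ▷ ifEqual-no p≢v det-skip)

    do-back : ∀ m → m < n → Det backStep (augmenting (n ∸ m) (vertex m) m (residual m u v))
      (augmenting (n ∸ suc m) (vertex (suc m)) m (residual (suc m) u v))
    do-back m m<n =
      det-≡ (cong (λ i → augmenting i (vertex m) m (residual m u v)) (pred[m∸n]≡m∸[1+n] n m)) (do-decr (≤-<-trans (m∸n≤m n m) n<B))
      ▷ do-count level<B
      ▷ do-copy rV rX ▷ do-copy rL rI ▷ do-member (n ∸ suc m) (vertex m) 0 _ o level<B (vertex-bound m) refl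
      ▷ do-push (residual m) ▷ do-copy rX rPar
      ▷ do-set rV false ▷ do-set rL false ▷ do-set rC false ▷ do-set rPar false ▷ do-set rFound false
      where
      level<B : n ∸ suc m < B
      level<B = ≤-<-trans (m∸n≤m n (suc m)) n<B

    do-augment : Det augmentVal (augmenting 0 0 0 (E u v)) (augmenting 0 0 0 (residual n u v))
    do-augment = do-copy rX rT ▷ do-copy rI rN
      ▷ for-det rM rN backStep n (λ m → augmenting (n ∸ m) (vertex m) m (residual m u v))
          (λ m → augmenting (n ∸ suc m) (vertex (suc m)) m (residual (suc m) u v))
          (λ m → refl , refl) do-back (λ m → refl , refl) n<B refl refl
      ▷ do-set rI false ▷ do-set rX false

    entryOut : Word
    entryOut = emitTo (emitTo o (bitOf (readInput x (place n b u v))))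
      (Maybe.map (const (residual n u v)) (bitOf (readInput x (suc (place n b u v)))))

    output : Word → State 28
    output o′ = counting 0 0 0 0 0 (0 , 0 , 0 , u , v , t , tt) o′

    do-entry : Det entryPair (output o) (output entryOut)
    do-entry = read ▷ do-augment ▷ do-copy rP rA ▷ do-copy rQ rB ▷ do-seek u<B v<B
      ▷ do-look copied ▷ put (residual n u v) ▷ do-tidy ▷ do-set rVal false
      where
      read : Det (ifEdge rA rB (set! rVal true) skip) (output o) (augmenting 0 0 0 (E u v))
      read with E u v in e
      ... | true  = edge-yes (# 19) (# 20) u<B v<B e (do-set rVal true)
      ... | false = edge-no (# 19) (# 20) u<B v<B e det-skip
      rest : Bool → Tup ℕ 22
      rest w = proj₂ (proj₂ (proj₂ (proj₂ (proj₂ (proj₂ (regs (augmenting 0 0 0 w)))))))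
      o₁ : Word
      o₁ = emitTo o (bitOf (readInput x (place n b u v)))
      beside : Bool → Word → State 28
      beside w = state (clamp (suc (place n b u v))) (0 , 0 , u , v , n , b , rest w)
      copied : _≡_ {A = Bool × State 28}
        (false , state (moveInput x right (clamp (place n b u v))) (0 , 0 , u , v , n , b , rest (residual n u v))
          (emitTo o (bitOf (readInput x (clamp (place n b u v))))))
        (false , beside (residual n u v) o₁)
      copied = cong₂ (λ h a → false , state h (0 , 0 , u , v , n , b , rest (residual n u v)) (emitTo o (bitOf a)))
        (clamp-suc (place n b u v) _) (readInput-clamp (place n b u v))
      writes : ∀ w → Det (perform! (look (λ a → false , stay , Maybe.map (const w) (bitOf a)))) (beside w o₁)
        (beside w (emitTo o₁ (Maybe.map (const w) (bitOf (readInput x (suc (place n b u v)))))))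
      writes w = do-look (cong (λ a → false , beside w (emitTo o₁ (Maybe.map (const w) (bitOf a)))) (readInput-clamp (suc (place n b u v))))
      put : ∀ w → Det (ifEqual rVal rO (perform! (look (λ a → false , stay , Maybe.map (const false) (bitOf a))))
                                 (perform! (look (λ a → false , stay , Maybe.map (const true) (bitOf a)))))
        (beside w o₁) (beside w (emitTo o₁ (Maybe.map (const w) (bitOf (readInput x (suc (place n b u v)))))))
      put true  = ifEqual-no (λ ()) (writes true)
      put false = ifEqual-yes refl (writes false)

  rowOut : ℕ → ℕ → Word → Word
  rowOut u zero    o = o
  rowOut u (suc k) o = emitTo (emitTo (rowOut u k o) (bitOf (readInput x (place n b u k))))
    (Maybe.map (const (residual n u k)) (bitOf (readInput x (suc (place n b u k)))))

  matrixOut : ℕ → Word → Word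
  matrixOut zero    o = o
  matrixOut (suc u) o = rowOut u n (matrixOut u o)

  do-matrix : ∀ {o} → Det matrixPairs (counting 0 0 0 0 0 (0 , 0 , 0 , 0 , 0 , t , tt) o)
    (counting 0 0 0 0 0 (0 , 0 , 0 , 0 , 0 , t , tt) (matrixOut n o))
  do-matrix {o} = for-det rA rN (for rB rN entryPair) n (λ u → at u 0 (matrixOut u o)) (λ u → at u 0 (matrixOut (suc u) o))
    (λ u → refl , refl)
    (λ u u<n → for-det rB rN entryPair n (λ v → at u v (rowOut u v (matrixOut u o))) (λ v → at u v (rowOut u (suc v) (matrixOut u o)))
      (λ v → refl , refl) (λ v v<n → do-entry u v u<n v<n (rowOut u v (matrixOut u o))) (λ v → refl , refl) n<B refl refl)
    (λ u → refl , refl) n<B refl refl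
    where
    at : ℕ → ℕ → Word → State 28
    at u v o′ = counting 0 0 0 0 0 (0 , 0 , 0 , u , v , t , tt) o′

-- The initial function and the iterator

-- A word starts with a block 1ⁿ0; the final 0 may be missing at the end.
ones : Word → ℕ
ones (true ∷ w) = suc (ones w)
ones _          = 0

block rest : Word → Word
block (true ∷ w)  = true ∷ block w
block (false ∷ w) = false ∷ []
block []          = []
rest (true ∷ w)  = rest w
rest (false ∷ w) = w
rest []          = []

-- For the zero flow the residual matrix is the edge matrix itself.
double : Word → Word
double []      = []
double (b ∷ w) = b ∷ b ∷ double w

-- The bit `e ∧ not r` is the flow along the pair. An unpaired last bit, possible only on malformed
-- words, is passed on as it is.
select : Word → Word
select []          = []
select (e ∷ [])    = e ∷ []
select (e ∷ r ∷ w) = (e ∧ not r) ∷ select w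

prefix body : Word → Word
prefix w = block w ++ block (rest w) ++ block (rest (rest w))
body w = rest (rest (rest w))

nth : Word → ℕ → Maybe Bool
nth []      i       = nothing
nth (b ∷ w) zero    = just b
nth (b ∷ w) (suc i) = nth w i

isTrue : Maybe Bool → Bool
isTrue (just b) = b
isTrue nothing  = false

offset : ℕ → ℕ → ℕ → ℕ
offset n u v = place n 0 u v

entryBit : ℕ → Word → ℕ → ℕ → Bool
entryBit n w u v = isTrue (nth w (suc (offset n u v)))

pairWord : ℕ → Word → (ℕ → ℕ → Bool) → ℕ → ℕ → Word
pairWord n w r u v = fromMaybe (nth w (offset n u v)) ++ fromMaybe (Maybe.map (const (r u v)) (nth w (suc (offset n u v))))

concatBelow : ℕ → (ℕ → Word) → Word
concatBelow zero    g = []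
concatBelow (suc k) g = concatBelow k g ++ g k

rowWord : ℕ → Word → (ℕ → ℕ → Bool) → ℕ → ℕ → Word
rowWord n w r u k = concatBelow k (pairWord n w r u)

matrixWord : ℕ → Word → (ℕ → ℕ → Bool) → ℕ → Word
matrixWord n w r k = concatBelow k (λ u → rowWord n w r u n)

augmented : ℕ → ℕ → ℕ → Word → ℕ → ℕ → Bool
augmented n s t w = Pushing.residual n s t (entryBit n w) n

augment : Word → Word
augment w = prefix w ++ matrixWord n (body w) (augmented n (ones (rest w)) (ones (rest (rest w))) (body w)) n
  where n = ones w

-- The parameter counts the augmentations still to be made.
iterator : Word × ℕ → Word × ℕ
iterator (w , zero)  = select (body w) , 0
iterator (w , suc k) = augment w , k

initialize : Word × ℕ → Word × ℕ
initialize (w , k) = prefix w ++ double (body w) , k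

-- Commands for the initial function and the iterator

copyOne copyZero : Bool → InputSymbol → Bool × Move × Maybe Bool
copyOne e (sym true) = true , right , (if e then just true else nothing)
copyOne e _          = false , stay , nothing
copyZero e (sym false) = true , right , (if e then just false else nothing)
copyZero e _           = false , stay , nothing

-- `rBase` follows the head through the blocks and thus ends up as the position where the pairs of
-- bits start; `C` counts the ones of the block. The flag decides whether the block is copied to the
-- output.
passBlock : Bool → Cmd 28 → Cmd 28
passBlock e C = while (look (copyOne e)) (incr rBase ⨟ C) ⨟ cond (look (copyZero e)) (incr rBase) skip

isBit : InputSymbol → Bool
isBit (sym _) = true
isBit _       = false

bit? : Prim 28
bit? = look (λ a → isBit a , stay , nothing)

-- For an unpaired last bit `selectBits` reads the right marker as second bit. `isOne` takes it for
-- a 0, so that the first bit is emitted unchanged, as `select` demands.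
doubleBits selectBits : Cmd 28
doubleBits = while bit? (perform! (look (λ a → false , stay , bitOf a)) ⨟ perform! (look (λ a → false , right , bitOf a)))
selectBits = while bit? (cond (look (λ a → isOne a , right , nothing))
  (perform! (look (λ a → false , right , just (not (isOne a)))))
  (perform! (look (λ a → false , right , just false))))

-- The counting of the input leaves its length in register 0, which is `rJ₀`, and the head on the
-- right marker.
start-up : Cmd 28
start-up = set! rJ₀ false ⨟ rewind ⨟ right!

initializer : Cmd 28
initializer = start-up ⨟ set! rBase true ⨟
  passBlock true skip ⨟ passBlock true skip ⨟ passBlock true skip ⨟ passBlock true skip ⨟ doubleBits

-- The first symbol tells whether the parameter is positive. If so, skipping this 1 decrements the
-- unary parameter; otherwise the emitted 0 encodes the output parameter 0. In both cases the head
-- is then at position 2, the value given to `rBase`.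
iteration : Cmd 28
iteration = start-up ⨟ cond one?
  (right! ⨟ set! rBase true ⨟ incr rBase ⨟ passBlock true skip ⨟
    passBlock true (incr rN) ⨟ passBlock true (incr rS) ⨟ passBlock true (incr rT) ⨟ rewind ⨟ matrixPairs)
  (perform! (look (λ a → false , right , just false)) ⨟ set! rBase true ⨟ incr rBase ⨟
    passBlock false skip ⨟ passBlock false skip ⨟ passBlock false skip ⨟ selectBits)

block-rest : ∀ w → block w ++ rest w ≡ w
block-rest []          = refl
block-rest (true ∷ w)  = cong (true ∷_) (block-rest w)
block-rest (false ∷ w) = refl

ones≤block : ∀ w → ones w ≤ length (block w)
ones≤block []          = z≤n
ones≤block (true ∷ w)  = s≤s (ones≤block w)
ones≤block (false ∷ w) = z≤n

readInput-drop : ∀ x p → readInput x (suc p) ≡ readInput (drop p x) 1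
readInput-drop x       zero    = refl
readInput-drop []      (suc p) = refl
readInput-drop (b ∷ x) (suc p) = readInput-drop x p

drop-suc : ∀ p x {b : Bool} {w} → drop p x ≡ b ∷ w → drop (suc p) x ≡ w
drop-suc zero    (_ ∷ x) refl = refl
drop-suc (suc p) (_ ∷ x) eq   = drop-suc p x eq

drop-< : ∀ p x {b : Bool} {w} → drop p x ≡ b ∷ w → p < length x
drop-< zero    (_ ∷ x) eq = s≤s z≤n
drop-< (suc p) (_ ∷ x) eq = s≤s (drop-< p x eq)

drop-end : ∀ p x → p ≤ length x → drop p x ≡ ([] {A = Bool}) → p ≡ length x
drop-end zero    []      p≤ eq = refl
drop-end (suc p) (_ ∷ x) (s≤s p≤) eq = cong suc (drop-end p x p≤ eq)

drop-block : ∀ p x w → p ≤ length x → drop p x ≡ w → p + length (block w) ≤ length x × drop (p + length (block w)) x ≡ rest w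
drop-block p x []          p≤ eq = subst (_≤ length x) (≡-sym (+-identityʳ p)) p≤ , trans (cong (λ q → drop q x) (+-identityʳ p)) eq
drop-block p x (true ∷ w)  p≤ eq = subst (λ q → q ≤ length x × drop q x ≡ rest w) (≡-sym (+-suc p _))
  (drop-block (suc p) x w (drop-< p x eq) (drop-suc p x eq))
drop-block p x (false ∷ w) p≤ eq = subst (λ q → q ≤ length x × drop q x ≡ w) (≡-sym (+-comm p 1)) (drop-< p x eq , drop-suc p x eq)

echo : Bool → Word → Word → Word
echo true  o w = o ++ w
echo false o w = o

echo-∷ : ∀ e o b w → echo e (emitTo o (if e then just b else nothing)) w ≡ echo e o (b ∷ w)
echo-∷ true  o b w = ++-assoc o (b ∷ []) w
echo-∷ false o b w = refl

echo-[] : ∀ e o → echo e o [] ≡ o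
echo-[] true  o = ++-identityʳ o
echo-[] false o = refl

-- Passing over the header and the body of a word

module Scanning (B : ℕ) (x : Word) (size<B : suc (length x) < B) where
  open Logic {28} B x

  step-right : ∀ {p} → p < length x → moveInput x right (suc p) ≡ suc (suc p)
  step-right p< = m≤n⇒m⊓n≡m (s≤s p<)

  stay-right : moveInput x right (suc (length x)) ≡ suc (length x)
  stay-right = m≥n⇒m⊓n≡n (n≤1+n _)

  read-∷ : ∀ {p b w} → drop p x ≡ b ∷ w → readInput x (suc p) ≡ sym b
  read-∷ {p} eq = trans (readInput-drop x p) (cong (λ w → readInput w 1) eq)

  read-[] : ∀ {p} → drop p x ≡ [] → readInput x (suc p) ≡ ⊣
  read-[] {p} eq = trans (readInput-drop x p) (cong (λ w → readInput w 1) eq)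

  stays : ∀ {f : InputSymbol → Bool × Move × Maybe Bool} {p t o a b e} → readInput x (suc p) ≡ a → f a ≡ (b , stay , e) →
    Decides (look f) (state (suc p) t o) b (state (suc p) t (emitTo o e))
  stays {f} {p} {t} {o} {a} {b} {e} r q = look-decides eval
    where
    eval : evalPrim {28} B x (look f) (state (suc p) t o) ≡ (b , state (suc p) t (emitTo o e))
    eval rewrite r | q = refl

  rights : ∀ {f : InputSymbol → Bool × Move × Maybe Bool} {p t o a b e} → p < length x → readInput x (suc p) ≡ a → f a ≡ (b , right , e) →
    Decides (look f) (state (suc p) t o) b (state (suc (suc p)) t (emitTo o e))
  rights {f} {p} {t} {o} {a} {b} {e} p< r q = look-decides eval
    where
    eval : evalPrim {28} B x (look f) (state (suc p) t o) ≡ (b , state (suc (suc p)) t (emitTo o e))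
    eval rewrite r | q = cong (λ h → b , state h t (emitTo o e)) (step-right p<)

  ends : ∀ {f : InputSymbol → Bool × Move × Maybe Bool} {p t o b e} → p ≡ length x → f ⊣ ≡ (b , right , e) →
    Decides (look f) (state (suc p) t o) b (state (suc (length x)) t (emitTo o e))
  ends {f} {p} {t} {o} {b} {e} refl q = look-decides eval
    where
    eval : evalPrim {28} B x (look f) (state (suc (length x)) t o) ≡ (b , state (suc (length x)) t (emitTo o e))
    eval rewrite readInput-beyond x (suc (length x)) ≤-refl | q = cong (λ h → b , state h t (emitTo o e)) stay-right

  do-decided : ∀ {f σ b ρ} → Decides (look f) σ b ρ → Det (perform! (look f)) σ ρ
  do-decided {b = true}  d = cond-yes d det-skip
  do-decided {b = false} d = cond-no d det-skip

  module Block (mk : ℕ → ℕ → Tup ℕ 28) (C : Cmd 28)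
    (get-base : ∀ β v → get rBase (mk β v) ≡ β)
    (set-base : ∀ β β′ v → set rBase β′ (mk β v) ≡ mk β′ v)
    (do-C : ∀ {h β v o} → suc v < B → Det C (state h (mk β v) o) (state h (mk β (suc v)) o)) where

    do-base : ∀ {p h v o} → p < length x → Det (incr rBase) (state h (mk (suc p) v) o) (state h (mk (suc (suc p)) v) o)
    do-base {p} {h} {v} {o} p< = det-≡ (cong (λ t → state h t o)
        (trans (cong (λ β → set rBase (suc β) (mk (suc p) v)) (get-base (suc p) v)) (set-base (suc p) _ v)))
      (do-incr rBase (subst (λ β → suc β < B) (≡-sym (get-base (suc p) v)) (≤-<-trans (s≤s p<) size<B)))

    -- The condition `v ≤ p` ties the counter to the head position and thereby keeps it below `B`,
    -- so `C` cannot overflow.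
    do-block : ∀ e w p v o → drop p x ≡ w → v ≤ p →
      Det (passBlock e C) (state (suc p) (mk (suc p) v) o)
        (state (suc (p + length (block w))) (mk (suc (p + length (block w))) (v + ones w)) (echo e o (block w)))
    do-block e [] p v o eq v≤ rewrite +-identityʳ p | +-identityʳ v | echo-[] e o =
      while-no (stays (read-[] eq) refl) ▷ cond-no (stays (read-[] eq) refl) det-skip
    do-block e (false ∷ w) p v o eq v≤ rewrite +-comm p 1 | +-identityʳ v =
      while-no (stays (read-∷ eq) refl) ▷
      det-≡ (cong (state _ _) (trans (≡-sym (echo-[] e _)) (echo-∷ e o false [])))
        (cond-yes (rights (drop-< p x eq) (read-∷ eq) refl) (do-base (drop-< p x eq)))
    do-block e (true ∷ w) p v o eq v≤ rewrite +-suc p (length (block w)) | +-suc v (ones w) | ≡-sym (echo-∷ e o true (block w)) =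
      same (λ { (seq l c) → to tail (seq (to first l) c) }) (λ r → unfold (from tail r))
      where
      tail : Det (passBlock e C) (state (suc (suc p)) (mk (suc (suc p)) (suc v)) (emitTo o (if e then just true else nothing))) _
      tail = do-block e w (suc p) (suc v) _ (drop-suc p x eq) (s≤s v≤)
      v< : suc v < B
      v< = ≤-<-trans (≤-trans (s≤s v≤) (drop-< p x eq)) (<-trans ≤-refl size<B)
      first : Same (while (look (copyOne e)) (incr rBase ⨟ C)) (state (suc p) (mk (suc p) v) o)
        (while (look (copyOne e)) (incr rBase ⨟ C)) (state (suc (suc p)) (mk (suc (suc p)) (suc v)) (emitTo o (if e then just true else nothing)))
      first = while-yes (rights (drop-< p x eq) (read-∷ eq) refl) (do-base (drop-< p x eq) ▷ do-C v<) (same id id)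
      unfold : ∀ {ρ} → Eval (passBlock e C) (state (suc (suc p)) (mk (suc (suc p)) (suc v)) (emitTo o (if e then just true else nothing))) ρ →
        Eval (passBlock e C) (state (suc p) (mk (suc p) v) o) ρ
      unfold (seq l c) = seq (from first l) c

  do-double : ∀ w p t o → p ≤ length x → drop p x ≡ w → Det doubleBits (state (suc p) t o) (state (suc (length x)) t (o ++ double w))
  do-double [] p t o p≤ eq rewrite drop-end p x p≤ eq | ++-identityʳ o = while-no (stays (read-[] eq′) refl)
    where eq′ = trans (cong (λ q → drop q x) (≡-sym (drop-end p x p≤ eq))) eq
  do-double (b ∷ w) p t o p≤ eq = while-yes (stays (read-∷ eq) refl)
    (do-decided (stays (read-∷ eq) refl) ▷ do-decided (rights (drop-< p x eq) (read-∷ eq) refl))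
    (det-≡ (cong (state _ t) (trans (cong (_++ double w) (++-assoc o _ _)) (++-assoc o _ _)))
      (do-double w (suc p) t _ (drop-< p x eq) (drop-suc p x eq)))

  do-select : ∀ w p t o → p ≤ length x → drop p x ≡ w → Det selectBits (state (suc p) t o) (state (suc (length x)) t (o ++ select w))
  do-select [] p t o p≤ eq with drop-end p x p≤ eq
  ... | refl rewrite ++-identityʳ o = while-no (stays (read-[] eq) refl)
  do-select (e ∷ []) p t o p≤ eq = while-yes (stays (read-∷ eq) refl) (write e eq) (finish (drop-end (suc p) x (drop-< p x eq) (drop-suc p x eq)))
    where
    finish : ∀ {o} → suc p ≡ length x → Det selectBits (state (suc (length x)) t o) (state (suc (length x)) t o)
    finish end = while-no (stays (readInput-beyond x (suc (length x)) ≤-refl) refl)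
    write : ∀ e → drop p x ≡ e ∷ [] → Det (cond (look (λ a → isOne a , right , nothing))
      (perform! (look (λ a → false , right , just (not (isOne a)))))
      (perform! (look (λ a → false , right , just false)))) (state (suc p) t o) (state (suc (length x)) t (o ++ e ∷ []))
    write true  eq = cond-yes (rights (drop-< p x eq) (read-∷ eq) refl)
      (do-decided (ends (drop-end (suc p) x (drop-< p x eq) (drop-suc p x eq)) refl))
    write false eq = cond-no (rights (drop-< p x eq) (read-∷ eq) refl)
      (do-decided (ends (drop-end (suc p) x (drop-< p x eq) (drop-suc p x eq)) refl))
  do-select (e ∷ r ∷ w) p t o p≤ eq = while-yes (stays (read-∷ eq) refl) (write e eq)
    (det-≡ (cong (state _ t) (++-assoc o _ _)) (do-select w (suc (suc p)) t _ (drop-< (suc p) x eq′) (drop-suc (suc p) x eq′)))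
    where
    eq′ : drop (suc p) x ≡ r ∷ w
    eq′ = drop-suc p x eq
    write : ∀ e → drop p x ≡ e ∷ r ∷ w → Det (cond (look (λ a → isOne a , right , nothing))
      (perform! (look (λ a → false , right , just (not (isOne a)))))
      (perform! (look (λ a → false , right , just false)))) (state (suc p) t o) (state (suc (suc (suc p))) t (o ++ (e ∧ not r) ∷ []))
    write true  eq = cond-yes (rights (drop-< p x eq) (read-∷ eq) refl) (do-decided (rights (drop-< (suc p) x eq′) (read-∷ eq′) refl))
    write false eq = cond-no (rights (drop-< p x eq) (read-∷ eq) refl) (do-decided (rights (drop-< (suc p) x eq′) (read-∷ eq′) refl))

block-unary : ∀ k w → block (unary k ++ false ∷ w) ≡ unary k ++ false ∷ []
block-unary zero    w = refl
block-unary (suc k) w = cong (true ∷_) (block-unary k w)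

rest-unary : ∀ k w → rest (unary k ++ false ∷ w) ≡ w
rest-unary zero    w = refl
rest-unary (suc k) w = rest-unary k w

ones-unary : ∀ k w → ones (unary k ++ false ∷ w) ≡ k
ones-unary zero    w = refl
ones-unary (suc k) w = cong suc (ones-unary k w)

bitOf-nth : ∀ x i → bitOf (readInput x (suc i)) ≡ nth x i
bitOf-nth []      i       = refl
bitOf-nth (b ∷ x) zero    = refl
bitOf-nth (b ∷ x) (suc i) = bitOf-nth x i

isOne-bitOf : ∀ a → isOne a ≡ isTrue (bitOf a)
isOne-bitOf ⊢       = refl
isOne-bitOf ⊣       = refl
isOne-bitOf (sym b) = refl

nth-drop : ∀ p x i → nth x (p + i) ≡ nth (drop p x) i
nth-drop zero    x       i = refl
nth-drop (suc p) []      i = refl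
nth-drop (suc p) (_ ∷ x) i = nth-drop p x i

place-offset : ∀ n b u v → place n b u v ≡ b + offset n u v
place-offset n b u v = trans (cong (_+_ (v * 2)) (rows u)) (x∙yz≈y∙xz (v * 2) b _)
  where
  rows : ∀ u → row n b u ≡ b + row n 0 u
  rows zero    = ≡-sym (+-identityʳ b)
  rows (suc u) = trans (cong (_+_ (n * 2)) (rows u)) (x∙yz≈y∙xz (n * 2) b _)

bit-place : ∀ n p x u v → bitOf (readInput x (place n (suc p) u v)) ≡ nth (drop p x) (offset n u v)
bit-place n p x u v = trans (cong (bitOf ∘ readInput x) (place-offset n (suc p) u v))
  (trans (bitOf-nth x (p + offset n u v)) (nth-drop p x _))

bit-place′ : ∀ n p x u v → bitOf (readInput x (suc (place n (suc p) u v))) ≡ nth (drop p x) (suc (offset n u v))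
bit-place′ n p x u v = trans (cong (bitOf ∘ readInput x ∘ suc) (trans (place-offset n (suc p) u v) (≡-sym (+-suc p _))))
  (trans (bitOf-nth x (p + suc (offset n u v))) (nth-drop p x _))

emit-both : ∀ o a b → emitTo (emitTo o a) b ≡ o ++ (fromMaybe a ++ fromMaybe b)
emit-both o a b = trans (≡-sym (emitTo-++ (emitTo o a) b))
  (trans (cong (_++ fromMaybe b) (≡-sym (emitTo-++ o a))) (++-assoc o (fromMaybe a) (fromMaybe b)))

zeros : ℕ → Tup ℕ 28
zeros β = 0 , 0 , 0 , 0 , 0 , β , const-tup 0 22

initially : Word → State 28
initially x = state (suc (length x)) (suc (length x) , const-tup 0 27) []

-- Complete runs of the two commands

module Running (B : ℕ) (x : Word) (size<B : suc (length x) < B) where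
  open Scanning B x size<B
  open Logic {28} B x
  open Seeking B x 0 0 (≤-trans (s≤s z≤n) size<B) (≤-trans (s≤s z≤n) size<B) _ (λ _ _ → refl) using (do-rewind)

  do-start : Det start-up (initially x) (state 1 (zeros 0) [])
  do-start = do-set rJ₀ false ▷ do-rewind _ ▷ do-look refl

  module Plain = Block (λ β _ → zeros β) skip (λ _ _ → refl) (λ _ _ _ → refl) (λ _ → det-skip)

  do-plain : ∀ e w p o → drop p x ≡ w → Det (passBlock e skip) (state (suc p) (zeros (suc p)) o)
    (state (suc (p + length (block w))) (zeros (suc (p + length (block w)))) (echo e o (block w)))
  do-plain e w p o eq = Plain.do-block e w p 0 o eq z≤n

  module Blocks (p : ℕ) (w : Word) (p≤ : p ≤ length x) (eq : drop p x ≡ w) where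
    p₁ p₂ p₃ : ℕ
    p₁ = p + length (block w)
    p₂ = p₁ + length (block (rest w))
    p₃ = p₂ + length (block (rest (rest w)))

    abstract
      p₁≤ : p₁ ≤ length x
      p₁≤ = proj₁ (drop-block p x w p≤ eq)
      eq₁ : drop p₁ x ≡ rest w
      eq₁ = proj₂ (drop-block p x w p≤ eq)
      p₂≤ : p₂ ≤ length x
      p₂≤ = proj₁ (drop-block p₁ x (rest w) p₁≤ eq₁)
      eq₂ : drop p₂ x ≡ rest (rest w)
      eq₂ = proj₂ (drop-block p₁ x (rest w) p₁≤ eq₁)
      p₃≤ : p₃ ≤ length x
      p₃≤ = proj₁ (drop-block p₂ x (rest (rest w)) p₂≤ eq₂)
      eq₃ : drop p₃ x ≡ body w
      eq₃ = proj₂ (drop-block p₂ x (rest (rest w)) p₂≤ eq₂)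

      ones<B : ∀ {q} v → q + length (block v) ≤ length x → ones v < B
      ones<B {q} v le = ≤-<-trans (≤-trans (ones≤block v) (≤-trans (m≤n+m _ q) le)) (<-trans ≤-refl size<B)

    module Header (o : Word) where
      n s t : ℕ
      n = ones w
      s = ones (rest w)
      t = ones (rest (rest w))

      header : ℕ → ℕ → ℕ → ℕ → Tup ℕ 28
      header n β s t = 0 , 0 , 0 , 0 , n , β , s , 0 , 0 , 0 , 0 , 0 , 0 , 0 , 0 , 0 , 0 , 0 , 0 , 0 , 0 , 0 , 0 , 0 , 0 , 0 , 0 , t , tt

      module N = Block (λ β v → header v β 0 0) (incr rN) (λ _ _ → refl) (λ _ _ _ → refl) (λ lt → do-incr rN lt)
      module S = Block (λ β v → header n β v 0) (incr rS) (λ _ _ → refl) (λ _ _ _ → refl) (λ lt → do-incr rS lt)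
      module T = Block (λ β v → header n β s v) (incr rT) (λ _ _ → refl) (λ _ _ _ → refl) (λ lt → do-incr rT lt)

      o₃ : Word
      o₃ = ((o ++ block w) ++ block (rest w)) ++ block (rest (rest w))

      E-spec : ∀ u v → isOne (readInput x (suc (place n (suc p₃) u v))) ≡ entryBit n (body w) u v
      E-spec u v = trans (isOne-bitOf (readInput x (suc (place n (suc p₃) u v)))) 
        (cong isTrue (trans (bit-place′ n p₃ x u v) (cong (λ z → nth z (suc (offset n u v))) eq₃)))

      open Augmenting B x n (suc p₃) s t (ones<B {p} w p₁≤) (≤-<-trans (s≤s p₃≤) size<B) (ones<B {p₂} (rest (rest w)) p₃≤)
        (entryBit n (body w)) E-spec using (rowOut; matrixOut; do-matrix; residual)

      rowOut-word : ∀ u k o → rowOut u k o ≡ o ++ rowWord n (body w) (residual n) u k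
      rowOut-word u zero    o = ≡-sym (++-identityʳ o)
      rowOut-word u (suc k) o = trans (emit-both (rowOut u k o) (bitOf (readInput x (place n (suc p₃) u k)))
          (Maybe.map (const (residual n u k)) (bitOf (readInput x (suc (place n (suc p₃) u k))))))
        (trans (cong₂ (λ a b → rowOut u k o ++ (fromMaybe a ++ fromMaybe (Maybe.map (const (residual n u k)) b)))
            (trans (bit-place n p₃ x u k) (cong (λ z → nth z (offset n u k)) eq₃))
            (trans (bit-place′ n p₃ x u k) (cong (λ z → nth z (suc (offset n u k))) eq₃)))
          (trans (cong (_++ pairWord n (body w) (residual n) u k) (rowOut-word u k o)) (++-assoc o _ _)))

      matrixOut-word : ∀ u o → matrixOut u o ≡ o ++ matrixWord n (body w) (residual n) u
      matrixOut-word zero    o = ≡-sym (++-identityʳ o)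
      matrixOut-word (suc u) o = trans (rowOut-word u n (matrixOut u o))
        (trans (cong (_++ rowWord n (body w) (residual n) u n) (matrixOut-word u o)) (++-assoc o _ _))

      do-header : Det (passBlock true (incr rN) ⨟ passBlock true (incr rS) ⨟ passBlock true (incr rT) ⨟ rewind ⨟ matrixPairs)
        (state (suc p) (zeros (suc p)) o) (state 0 (header n (suc p₃) s t) (o ++ augment w))
      do-header = N.do-block true w p 0 o eq z≤n ▷ S.do-block true (rest w) p₁ 0 _ eq₁ z≤n
        ▷ T.do-block true (rest (rest w)) p₂ 0 _ eq₂ z≤n ▷ do-rewind _
        ▷ det-≡ (cong (state 0 (header n (suc p₃) s t)) (trans (matrixOut-word n o₃) assoc)) do-matrix
        where
        assoc : o₃ ++ matrixWord n (body w) (residual n) n ≡ o ++ augment w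
        assoc = trans (cong (_++ matrixWord n (body w) (residual n) n)
            (trans (++-assoc (o ++ block w) _ _) (++-assoc o _ _)))
          (++-assoc o (prefix w) _)

  2<B : 1 ≤ length x → 2 < B
  2<B le = ≤-<-trans (s≤s le) size<B

initializer-run : ∀ B w k → let x = pair (w , k) in suc (length x) < B →
  ∃[ τ ] (Logic.Det {28} B x initializer (initially x) τ × outp τ ≡ pair (initialize (w , k)))
initializer-run B w k size<B = _ , det , out-eq
  where
  x : Word
  x = pair (w , k)
  open Logic {28} B x
  open Running B x size<B
  open Scanning B x size<B
  q : ℕ
  q = length (block x)
  start : q ≤ length x × drop q x ≡ w
  start = proj₁ (drop-block 0 x x z≤n refl) , trans (proj₂ (drop-block 0 x x z≤n refl)) (rest-unary k w)
  open Blocks q w (proj₁ start) (proj₂ start)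
  o₃ : Word
  o₃ = ((block x ++ block w) ++ block (rest w)) ++ block (rest (rest w))
  det : Det initializer (initially x) (state (suc (length x)) (zeros (suc p₃)) (o₃ ++ double (body w)))
  det = do-start ▷ do-set rBase true ▷ do-plain true x 0 [] refl ▷ do-plain true w q _ (proj₂ start)
    ▷ do-plain true (rest w) p₁ _ eq₁ ▷ do-plain true (rest (rest w)) p₂ _ eq₂ ▷ do-double (body w) p₃ _ _ p₃≤ eq₃
  out-eq : o₃ ++ double (body w) ≡ unary k ++ false ∷ (prefix w ++ double (body w))
  out-eq = trans (cong (_++ double (body w)) (trans (++-assoc (block x ++ block w) _ _) (++-assoc (block x) _ _)))
    (trans (++-assoc (block x) (prefix w) _) (trans (cong (_++ (prefix w ++ double (body w))) (block-unary k w)) (++-assoc (unary k) _ _)))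

iteration-run : ∀ B w k → let x = pair (w , k) in suc (length x) < B →
  ∃[ τ ] (Logic.Det {28} B x iteration (initially x) τ × outp τ ≡ pair (iterator (w , k)))
iteration-run B w zero size<B = _ , det , refl
  where
  x : Word
  x = pair (w , 0)
  open Logic {28} B x
  open Running B x size<B
  open Scanning B x size<B
  open Blocks 1 w (s≤s z≤n) refl
  det : Det iteration (initially x) (state (suc (length x)) (zeros (suc p₃)) (false ∷ select (body w)))
  det = do-start ▷ cond-no (look-decides refl) (do-look refl ▷ do-set rBase true ▷ do-incr rBase (2<B (s≤s z≤n))
    ▷ do-plain false w 1 _ refl ▷ do-plain false (rest w) p₁ _ eq₁ ▷ do-plain false (rest (rest w)) p₂ _ eq₂
    ▷ do-select (body w) p₃ _ _ p₃≤ eq₃)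
iteration-run B w (suc k) size<B = _ , det , out-eq
  where
  x x′ : Word
  x = pair (w , suc k)
  x′ = pair (w , k)
  open Logic {28} B x
  open Running B x size<B
  q : ℕ
  q = 1 + length (block x′)
  start : q ≤ length x × drop q x ≡ w
  start = proj₁ (drop-block 1 x x′ (s≤s z≤n) refl) , trans (proj₂ (drop-block 1 x x′ (s≤s z≤n) refl)) (rest-unary k w)
  open Blocks q w (proj₁ start) (proj₂ start)
  open Header (block x′)
  det : Det iteration (initially x) (state 0 (header n (suc p₃) s t) (block x′ ++ augment w))
  det = do-start ▷ cond-yes (look-decides refl) (do-look refl ▷ do-set rBase true ▷ do-incr rBase (2<B (s≤s z≤n))
    ▷ do-plain true x′ 1 [] refl ▷ do-header)
  out-eq : block x′ ++ augment w ≡ unary k ++ false ∷ augment w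
  out-eq = trans (cong (_++ augment w) (block-unary k w)) (++-assoc (unary k) _ _)

-- The register bound is a power of two chosen by the layout of the tape, so the run has to be given
-- for every `B` beyond the counted input size. That input and output parameters satisfy the simple
-- inequality lets `id` bound the parameter.
paraFNL : (C : Cmd 28) (F : Word × ℕ → Word × ℕ) → (∀ w k → proj₂ (F (w , k)) ≤ k) →
  (∀ B w k → let x = pair (w , k) in suc (length x) < B →
    ∃[ τ ] (Logic.Det {28} B x C (initially x) τ × outp τ ≡ pair (F (w , k)))) → ParaFNL F
paraFNL C F param run = (id , param) , Simulation.machine (program C) , (λ k → 7 * suc k) , 1 , computable-multiple 6 ,
  λ w k → yields′ w k , λ c r → ≤-trans (Program.space C (pair (w , k)) c r) (width-bound (length w) k _ (narrow w k))
  where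
  len : ∀ w k → length (pair (w , k)) ≡ suc (k + length w)
  len w k = trans (length-++ (unary k)) (trans (cong (_+ suc (length w)) (length-replicate k)) (+-suc k (length w)))
  narrow : ∀ w k → 2 ^ pred (Program.width C (pair (w , k))) ≤ suc (suc (suc (k + length w)))
  narrow w k = ≤-trans (layout-length {27} (suc (length (pair (w , k))))) (≤-reflexive (cong (λ l → suc (suc l)) (len w k)))
  yields′ : ∀ w k → Yields (Simulation.machine (program C)) (pair (w , k)) (pair (F (w , k)))
  yields′ w k with run _ w k (Program.capacity C (pair (w , k)))
  ... | τ , d , eq = Program.yields C (pair (w , k)) _ (τ , det-eval d) (λ τ′ e → trans (cong outp (det-unique d e)) eq)
    where open Logic {28} (2 ^ Program.width C (pair (w , k))) (pair (w , k))

initialize-paraFNL : ParaFNL initialize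
initialize-paraFNL = paraFNL initializer initialize (λ w k → ≤-refl) initializer-run

iterator-paraFNL : ParaFNL iterator
iterator-paraFNL = paraFNL iteration iterator (λ { w zero → z≤n ; w (suc k) → n≤1+n k }) iteration-run

-- Residual matrices and flows

module LevelProperties (n s : ℕ) (E : ℕ → ℕ → Bool) where
  open Levels n s E

  R-mono : ∀ {l l′ v} → l ≤ l′ → R l v ≡ true → R l′ v ≡ true
  R-mono {l} {l′} {v} l≤ Rv = subst (λ i → R i v ≡ true) (ℕ.m∸n+n≡m l≤) (go (l′ ∸ l)) where
    go : ∀ d → R (d ℕ.+ l) v ≡ true
    go zero    = Rv
    go (suc d) = R-weaken (d ℕ.+ l) (go d)

  Stable : ℕ → Set
  Stable l = ∀ {v} → R (suc l) v ≡ true → R l v ≡ true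

  stable-suc : ∀ {l} → Stable l → Stable (suc l)
  stable-suc {l} st {v} Rv with R-suc-elim (suc l) {v} Rv
  ... | inj₁ p = p
  ... | inj₂ (v< , u , Ru , Euv) = R-edge l (st Ru) Euv v<

  count-mono : ∀ k {p q} → (∀ v → p v ≡ true → q v ≡ true) → countBelow k p ≤ countBelow k q
  count-mono zero    sub = z≤n
  count-mono (suc k) {p} {q} sub with p k in pk | q k in qk
  ... | true  | true  = s≤s (count-mono k sub)
  ... | true  | false = contradiction (trans (≡-sym (sub k pk)) qk) (λ ())
  ... | false | true  = ℕ.m≤n⇒m≤1+n (count-mono k sub)
  ... | false | false = count-mono k sub

  count-≡ : ∀ k {p q} → (∀ v → p v ≡ true → q v ≡ true) → countBelow k p ≡ countBelow k q →
            ∀ {v} → v < k → q v ≡ true → p v ≡ true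
  count-≡ (suc k) {p} {q} sub eq {v} v< qv with p k in pk | q k in qk
  ... | true  | false = contradiction (trans (≡-sym (sub k pk)) qk) (λ ())
  ... | false | true  = contradiction (ℕ.≤-reflexive (≡-sym eq)) (ℕ.<⇒≱ (s≤s (count-mono k {p} {q} sub)))
  ... | true  | true with v ℕ.≟ k
  ...   | yes refl = pk
  ...   | no v≢k   = count-≡ k {p} {q} sub (ℕ.suc-injective eq) (ℕ.≤∧≢⇒< (ℕ.≤-pred v<) v≢k) qv
  count-≡ (suc k) {p} {q} sub eq {v} v< qv | false | false with v ℕ.≟ k
  ...   | yes refl = contradiction (trans (≡-sym qv) qk) (λ ())
  ...   | no v≢k   = count-≡ k {p} {q} sub eq (ℕ.≤∧≢⇒< (ℕ.≤-pred v<) v≢k) qv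

  count-pos : ∀ k p {v} → v < k → p v ≡ true → 1 ≤ countBelow k p
  count-pos (suc k) p {v} v< pv with p k in pk
  ... | true = s≤s z≤n
  ... | false with v ℕ.≟ k
  ... | yes refl = contradiction (trans (≡-sym pv) pk) (λ ())
  ... | no v≢k   = count-pos k p (ℕ.≤∧≢⇒< (ℕ.≤-pred v<) v≢k) pv

  R-source : s < n → R 0 s ≡ true
  R-source s<n rewrite below-intro s<n | neq-≡ {s} refl = refl

  module _ (s<n : s < n) where

    -- As long as no level is stable, each one adds at least one vertex to the one before.
    stable-or-large : ∀ l → Stable l ⊎ suc l ≤ level-size l
    stable-or-large zero = inj₂ (count-pos n (R 0) s<n (R-source s<n))
    stable-or-large (suc l) with stable-or-large l
    ... | inj₁ st = inj₁ (stable-suc {l} st)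
    ... | inj₂ le with level-size l ℕ.≟ level-size (suc l)
    ... | yes eq = inj₁ (stable-suc {l} (λ {v} Rv → count-≡ n {R l} {R (suc l)} (λ _ → R-weaken l) eq (R-below (suc l) {v} Rv) Rv))
    ... | no ne  = inj₂ (ℕ.≤-<-trans le (ℕ.≤∧≢⇒< (count-mono n {R l} {R (suc l)} (λ _ → R-weaken l)) ne))

    -- Level `n` has at most `n` vertices, so the growth alternative fails and the level is stable;
    -- this makes it a cut when it misses `t`.
    closed : ∀ {u v} → R n u ≡ true → v < n → E u v ≡ true → R n v ≡ true
    closed Ru v<n Euv with stable-or-large n
    ... | inj₁ st = st (R-edge n Ru Euv v<n)
    ... | inj₂ le = contradiction le (ℕ.<⇒≱ (s≤s (count-≤ n (R n))))

pushBit-idle : ∀ {p x} a b w → p ≡ x → pushBit p x a b w ≡ w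
pushBit-idle {p} a b w eq rewrite neq-≡ eq = refl

pushBit-back : ∀ {p x} w → p ≢ x → pushBit p x x p w ≡ true
pushBit-back {p} {x} w ne rewrite neq-≢ ne | neq-≡ {p} refl | neq-≡ {x} refl = refl

pushBit-forth : ∀ {p x} w → p ≢ x → pushBit p x p x w ≡ false
pushBit-forth {p} {x} w ne rewrite neq-≢ ne | neq-≡ {p} refl | neq-≡ {x} refl = refl

pushBit-other : ∀ {p x} a b w → ¬ (a ≡ x × b ≡ p) → ¬ (a ≡ p × b ≡ x) → pushBit p x a b w ≡ w
pushBit-other {p} {x} a b w ¬back ¬forth with p ℕ.≟ x | p ℕ.≟ b | x ℕ.≟ a | p ℕ.≟ a | x ℕ.≟ b
... | yes _ | _        | _        | _        | _        = refl
... | no _  | yes p≡b  | yes x≡a  | _        | _        = contradiction (≡-sym x≡a , ≡-sym p≡b) ¬back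
... | no _  | _        | _        | yes p≡a  | yes x≡b  = contradiction (≡-sym p≡a , ≡-sym x≡b) ¬forth
... | no _  | no _     | _        | no _     | _        = refl
... | no _  | no _     | _        | yes _    | no _     = refl
... | no _  | yes _    | no _     | no _     | _        = refl
... | no _  | yes _    | no _     | yes _    | no _     = refl

-- Integer sums, net flow and cuts

∑ℤ : ∀ {n} → (Fin n → ℤ) → ℤ
∑ℤ = sumOver ℤ.+-0-commutativeMonoid

module Sumℤ = Algebra.Properties.CommutativeMonoid.Sum ℤ.+-0-commutativeMonoid

ι : Bool → ℤ
ι b = if b then + 1 else + 0

∑ℤ-neg : ∀ {n} (f : Fin n → ℤ) → ∑ℤ (λ v → ℤ.- f v) ≡ ℤ.- ∑ℤ f
∑ℤ-neg {zero}  f = refl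
∑ℤ-neg {suc n} f = trans (cong (ℤ._+_ (ℤ.- f zero)) (∑ℤ-neg (f ∘ suc))) (≡-sym (ℤ.neg-distrib-+ (f zero) _))

∑ℤ-zero : ∀ {n} (f : Fin n → ℤ) → (∀ v → f v ≡ + 0) → ∑ℤ f ≡ + 0
∑ℤ-zero {zero}  f eq = refl
∑ℤ-zero {suc n} f eq = cong₂ ℤ._+_ (eq zero) (∑ℤ-zero (f ∘ suc) (eq ∘ suc))

∑ℤ-nonneg : ∀ {n} (f : Fin n → ℤ) → (∀ v → + 0 ℤ.≤ f v) → + 0 ℤ.≤ ∑ℤ f
∑ℤ-nonneg {zero}  f le = ℤ.≤-refl
∑ℤ-nonneg {suc n} f le = ℤ.+-mono-≤ (le zero) (∑ℤ-nonneg (f ∘ suc) (le ∘ suc))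

∑ℤ-single : ∀ {n} (f : Fin n → ℤ) s → (∀ v → v ≢ s → f v ≡ + 0) → ∑ℤ f ≡ f s
∑ℤ-single f zero    eq = trans (cong (ℤ._+_ (f zero)) (∑ℤ-zero (f ∘ suc) (λ v → eq (suc v) (λ ())))) (ℤ.+-identityʳ _)
∑ℤ-single f (suc s) eq = trans (cong₂ ℤ._+_ (eq zero (λ ())) (∑ℤ-single (f ∘ suc) s (λ v ne → eq (suc v) (ne ∘ Fin.suc-injective)))) (ℤ.+-identityˡ _)

∑-difference : ∀ {n} (p q : Fin n → Bool) → + ∑ p ℤ.- + ∑ q ≡ ∑ℤ (λ v → ι (p v) ℤ.- ι (q v))
∑-difference {zero}  p q = refl
∑-difference {suc n} p q = trans
  (cong₂ (λ a b → a ℤ.- b) (split (p zero) (∑ (p ∘ suc))) (split (q zero) (∑ (q ∘ suc))))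
  (trans (solve 4 (λ a b c d → (a :+ b) :- (c :+ d) := (a :- c) :+ (b :- d)) refl (ι (p zero)) (+ ∑ (p ∘ suc)) (ι (q zero)) (+ ∑ (q ∘ suc)))
    (cong (ℤ._+_ (ι (p zero) ℤ.- ι (q zero))) (∑-difference (p ∘ suc) (q ∘ suc))))
  where
  open ℤ-Solver
  split : ∀ b m → + ((if b then 1 else 0) ℕ.+ m) ≡ ι b ℤ.+ + m
  split true  m = refl
  split false m = refl

self-opposite : ∀ i → i ≡ ℤ.- i → i ≡ + 0
self-opposite (+ zero)    eq = refl
self-opposite (+ (suc n)) ()
self-opposite -[1+ n ]    ()

-- Exchanging the order of summation turns the total into its own negative.
∑ℤ-antisymmetric : ∀ {n} (a : Fin n → Fin n → ℤ) → (∀ u v → a u v ≡ ℤ.- a v u) → ∑ℤ (λ u → ∑ℤ (a u)) ≡ + 0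
∑ℤ-antisymmetric a anti = self-opposite _ (begin
  ∑ℤ (λ u → ∑ℤ (a u))                ≡⟨ Sumℤ.∑-comm a ⟩
  ∑ℤ (λ v → ∑ℤ (λ u → a u v))        ≡⟨ Sumℤ.sum-cong-≗ (λ v → Sumℤ.sum-cong-≗ (λ u → anti u v)) ⟩
  ∑ℤ (λ v → ∑ℤ (λ u → ℤ.- a v u))    ≡⟨ Sumℤ.sum-cong-≗ (λ v → ∑ℤ-neg (a v)) ⟩
  ∑ℤ (λ v → ℤ.- ∑ℤ (a v))            ≡⟨ ∑ℤ-neg (λ v → ∑ℤ (a v)) ⟩
  ℤ.- ∑ℤ (λ v → ∑ℤ (a v))            ∎)
  where open ≡-Reasoning

gain : ∀ {n} → Matrix n → Fin n → Fin n → ℤ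
gain f u v = ι (f u v) ℤ.- ι (f v u)

net : ∀ {n} → Matrix n → Fin n → ℤ
net f u = ∑ℤ (gain f u)

net-difference : ∀ {n} (f : Matrix n) u → + outflow f u ℤ.- + inflow f u ≡ net f u
net-difference f u = ∑-difference (f u) (λ v → f v u)

gain-anti : ∀ {n} (f : Matrix n) u v → gain f u v ≡ ℤ.- gain f v u
gain-anti f u v = solve 2 (λ a b → a :- b := :- (b :- a)) refl (ι (f u v)) (ι (f v u)) where open ℤ-Solver

-- Only the edges leaving S contribute to the net flow out of S.
cut-bound : ∀ {n} (f g : Matrix n) (S : Fin n → Bool) (s : Fin n) → S s ≡ true →
  (∀ v → S v ≡ true → v ≢ s → net f v ≡ + 0 × net g v ≡ + 0) →
  (∀ u v → S u ≡ true → S v ≡ false → gain g u v ℤ.≤ gain f u v) →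
  net g s ℤ.≤ net f s
cut-bound {n} f g S s Ss zero-inside crossing =
  ℤ.0≤i-j⇒j≤i (subst (+ 0 ℤ.≤_) total (∑ℤ-nonneg _ (λ u → ∑ℤ-nonneg _ (leaving≥0 u))))
  where
  open ℤ-Solver
  d : Fin n → Fin n → ℤ
  d u v = gain f u v ℤ.- gain g u v
  inside leaving : Fin n → Fin n → ℤ
  inside  u v = if S u ∧ S v then d u v else + 0
  leaving u v = if S u ∧ not (S v) then d u v else + 0
  leaving≥0 : ∀ u v → + 0 ℤ.≤ leaving u v
  leaving≥0 u v with S u in Su | S v in Sv
  ... | true  | true  = ℤ.≤-refl
  ... | true  | false = ℤ.i≤j⇒0≤j-i (crossing u v Su Sv)
  ... | false | _     = ℤ.≤-refl
  inside-anti : ∀ u v → inside u v ≡ ℤ.- inside v u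
  inside-anti u v with S u | S v
  ... | true  | true  = trans (cong₂ ℤ._-_ (gain-anti f u v) (gain-anti g u v))
    (solve 2 (λ a b → (:- a) :- (:- b) := :- (a :- b)) refl (gain f v u) (gain g v u))
  ... | true  | false = refl
  ... | false | true  = refl
  ... | false | false = refl
  row-split : ∀ u → (if S u then net f u ℤ.- net g u else + 0) ≡ ∑ℤ (inside u) ℤ.+ ∑ℤ (leaving u)
  row-split u = trans (as-sum (S u)) (trans (Sumℤ.sum-cong-≗ split) (Sumℤ.∑-distrib-+ (inside u) (leaving u)))
    where
    split : ∀ v → (if S u then d u v else + 0) ≡ inside u v ℤ.+ leaving u v
    split v with S u | S v
    ... | true  | true  = ≡-sym (ℤ.+-identityʳ _)
    ... | true  | false = ≡-sym (ℤ.+-identityˡ _)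
    ... | false | _     = refl
    as-sum : ∀ b → (if b then net f u ℤ.- net g u else + 0) ≡ ∑ℤ (λ v → if b then d u v else + 0)
    as-sum false = ≡-sym (∑ℤ-zero {n} (λ _ → + 0) (λ _ → refl))
    as-sum true  = trans (cong (ℤ._+_ (net f u)) (≡-sym (∑ℤ-neg (gain g u)))) (≡-sym (Sumℤ.∑-distrib-+ (gain f u) (λ v → ℤ.- gain g u v)))
  -- Double counting: pairs inside `S` cancel by antisymmetry, and among the rows of `S` only that
  -- of `s` has a nonvanishing difference of net flows.
  total : ∑ℤ (λ u → ∑ℤ (leaving u)) ≡ net f s ℤ.- net g s
  total = begin
    ∑ℤ (λ u → ∑ℤ (leaving u))                                   ≡⟨ ℤ.+-identityˡ _ ⟨
    + 0 ℤ.+ ∑ℤ (λ u → ∑ℤ (leaving u))                           ≡⟨ cong (ℤ._+ ∑ℤ (λ u → ∑ℤ (leaving u))) (∑ℤ-antisymmetric inside inside-anti) ⟨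
    ∑ℤ (λ u → ∑ℤ (inside u)) ℤ.+ ∑ℤ (λ u → ∑ℤ (leaving u))      ≡⟨ Sumℤ.∑-distrib-+ (λ u → ∑ℤ (inside u)) (λ u → ∑ℤ (leaving u)) ⟨
    ∑ℤ (λ u → ∑ℤ (inside u) ℤ.+ ∑ℤ (leaving u))                 ≡⟨ Sumℤ.sum-cong-≗ row-split ⟨
    ∑ℤ (λ u → if S u then net f u ℤ.- net g u else + 0)         ≡⟨ ∑ℤ-single _ s vanish ⟩
    (if S s then net f s ℤ.- net g s else + 0)                  ≡⟨ cong (λ b → if b then net f s ℤ.- net g s else + 0) Ss ⟩
    net f s ℤ.- net g s                                         ∎
    where
    open ≡-Reasoning
    vanish : ∀ u → u ≢ s → (if S u then net f u ℤ.- net g u else + 0) ≡ + 0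
    vanish u u≢s with S u in Su
    ... | false = refl
    ... | true rewrite proj₁ (zero-inside u Su u≢s) | proj₂ (zero-inside u Su u≢s) = refl

-- Flows as residual matrices

module Residual {n : ℕ} (G : Network n) where
  open Network G renaming (edge to e)

  flowOf : Matrix n → Matrix n
  flowOf r u v = e u v ∧ not (r u v)

  -- A residual pair is an edge without flow or the reverse of an edge with flow. For a loop the
  -- equation forces `r u u ≡ e u u`, so loops carry no flow.
  IsResidual : Matrix n → Set
  IsResidual r = ∀ u v → r u v ≡ (e u v ∧ r u v) ∨ (e v u ∧ not (r v u))

  Conserved : Matrix n → Set
  Conserved f = ∀ v → v ≢ s → v ≢ t → net f v ≡ + 0

  toFlow : ∀ r → Conserved (flowOf r) → Flow G
  toFlow r c = record
    { flow         = flowOf r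
    ; support      = λ u v → supported (e u v) (r u v)
    ; conservation = λ v v≢s v≢t → ≡-sym (ℤ.+-injective (ℤ.i-j≡0⇒i≡j _ _ (trans (net-difference (flowOf r) v) (c v v≢s v≢t))))
    }
    where
    supported : ∀ a b → T (a ∧ not b) → T a
    supported true b _ = tt

  flow-conserved : ∀ (ψ : Flow G) → Conserved (flow ψ)
  flow-conserved ψ v v≢s v≢t = trans (≡-sym (net-difference (flow ψ) v))
    (ℤ.i≡j⇒i-j≡0 (cong +_ (≡-sym (Flow.conservation ψ v v≢s v≢t))))

  value-net : ∀ (ψ : Flow G) → value ψ ≡ net (flow ψ) s
  value-net ψ = net-difference (flow ψ) s

  -- If the residual bit is off, an edge from `u` to `v` is used and an edge from `v` to `u` is not;
  -- no flow can gain more across the pair. The proof is a truth table.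
  gain-saturated : ∀ r (ψ : Flow G) u v → IsResidual r → r u v ≡ false → gain (flow ψ) u v ℤ.≤ gain (flowOf r) u v
  gain-saturated r ψ u v res ruv = go (e u v) (e v u) (r u v) (r v u) (flow ψ u v) (flow ψ v u)
    (Flow.support ψ u v) (res u v) ruv
    where
    go : ∀ a b c d p q → (T p → T a) → c ≡ (a ∧ c) ∨ (b ∧ not d) → c ≡ false →
      ι p ℤ.- ι q ℤ.≤ ι (a ∧ not c) ℤ.- ι (b ∧ not d)
    go true  true  false true  true  true  _ _ _ = ℤ.+≤+ z≤n
    go true  true  false true  true  false _ _ _ = ℤ.≤-refl
    go true  true  false true  false true  _ _ _ = ℤ.-≤+
    go true  true  false true  false false _ _ _ = ℤ.+≤+ z≤n
    go true  false false d     true  true  _ _ _ = ℤ.+≤+ z≤n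
    go true  false false d     true  false _ _ _ = ℤ.≤-refl
    go true  false false d     false true  _ _ _ = ℤ.-≤+
    go true  false false d     false false _ _ _ = ℤ.+≤+ z≤n
    go false true  false true  false true  _ _ _ = ℤ.-≤+
    go false true  false true  false false _ _ _ = ℤ.≤-refl
    go false false false d     false true  _ _ _ = ℤ.-≤+
    go false false false d     false false _ _ _ = ℤ.≤-refl
    go false b     false d     true  q     h _ _ = ⊥-elim (h tt)
    go true  true  false false p     q     _ () _
    go false true  false false p     q     _ () _

  MaximumNet : Matrix n → Set
  MaximumNet f = ∀ (ψ : Flow G) → value ψ ℤ.≤ net f s

  -- The easy half of the duality between flows and cuts. The condition on `t` forbids `t` in `S`
  -- unless it coincides with `s`, so that the case `s ≡ t` is covered as well.
  maximum-by-cut : ∀ r (S : Fin n → Bool) → IsResidual r → Conserved (flowOf r) → S s ≡ true →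
    (∀ v → S v ≡ true → v ≢ s → v ≢ t) → (∀ u v → S u ≡ true → S v ≡ false → r u v ≡ false) →
    MaximumNet (flowOf r)
  maximum-by-cut r S res cons Ss St crossing ψ = ℤ.≤-trans (ℤ.≤-reflexive (value-net ψ))
    (cut-bound (flowOf r) (flow ψ) S s Ss (λ v Sv v≢s → cons v v≢s (St v Sv v≢s) , flow-conserved ψ v v≢s (St v Sv v≢s))
      (λ u v Su Sv → gain-saturated r ψ u v res (crossing u v Su Sv)))

  pushed : Fin n → Fin n → Matrix n → Matrix n
  pushed p x r u v = pushBit (toℕ p) (toℕ x) (toℕ u) (toℕ v) (r u v)

  at : Fin n → Fin n → Bool
  at u v = ⌊ u Fin.≟ v ⌋

  at-same : ∀ u → at u u ≡ true
  at-same u with u Fin.≟ u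
  ... | yes _ = refl
  ... | no ¬p = contradiction refl ¬p

  at-distinct : ∀ {u v} → u ≢ v → at u v ≡ false
  at-distinct {u} {v} ne with u Fin.≟ v
  ... | yes p = contradiction p ne
  ... | no _  = refl

  data Place (p x u v : Fin n) : Set where
    forth : u ≡ p → v ≡ x → Place p x u v
    back  : u ≡ x → v ≡ p → Place p x u v
    other : ¬ (u ≡ p × v ≡ x) → ¬ (u ≡ x × v ≡ p) → Place p x u v

  locate : ∀ p x u v → Place p x u v
  locate p x u v with u Fin.≟ p | v Fin.≟ x | u Fin.≟ x | v Fin.≟ p
  ... | yes a | yes b | _     | _     = forth a b
  ... | _     | _     | yes a | yes b = back a b
  ... | no a  | _     | no b  | _     = other (a ∘ proj₁) (b ∘ proj₁)
  ... | no a  | _     | _     | no b  = other (a ∘ proj₁) (b ∘ proj₂)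
  ... | _     | no a  | no b  | _     = other (a ∘ proj₂) (b ∘ proj₁)
  ... | _     | no a  | _     | no b  = other (a ∘ proj₂) (b ∘ proj₂)

  module _ (p x : Fin n) (p≢x : p ≢ x) (r : Matrix n) (res : IsResidual r) (rpx : r p x ≡ true) where

    private
      distinct : toℕ p ≢ toℕ x
      distinct = p≢x ∘ toℕ-injective

      r′ : Matrix n
      r′ = pushed p x r

      r′-forth : r′ p x ≡ false
      r′-forth = pushBit-forth (r p x) distinct

      r′-back : r′ x p ≡ true
      r′-back = pushBit-back (r x p) distinct

      r′-other : ∀ {u v} → ¬ (u ≡ p × v ≡ x) → ¬ (u ≡ x × v ≡ p) → r′ u v ≡ r u v
      r′-other {u} {v} ¬f ¬b = pushBit-other (toℕ u) (toℕ v) (r u v)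
        (λ (a , b) → ¬b (toℕ-injective a , toℕ-injective b)) (λ (a , b) → ¬f (toℕ-injective a , toℕ-injective b))

      covered : (e p x ∧ true) ∨ (e x p ∧ not (r x p)) ≡ true
      covered = trans (≡-sym (trans (res p x) (cong (λ b → (e p x ∧ b) ∨ (e x p ∧ not (r x p))) rpx))) rpx

    pushed-residual : IsResidual r′
    pushed-residual u v with locate p x u v
    ... | forth refl refl rewrite r′-forth | r′-back | ∧-zeroʳ (e p x) | ∧-zeroʳ (e x p) = refl
    ... | back refl refl rewrite r′-forth | r′-back = ≡-sym (go (e p x) (e x p) (r x p) covered)
      where
      go : ∀ a b c → (a ∧ true) ∨ (b ∧ not c) ≡ true → (b ∧ true) ∨ (a ∧ true) ≡ true
      go true  true  c _ = refl
      go true  false c _ = refl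
      go false true  c _ = refl
    ... | other ¬f ¬b rewrite r′-other ¬f ¬b | r′-other {v} {u} (λ (a , b) → ¬b (b , a)) (λ (a , b) → ¬f (b , a)) = res u v

    private
      δ : Fin n → Fin n → Fin n → Fin n → ℤ
      δ a b u v = ι (at u a ∧ at v b)

      at-∧ : ∀ {u v a b} → ¬ (u ≡ a × v ≡ b) → at u a ∧ at v b ≡ false
      at-∧ {u} {v} {a} {b} ne with u Fin.≟ a | v Fin.≟ b
      ... | yes p | yes q = contradiction (p , q) ne
      ... | yes _ | no _  = refl
      ... | no _  | _     = refl

      -- Here the absence of antiparallel edges enters: with both edges present, one push could add
      -- flow on one and remove it from the other, changing the gain by two.
      gain-forth : gain (flowOf r′) p x ≡ gain (flowOf r) p x ℤ.+ (+ 1)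
      gain-forth rewrite r′-forth | r′-back | rpx = go (e p x) (e x p) (r x p) covered (noAntiparallel p x p≢x)
        where
        go : ∀ a b c → (a ∧ true) ∨ (b ∧ not c) ≡ true → ¬ (T a × T b) →
          ι (a ∧ true) ℤ.- ι (b ∧ false) ≡ (ι (a ∧ false) ℤ.- ι (b ∧ not c)) ℤ.+ (+ 1)
        go true  false c     _ _ = refl
        go false true  false _ _ = refl
        go true  true  c     _ h = ⊥-elim (h (tt , tt))

      gain-pushed : ∀ u v → gain (flowOf r′) u v ≡ gain (flowOf r) u v ℤ.+ (δ p x u v ℤ.- δ x p u v)
      gain-pushed u v with locate p x u v
      ... | forth refl refl rewrite at-same p | at-same x | at-distinct p≢x = gain-forth
      ... | back refl refl rewrite at-same p | at-same x | at-distinct (≢-sym p≢x) = begin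
        gain (flowOf r′) x p                       ≡⟨ gain-anti (flowOf r′) x p ⟩
        ℤ.- gain (flowOf r′) p x                   ≡⟨ cong ℤ.-_ gain-forth ⟩
        ℤ.- (gain (flowOf r) p x ℤ.+ (+ 1))        ≡⟨ ℤ.neg-distrib-+ (gain (flowOf r) p x) (+ 1) ⟩
        (ℤ.- gain (flowOf r) p x) ℤ.+ -[1+ 0 ]     ≡⟨ cong (ℤ._+ -[1+ 0 ]) (gain-anti (flowOf r) x p) ⟨
        gain (flowOf r) x p ℤ.+ -[1+ 0 ]           ∎
        where open ≡-Reasoning
      ... | other ¬f ¬b rewrite r′-other ¬f ¬b | r′-other {v} {u} (λ (a , b) → ¬b (b , a)) (λ (a , b) → ¬f (b , a))
        | at-∧ ¬f | at-∧ ¬b = ≡-sym (ℤ.+-identityʳ _)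

      ∑-δ : ∀ a b u → ∑ℤ (δ a b u) ≡ ι (at u a)
      ∑-δ a b u = trans (∑ℤ-single (δ a b u) b (λ v v≢b → cong ι (trans (cong (at u a ∧_) (at-distinct v≢b)) (∧-zeroʳ _))))
        (trans (cong (λ z → ι (at u a ∧ z)) (at-same b)) (cong ι (∧-identity (at u a))))
        where
        ∧-identity : ∀ a → a ∧ true ≡ a
        ∧-identity true  = refl
        ∧-identity false = refl

    -- A push shifts one unit of net outflow from `x` to `p`. Along the walk from `t` back to `s`
    -- these shifts telescope.
    net-pushed : ∀ u → net (flowOf r′) u ≡ net (flowOf r) u ℤ.+ (ι (at u p) ℤ.- ι (at u x))
    net-pushed u = begin
      ∑ℤ (gain (flowOf r′) u)                                             ≡⟨ Sumℤ.sum-cong-≗ (gain-pushed u) ⟩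
      ∑ℤ (λ v → gain (flowOf r) u v ℤ.+ (δ p x u v ℤ.- δ x p u v))        ≡⟨ Sumℤ.∑-distrib-+ (gain (flowOf r) u) _ ⟩
      net (flowOf r) u ℤ.+ ∑ℤ (λ v → δ p x u v ℤ.- δ x p u v)             ≡⟨ cong (ℤ._+_ (net (flowOf r) u)) (Sumℤ.∑-distrib-+ (δ p x u) _) ⟩
      net (flowOf r) u ℤ.+ (∑ℤ (δ p x u) ℤ.+ ∑ℤ (λ v → ℤ.- δ x p u v))    ≡⟨ cong (λ z → net (flowOf r) u ℤ.+ (∑ℤ (δ p x u) ℤ.+ z)) (∑ℤ-neg (δ x p u)) ⟩
      net (flowOf r) u ℤ.+ (∑ℤ (δ p x u) ℤ.- ∑ℤ (δ x p u))                ≡⟨ cong₂ (λ a b → net (flowOf r) u ℤ.+ (a ℤ.- b)) (∑-δ p x u) (∑-δ x p u) ⟩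
      net (flowOf r) u ℤ.+ (ι (at u p) ℤ.- ι (at u x))                    ∎
      where open ≡-Reasoning

  gain-cong : ∀ {f g : Matrix n} → (∀ u v → f u v ≡ g u v) → ∀ u → net f u ≡ net g u
  gain-cong eq u = Sumℤ.sum-cong-≗ (λ v → cong₂ (λ a b → ι a ℤ.- ι b) (eq u v) (eq v u))

  module Augmentation (E : ℕ → ℕ → Bool) (r : Matrix n) (E-r : ∀ u v → E (toℕ u) (toℕ v) ≡ r u v)
    (res : IsResidual r) (cons : Conserved (flowOf r)) where

    open Levels n (toℕ s) E
    open LevelProperties n (toℕ s) E
    open Pushing n (toℕ s) (toℕ t) E

    stage : ℕ → Matrix n
    stage m u v = residual m (toℕ u) (toℕ v)

    cong-residual : ∀ {q q′ : Matrix n} → (∀ u v → q u v ≡ q′ u v) → IsResidual q′ → IsResidual q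
    cong-residual eq h u v rewrite eq u v | eq v u = h u v

    -- After `m` steps back the surplus sits at the current vertex and is missing at `t`. The next
    -- edge is chosen in the original matrix `E`; `agrees` guarantees that it is still residual now,
    -- because each push changes only entries at a vertex outside the level reached afterwards.
    record Progress (m : ℕ) : Set where
      field
        current   : Fin n
        current-≡ : toℕ current ≡ vertex m
        level     : R (n ∸ m) (vertex m) ≡ true
        stage-res : IsResidual (stage m)
        agrees    : ∀ {u v} → R (n ∸ m) u ≡ true → R (n ∸ m) v ≡ true → residual m u v ≡ E u v
        stage-net : ∀ v → net (flowOf (stage m)) v ≡ net (flowOf r) v ℤ.+ (ι (at v current) ℤ.- ι (at v t))
    open Progress

    progress : R n (toℕ t) ≡ true → ∀ m → m ≤ n → Progress m
    progress Rt zero m≤ = record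
      { current = t ; current-≡ = refl ; level = Rt
      ; stage-res = cong-residual E-r res ; agrees = λ _ _ → refl
      ; stage-net = λ v → trans (gain-cong (λ u w → cong (λ b → e u w ∧ not b) (E-r u w)) v)
          (≡-sym (trans (cong (ℤ._+_ (net (flowOf r) v)) (ℤ.+-inverseʳ (ι (at v t)))) (ℤ.+-identityʳ _)))
      }
    progress Rt (suc m) m<n = next (progress Rt m (ℕ.<⇒≤ m<n))
      where
      l : ℕ
      l = n ∸ suc m
      l-suc : n ∸ m ≡ suc l
      l-suc = ℕ.+-∸-assoc 1 m<n
      next : Progress m → Progress (suc m)
      next P with R l (vertex m) in Rl
      ... | true = record
        { current = current P ; current-≡ = trans (current-≡ P) (≡-sym stays)
        ; level = trans (cong (R l) stays) Rl
        ; stage-res = cong-residual unchanged (stage-res P)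
        ; agrees = λ {u} {v} Ru Rv → trans (pushBit-idle u v _ stays) (agrees P (up Ru) (up Rv))
        ; stage-net = λ v → trans (gain-cong (λ u w → cong (λ b → e u w ∧ not b) (unchanged u w)) v) (stage-net P v)
        }
        where
        stays : vertex (suc m) ≡ vertex m
        stays rewrite Rl = refl
        unchanged : ∀ u v → stage (suc m) u v ≡ stage m u v
        unchanged u v = pushBit-idle (toℕ u) (toℕ v) _ stays
        up : ∀ {u} → R l u ≡ true → R (n ∸ m) u ≡ true
        up {u} Ru = subst (λ i → R i u ≡ true) (≡-sym l-suc) (R-weaken l Ru)
      ... | false = record
        { current = p ; current-≡ = p-≡
        ; level = trans (cong (R l) moves) Rb
        ; stage-res = cong-residual stage-≡ (pushed-residual p x p≢x (stage m) (stage-res P) rpx)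
        ; agrees = λ {u} {v} Ru Rv → trans
            (pushBit-other {vertex (suc m)} {y} u v _ (λ (a , _) → off Ru a) (λ (_ , b) → off Rv b)) (agrees P (up Ru) (up Rv))
        ; stage-net = λ v → begin
            net (flowOf (stage (suc m))) v                                          ≡⟨ gain-cong (λ u w → cong (λ b → e u w ∧ not b) (stage-≡ u w)) v ⟩
            net (flowOf (pushed p x (stage m))) v                                   ≡⟨ net-pushed p x p≢x (stage m) (stage-res P) rpx v ⟩
            net (flowOf (stage m)) v ℤ.+ (ι (at v p) ℤ.- ι (at v x))                ≡⟨ cong (ℤ._+ (ι (at v p) ℤ.- ι (at v x))) (stage-net P v) ⟩
            (net (flowOf r) v ℤ.+ (ι (at v x) ℤ.- ι (at v t))) ℤ.+ (ι (at v p) ℤ.- ι (at v x)) 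
              ≡⟨ telescope (net (flowOf r) v) (ι (at v x)) (ι (at v t)) (ι (at v p)) ⟩
            net (flowOf r) v ℤ.+ (ι (at v p) ℤ.- ι (at v t))                        ∎
        }
        where
        open ≡-Reasoning
        telescope : ∀ a x t p → (a ℤ.+ (x ℤ.- t)) ℤ.+ (p ℤ.- x) ≡ a ℤ.+ (p ℤ.- t)
        telescope = solve 4 (λ a x t p → (a :+ (x :- t)) :+ (p :- x) := a :+ (p :- t)) refl where open ℤ-Solver
        x : Fin n
        x = current P
        y b : ℕ
        y = vertex m
        b = best l y n
        moves : vertex (suc m) ≡ b
        moves rewrite Rl = refl
        up : ∀ {u} → R l u ≡ true → R (n ∸ m) u ≡ true
        up {u} Ru = subst (λ i → R i u ≡ true) (≡-sym l-suc) (R-weaken l Ru)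
        off : ∀ {u} → R l u ≡ true → u ≢ y
        off Ru refl = contradiction (trans (≡-sym Ru) Rl) (λ ())
        -- The vertex `y` is in level `l + 1` but not in level `l`, so it has a predecessor in level
        -- `l`, different from `y`, and `best` cannot return its default.
        chosen : b < n × b ≢ y × R l b ≡ true × E b y ≡ true
        chosen with R-suc-elim l {y} (subst (λ i → R i y ≡ true) l-suc (level P)) | best-candidate l y n
        ... | inj₁ Ry | _ = contradiction (trans (≡-sym Ry) Rl) (λ ())
        ... | inj₂ (_ , u , Ru , Euy) | inj₁ same = contradiction same (best-found l y n (R-below l Ru) Ru (off Ru) Euy)
        ... | inj₂ _ | inj₂ c = c
        Rb : R l b ≡ true
        Rb = proj₁ (proj₂ (proj₂ chosen))
        p : Fin n
        p = fromℕ< (proj₁ chosen)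
        p-≡ : toℕ p ≡ vertex (suc m)
        p-≡ = trans (toℕ-fromℕ< (proj₁ chosen)) (≡-sym moves)
        p≢x : p ≢ x
        p≢x eq = proj₁ (proj₂ chosen) (trans (≡-sym moves) (trans (≡-sym p-≡) (trans (cong toℕ eq) (current-≡ P))))
        rpx : stage m p x ≡ true
        rpx rewrite p-≡ | moves | current-≡ P = trans (agrees P (up Rb) (level P)) (proj₂ (proj₂ (proj₂ chosen)))
        stage-≡ : ∀ u v → stage (suc m) u v ≡ pushed p x (stage m) u v
        stage-≡ u v = cong₂ (λ a c → pushBit a c (toℕ u) (toℕ v) (stage m u v)) (≡-sym p-≡) (≡-sym (current-≡ P))

    -- A predecessor of `t` in one of the levels would put `t` into the next level and so into level
    -- `n`. Hence the walk waits at `t` throughout, and waiting pushes nothing.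
    unreached : R n (toℕ t) ≡ false → ∀ m → m ≤ n → vertex m ≡ toℕ t × (∀ u v → residual m u v ≡ E u v)
    unreached Rt zero    m≤  = refl , λ _ _ → refl
    unreached Rt (suc m) m<n with unreached Rt m (ℕ.<⇒≤ m<n)
    ... | vm , rm = trans stays vm , λ u v → trans (pushBit-idle u v _ stays) (rm u v)
      where
      l : ℕ
      l = n ∸ suc m
      l-suc : n ∸ m ≡ suc l
      l-suc = ℕ.+-∸-assoc 1 m<n
      never : ∀ {i} → i ≤ n → R i (toℕ t) ≢ true
      never i≤ Ri = contradiction (trans (≡-sym (R-mono i≤ Ri)) Rt) (λ ())
      stays : vertex (suc m) ≡ vertex m
      stays rewrite vm with R l (toℕ t) in Rl | best-candidate l (toℕ t) n
      ... | true  | _      = refl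
      ... | false | inj₁ b = b
      ... | false | inj₂ (_ , _ , Ru , Eut) = contradiction (R-edge l Ru Eut (toℕ<n t)) (never (subst (_≤ n) l-suc (ℕ.m∸n≤m n m)))

    final : Matrix n
    final = stage n

    -- In the maximal case the value must also not have grown: this keeps it below the number of
    -- iterations even if a maximum flow is met early.
    Outcome : Set
    Outcome = IsResidual final × Conserved (flowOf final) ×
      ((net (flowOf final) s ≡ net (flowOf r) s ℤ.+ (+ 1)) ⊎
       (MaximumNet (flowOf final) × net (flowOf final) s ℤ.≤ net (flowOf r) s))

    outcome : Outcome
    outcome with R n (toℕ t) in Rt
    outcome | false = cong-residual same res , conserved , 
      inj₂ (subst (λ z → ∀ ψ → value ψ ℤ.≤ z) (≡-sym (net-same s)) maximal , ℤ.≤-reflexive (net-same s))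
      where
      same : ∀ u v → final u v ≡ r u v
      same u v = trans (proj₂ (unreached Rt n ℕ.≤-refl) (toℕ u) (toℕ v)) (E-r u v)
      net-same : ∀ v → net (flowOf final) v ≡ net (flowOf r) v
      net-same = gain-cong (λ u w → cong (λ b → e u w ∧ not b) (same u w))
      conserved : Conserved (flowOf final)
      conserved v v≢s v≢t = trans (net-same v) (cons v v≢s v≢t)
      maximal : MaximumNet (flowOf r)
      maximal = maximum-by-cut r (λ v → R n (toℕ v)) res cons (R-mono {0} {n} z≤n (R-source (toℕ<n s)))
        (λ { v Rv _ refl → contradiction (trans (≡-sym Rv) Rt) (λ ()) })
        (λ u v Ru ¬Rv → trans (≡-sym (E-r u v)) (not-true (λ Euv → contradiction (trans (≡-sym (closed (toℕ<n s) Ru (toℕ<n v) Euv)) ¬Rv) (λ ()))))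
        where
        not-true : ∀ {b} → b ≢ true → b ≡ false
        not-true {true}  h = contradiction refl h
        not-true {false} h = refl
    outcome | true = stage-res P , conserved , compare
      where
      P : Progress n
      P = progress Rt n ℕ.≤-refl
      -- After `n` steps back the walk is in level 0, whose only vertex is `s`.
      at-source : current P ≡ s
      at-source = toℕ-injective (trans (current-≡ P) (R-start (subst (λ i → R i (vertex n) ≡ true) (ℕ.n∸n≡0 n) (level P))))
      net-final : ∀ v → net (flowOf final) v ≡ net (flowOf r) v ℤ.+ (ι (at v s) ℤ.- ι (at v t))
      net-final v = trans (stage-net P v) (cong (λ c → net (flowOf r) v ℤ.+ (ι (at v c) ℤ.- ι (at v t))) at-source)
      conserved : Conserved (flowOf final)
      conserved v v≢s v≢t = trans (net-final v) (trans (cong₂ (λ a b → net (flowOf r) v ℤ.+ (ι a ℤ.- ι b)) (at-distinct v≢s) (at-distinct v≢t))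
        (trans (ℤ.+-identityʳ _) (cons v v≢s v≢t)))
      compare : (net (flowOf final) s ≡ net (flowOf r) s ℤ.+ (+ 1)) ⊎
        (MaximumNet (flowOf final) × net (flowOf final) s ℤ.≤ net (flowOf r) s)
      compare with s Fin.≟ t
      ... | no s≢t = inj₁ (trans (net-final s) (cong₂ (λ a b → net (flowOf r) s ℤ.+ (ι a ℤ.- ι b)) (at-same s) (at-distinct s≢t)))
      -- With `s ≡ t` the set of all vertices serves as a cut that nothing leaves, so every flow is
      -- maximum; applying this to `r` as well bounds the new value by the old one.
      ... | yes s≡t = inj₂ (maximum-by-cut final (const true) (stage-res P) conserved refl everywhere (λ _ _ _ ()) ,
        subst (ℤ._≤ net (flowOf r) s) (value-net (toFlow final conserved))
          (maximum-by-cut r (const true) res cons refl everywhere (λ _ _ _ ()) (toFlow final conserved)))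
        where
        everywhere : ∀ v → true ≡ true → v ≢ s → v ≢ t
        everywhere v _ v≢s v≡t = v≢s (trans v≡t (≡-sym s≡t))

-- Correctness on encoded networks

length-body : ∀ w → length (prefix w) + length (body w) ≡ length w
length-body w = trans (≡-sym (length-++ (prefix w))) (cong length (begin
  (block w ++ block w₁ ++ block w₂) ++ rest w₂  ≡⟨ ++-assoc (block w) _ _ ⟩
  block w ++ (block w₁ ++ block w₂) ++ rest w₂  ≡⟨ cong (block w ++_) (++-assoc (block w₁) _ _) ⟩
  block w ++ block w₁ ++ block w₂ ++ rest w₂    ≡⟨ cong (λ z → block w ++ block w₁ ++ z) (block-rest w₂) ⟩
  block w ++ block w₁ ++ w₂                     ≡⟨ cong (block w ++_) (block-rest w₁) ⟩
  block w ++ w₁                                 ≡⟨ block-rest w ⟩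
  w                                             ∎))
  where
  open ≡-Reasoning
  w₁ w₂ : Word
  w₁ = rest w
  w₂ = rest w₁

length-select : ∀ w → length (select w) ≤ length w
length-select []          = z≤n
length-select (e ∷ [])    = ≤-refl
length-select (e ∷ r ∷ w) = s≤s (m≤n⇒m≤1+n (length-select w))

-- Adding the part of the input not yet read turns the estimate into an equation, which telescopes
-- over the entries of a row and then over the rows, also on truncated words.
length-pair : ∀ w i (b : Bool) → 
  length (fromMaybe (nth w i) ++ fromMaybe (Maybe.map (const b) (nth w (suc i)))) + length (drop (suc (suc i)) w) ≡ length (drop i w)
length-pair []          zero    b = refl
length-pair []          (suc i) b = refl
length-pair (_ ∷ [])    zero    b = refl
length-pair (_ ∷ _ ∷ w) zero    b = refl
length-pair (_ ∷ w)     (suc i) b = length-pair w i b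

length-row : ∀ n w r u k → length (rowWord n w r u k) + length (drop (offset n u k) w) ≡ length (drop (row n 0 u) w)
length-row n w r u zero    = refl
length-row n w r u (suc k) = begin
  length (rowWord n w r u k ++ pairWord n w r u k) + length (drop (offset n u (suc k)) w)            ≡⟨ cong (_+ _) (length-++ (rowWord n w r u k)) ⟩
  length (rowWord n w r u k) + length (pairWord n w r u k) + length (drop (offset n u (suc k)) w)    ≡⟨ +-assoc (length (rowWord n w r u k)) _ _ ⟩
  length (rowWord n w r u k) + (length (pairWord n w r u k) + length (drop (offset n u (suc k)) w))
    ≡⟨ cong (_+_ (length (rowWord n w r u k))) (length-pair w (offset n u k) (r u k)) ⟩
  length (rowWord n w r u k) + length (drop (offset n u k) w)                                        ≡⟨ length-row n w r u k ⟩
  length (drop (row n 0 u) w)                                                                        ∎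
  where open ≡-Reasoning

length-matrix : ∀ n w r k → length (matrixWord n w r k) + length (drop (row n 0 k) w) ≡ length w
length-matrix n w r zero    = refl
length-matrix n w r (suc k) = begin
  length (matrixWord n w r k ++ rowWord n w r k n) + length (drop (row n 0 (suc k)) w)          ≡⟨ cong (_+ _) (length-++ (matrixWord n w r k)) ⟩
  length (matrixWord n w r k) + length (rowWord n w r k n) + length (drop (offset n k n) w)     ≡⟨ +-assoc (length (matrixWord n w r k)) _ _ ⟩
  length (matrixWord n w r k) + (length (rowWord n w r k n) + length (drop (offset n k n) w))
    ≡⟨ cong (_+_ (length (matrixWord n w r k))) (length-row n w r k n) ⟩
  length (matrixWord n w r k) + length (drop (row n 0 k) w)                                     ≡⟨ length-matrix n w r k ⟩
  length w                                                                                      ∎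
  where open ≡-Reasoning

length-iterator : ∀ w k → length (proj₁ (iterator (w , k))) ≤ length w
length-iterator w zero    = ≤-trans (length-select (body w)) (≤-trans (m≤n+m _ _) (≤-reflexive (length-body w)))
length-iterator w (suc k) = ≤-trans (≤-reflexive (length-++ (prefix w)))
  (≤-trans (+-monoʳ-≤ (length (prefix w)) (≤-trans (m≤m+n _ _) (≤-reflexive (length-matrix (ones w) (body w) _ (ones w)))))
    (≤-reflexive (length-body w)))

-- The iterator never lengthens a word, so any computable factor that is at least 1 will do, also at
-- parameter 0.
iterator-linear : Linear iterator
iterator-linear = (λ k → 1 * suc k) , computable-multiple 0 , λ w k →
  ≤-trans (length-iterator w k) (≤-trans (m≤m+n _ (k * length w)) (≤-reflexive (cong (_* length w) (≡-sym (*-identityˡ (suc k))))))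

-- Words of encoded matrices

pairs : ∀ {n} → (Fin n → Bool × Bool) → Word
pairs f = concat (tabulate (λ v → proj₁ (f v) ∷ proj₂ (f v) ∷ []))

encodePairs : ∀ {n} → Matrix n → Matrix n → Word
encodePairs e r = concat (tabulate (λ u → pairs (λ v → e u v , r u v)))

double-++ : ∀ v w → double (v ++ w) ≡ double v ++ double w
double-++ []      w = refl
double-++ (b ∷ v) w = cong (λ z → b ∷ b ∷ z) (double-++ v w)

double-tabulate : ∀ {n} (f : Fin n → Bool) → double (tabulate f) ≡ pairs (λ v → f v , f v)
double-tabulate {zero}  f = refl
double-tabulate {suc n} f = cong (λ z → f zero ∷ f zero ∷ z) (double-tabulate (f ∘ suc))

double-rows : ∀ {k n} (f : Fin k → Fin n → Bool) →
  double (concat (tabulate (λ u → tabulate (f u)))) ≡ concat (tabulate (λ u → pairs (λ v → f u v , f u v)))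
double-rows {zero}  f = refl
double-rows {suc k} f = trans (double-++ (tabulate (f zero)) _) (cong₂ _++_ (double-tabulate (f zero)) (double-rows (f ∘ suc)))

select-pairs : ∀ {n} (f : Fin n → Bool × Bool) w →
  select (pairs f ++ w) ≡ tabulate (λ v → proj₁ (f v) ∧ not (proj₂ (f v))) ++ select w
select-pairs {zero}  f w = refl
select-pairs {suc n} f w = cong ((proj₁ (f zero) ∧ not (proj₂ (f zero))) ∷_) (select-pairs (f ∘ suc) w)

select-rows : ∀ {k n} (f : Fin k → Fin n → Bool × Bool) →
  select (concat (tabulate (λ u → pairs (f u)))) ≡ concat (tabulate (λ u → tabulate (λ v → proj₁ (f u v) ∧ not (proj₂ (f u v)))))
select-rows {zero}  f = refl
select-rows {suc k} f = trans (select-pairs (f zero) _)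
  (cong (tabulate (λ v → proj₁ (f zero v) ∧ not (proj₂ (f zero v))) ++_) (select-rows (f ∘ suc)))

length-pairs : ∀ {n} (f : Fin n → Bool × Bool) → length (pairs f) ≡ n * 2
length-pairs {zero}  f = refl
length-pairs {suc n} f = cong (_+_ 2) (length-pairs (f ∘ suc))

nth-++ˡ : ∀ v w {i} → i < length v → nth (v ++ w) i ≡ nth v i
nth-++ˡ (b ∷ v) w {zero}  p       = refl
nth-++ˡ (b ∷ v) w {suc i} (s≤s p) = nth-++ˡ v w p

nth-++ʳ : ∀ v w i → nth (v ++ w) (length v + i) ≡ nth w i
nth-++ʳ []      w i = refl
nth-++ʳ (b ∷ v) w i = nth-++ʳ v w i

nth-pairs₁ : ∀ {n} (f : Fin n → Bool × Bool) v → nth (pairs f) (toℕ v * 2) ≡ just (proj₁ (f v))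
nth-pairs₁ f zero    = refl
nth-pairs₁ f (suc v) = nth-pairs₁ (f ∘ suc) v

nth-pairs₂ : ∀ {n} (f : Fin n → Bool × Bool) v → nth (pairs f) (suc (toℕ v * 2)) ≡ just (proj₂ (f v))
nth-pairs₂ f zero    = refl
nth-pairs₂ f (suc v) = nth-pairs₂ (f ∘ suc) v

nth-rows : ∀ {k n} (f : Fin k → Fin n → Bool × Bool) u {i} → i < n * 2 →
  nth (concat (tabulate (λ u → pairs (f u)))) (i + row n 0 (toℕ u)) ≡ nth (pairs (f u)) i
nth-rows {suc k} {n} f zero {i} i< rewrite +-identityʳ i =
  nth-++ˡ (pairs (f zero)) _ (subst (i <_) (≡-sym (length-pairs (f zero))) i<)
nth-rows {suc k} {n} f (suc u) {i} i< = trans (cong (nth (pairs (f zero) ++ below)) shift)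
  (trans (nth-++ʳ (pairs (f zero)) below (i + row n 0 (toℕ u))) (nth-rows (f ∘ suc) u i<))
  where
  below : Word
  below = concat (tabulate (λ u → pairs (f (suc u))))
  shift : i + (n * 2 + row n 0 (toℕ u)) ≡ length (pairs (f zero)) + (i + row n 0 (toℕ u))
  shift = trans (x∙yz≈y∙xz i (n * 2) _) (cong (_+ (i + row n 0 (toℕ u))) (≡-sym (length-pairs (f zero))))

module _ {n : ℕ} (e r : Matrix n) where

  private
    inside : ∀ (v : Fin n) → suc (toℕ v * 2) < n * 2
    inside v = *-monoˡ-≤ 2 (toℕ<n v)

  nth-edge : ∀ u v → nth (encodePairs e r) (offset n (toℕ u) (toℕ v)) ≡ just (e u v)
  nth-edge u v = trans (nth-rows (λ u v → e u v , r u v) u (<-trans ≤-refl (inside v))) (nth-pairs₁ (λ v → e u v , r u v) v)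

  nth-residual : ∀ u v → nth (encodePairs e r) (suc (offset n (toℕ u) (toℕ v))) ≡ just (r u v)
  nth-residual u v = trans (nth-rows (λ u v → e u v , r u v) u (inside v)) (nth-pairs₂ (λ v → e u v , r u v) v)

concatBelow-suc : ∀ k g → concatBelow (suc k) g ≡ g 0 ++ concatBelow k (g ∘ suc)
concatBelow-suc zero    g = ≡-sym (++-identityʳ (g 0))
concatBelow-suc (suc k) g = trans (cong (_++ g (suc k)) (concatBelow-suc k g)) (++-assoc (g 0) _ _)

concatBelow-tabulate : ∀ k g (f : Fin k → Word) → (∀ u → g (toℕ u) ≡ f u) → concatBelow k g ≡ concat (tabulate f)
concatBelow-tabulate zero    g f eq = refl
concatBelow-tabulate (suc k) g f eq = trans (concatBelow-suc k g)
  (cong₂ _++_ (eq zero) (concatBelow-tabulate k (g ∘ suc) (f ∘ suc) (eq ∘ suc)))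

matrixWord-pairs : ∀ {n} (e r : Matrix n) ρ →
  matrixWord n (encodePairs e r) ρ n ≡ encodePairs e (λ u v → ρ (toℕ u) (toℕ v))
matrixWord-pairs {n} e r ρ = concatBelow-tabulate n _ _ (λ u → concatBelow-tabulate n _ _ (λ v →
  cong₂ (λ a b → fromMaybe a ++ fromMaybe (Maybe.map (const (ρ (toℕ u) (toℕ v))) b)) (nth-edge e r u v) (nth-residual e r u v)))

withHeader : ℕ → ℕ → ℕ → Word → Word
withHeader n s t v = unary n ++ false ∷ unary s ++ false ∷ unary t ++ false ∷ v

module _ (n s t : ℕ) (v : Word) where

  private
    rest₁ : rest (withHeader n s t v) ≡ unary s ++ false ∷ unary t ++ false ∷ v
    rest₁ = rest-unary n _

    rest₂ : rest (rest (withHeader n s t v)) ≡ unary t ++ false ∷ v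
    rest₂ = trans (cong rest rest₁) (rest-unary s _)

  body-header : body (withHeader n s t v) ≡ v
  body-header = trans (cong rest rest₂) (rest-unary t v)

  ones-header : ones (withHeader n s t v) ≡ n × ones (rest (withHeader n s t v)) ≡ s × ones (rest (rest (withHeader n s t v))) ≡ t
  ones-header = ones-unary n _ , trans (cong ones rest₁) (ones-unary s _) , trans (cong ones rest₂) (ones-unary t _)

  prefix-header : ∀ v′ → prefix (withHeader n s t v) ++ v′ ≡ withHeader n s t v′
  prefix-header v′ = begin
    prefix (withHeader n s t v) ++ v′
      ≡⟨ cong (_++ v′) (cong₂ _++_ (block-unary n _)
           (cong₂ _++_ (trans (cong block rest₁) (block-unary s _)) (trans (cong block rest₂) (block-unary t v)))) ⟩
    ((unary n ++ false ∷ []) ++ (unary s ++ false ∷ []) ++ unary t ++ false ∷ []) ++ v′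
      ≡⟨ ++-assoc (unary n ++ false ∷ []) _ v′ ⟩
    (unary n ++ false ∷ []) ++ ((unary s ++ false ∷ []) ++ unary t ++ false ∷ []) ++ v′
      ≡⟨ ++-assoc (unary n) _ _ ⟩
    unary n ++ false ∷ ((unary s ++ false ∷ []) ++ unary t ++ false ∷ []) ++ v′
      ≡⟨ cong (λ z → unary n ++ false ∷ z) (trans (++-assoc (unary s ++ false ∷ []) _ v′) (++-assoc (unary s) _ _)) ⟩
    unary n ++ false ∷ unary s ++ false ∷ (unary t ++ false ∷ []) ++ v′
      ≡⟨ cong (λ z → unary n ++ false ∷ unary s ++ false ∷ z) (++-assoc (unary t) _ v′) ⟩
    withHeader n s t v′ ∎
    where open ≡-Reasoning

augment-header : ∀ n s t v → augment (withHeader n s t v) ≡ withHeader n s t (matrixWord n v (augmented n s t v) n)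
augment-header n s t v = trans (cong (prefix w ++_) unfold) (prefix-header n s t v _)
  where
  w : Word
  w = withHeader n s t v
  unfold : matrixWord (ones w) (body w) (augmented (ones w) (ones (rest w)) (ones (rest (rest w))) (body w)) (ones w) ≡
           matrixWord n v (augmented n s t v) n
  unfold with ones-header n s t v
  ... | a , b , c rewrite body-header n s t v | a | b | c = refl

-- Iterated augmentation of an encoded network

module Correctness {n : ℕ} (G : Network n) where
  open Network G renaming (edge to e)
  open Residual G

  word : Matrix n → Word
  word r = withHeader n (toℕ s) (toℕ t) (encodePairs e r)

  initialize-word : ∀ k → initialize (encodeNetwork G , k) ≡ (word e , k)
  initialize-word k = cong (_, k) (trans (prefix-header n (toℕ s) (toℕ t) (encodeMatrix e) _)
    (cong (withHeader n (toℕ s) (toℕ t)) (trans (cong double (body-header n (toℕ s) (toℕ t) (encodeMatrix e))) (double-rows e))))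

  final-word : ∀ r → proj₁ (iterator (word r , 0)) ≡ encodeMatrix (flowOf r)
  final-word r = trans (cong select (body-header n (toℕ s) (toℕ t) (encodePairs e r))) (select-rows (λ u v → e u v , r u v))

  -- The upper bound `+ k` in the second case is what later forces a maximum flow to have value
  -- exactly `k` whenever some flow of value `k` exists.
  record Reached (k : ℕ) (r : Matrix n) : Set where
    field
      residual  : IsResidual r
      conserved : Conserved (flowOf r)
      progress  : net (flowOf r) s ≡ + k ⊎ (MaximumNet (flowOf r) × net (flowOf r) s ℤ.≤ + k)

  start : Reached 0 e
  start = record
    { residual  = λ u v → go (e u v) (e v u)
    ; conserved = λ v _ _ → zero-net v
    ; progress  = inj₁ (zero-net s)
    }
    where
    go : ∀ a b → a ≡ (a ∧ a) ∨ (b ∧ not b)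
    go true  b     = refl
    go false true  = refl
    go false false = refl
    none : ∀ a → a ∧ not a ≡ false
    none true  = refl
    none false = refl
    zero-net : ∀ v → net (flowOf e) v ≡ + 0
    zero-net v = ∑ℤ-zero _ (λ w → cong₂ (λ a b → ι a ℤ.- ι b) (none (e v w)) (none (e w v)))

  next : ∀ {k r} m → Reached k r → ∃[ r′ ] (Reached (suc k) r′ × iterator (word r , suc m) ≡ (word r′ , m))
  next {k} {r} m R = final ,
    record { residual = proj₁ outcome ; conserved = conserved′ ; progress = continue (proj₂ (proj₂ outcome)) (Reached.progress R) } ,
    cong (_, m) (trans (augment-header n (toℕ s) (toℕ t) (encodePairs e r)) (cong (withHeader n (toℕ s) (toℕ t)) (matrixWord-pairs e r _)))
    where
    open Augmentation (entryBit n (encodePairs e r)) r (λ u v → cong isTrue (nth-residual e r u v)) (Reached.residual R) (Reached.conserved R)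
      using (final; outcome)
    conserved′ : Conserved (flowOf final)
    conserved′ = proj₁ (proj₂ outcome)
    continue : _ → _ → net (flowOf final) s ≡ + suc k ⊎ (MaximumNet (flowOf final) × net (flowOf final) s ℤ.≤ + suc k)
    continue (inj₁ more) (inj₁ eq) = inj₁ (trans more (trans (cong (ℤ._+ + 1) eq) (cong +_ (+-comm k 1))))
    -- A value above that of a maximum flow is impossible.
    continue (inj₁ more) (inj₂ (max , _)) = contradiction
      (subst (ℤ._≤ net (flowOf r) s) (trans (value-net (toFlow final conserved′)) (trans more (ℤ.+-comm (net (flowOf r) s) (+ 1))))
        (max (toFlow final conserved′)))
      (λ le → ℤ.<-irrefl refl (ℤ.suc[i]≤j⇒i<j le))
    continue (inj₂ (max , le)) p = inj₂ (max , ℤ.≤-trans le (ℤ.≤-trans (bounded p) (ℤ.+≤+ (n≤1+n k))))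
      where
      bounded : net (flowOf r) s ≡ + k ⊎ (MaximumNet (flowOf r) × net (flowOf r) s ℤ.≤ + k) → net (flowOf r) s ℤ.≤ + k
      bounded (inj₁ eq)       = ℤ.≤-reflexive eq
      bounded (inj₂ (_ , le)) = le

  iterate : ∀ k m → ∃[ r ] (Reached k r × power (Word × ℕ) iterator k (word e , k + m) ≡ (word r , m))
  iterate zero    m = e , start , refl
  iterate (suc k) m with iterate k (suc m)
  ... | r , R , eq with next m R
  ... | r′ , R′ , eq′ = r′ , R′ , trans (cong iterator (trans (cong (λ z → power (Word × ℕ) iterator k (word e , z)) (≡-sym (+-suc k m))) eq)) eq′

-- The factor 1 only gives the iteration count the shape of the function supplied by
-- `computable-multiple 0`; the last iteration finds parameter 0 and extracts the flow.
maxFlow : Word × ℕ → Word × ℕ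
maxFlow (w , k) = power (Word × ℕ) iterator (1 * suc k) (initialize (w , k))

maxFlow-correct : ∀ n (G : Network n) (k : ℕ) →
  ∃[ φ ] (proj₁ (maxFlow (encodeNetwork G , k)) ≡ encodeMatrix (flow φ)
    × ((∃[ ψ ] (value {G = G} ψ ≡ + k)) → value {G = G} φ ≡ + k)
    × (¬ (∃[ ψ ] (value {G = G} ψ ≡ + k)) → Maximum {G = G} φ))
maxFlow-correct n G k with iterate k 0
  where open Correctness G
... | r , R , eq = φ , output-eq , exact (Reached.progress R) , maximum (Reached.progress R)
  where
  open Network G using (s)
  open Residual G
  open Correctness G
  φ : Flow G
  φ = toFlow r (Reached.conserved R)
  output-eq : proj₁ (maxFlow (encodeNetwork G , k)) ≡ encodeMatrix (flowOf r)
  output-eq = trans (cong₂ (λ j z → proj₁ (power (Word × ℕ) iterator j z)) (*-identityˡ (suc k))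
      (trans (initialize-word k) (cong (word (Network.edge G) ,_) (≡-sym (+-identityʳ k)))))
    (trans (cong (proj₁ ∘ iterator) eq) (final-word r))
  exact : net (flowOf r) s ≡ + k ⊎ (MaximumNet (flowOf r) × net (flowOf r) s ℤ.≤ + k) →
    (∃[ ψ ] (value {G = G} ψ ≡ + k)) → value {G = G} φ ≡ + k
  exact (inj₁ eq)         _         = trans (value-net φ) eq
  -- Maximality gives at least the value `k` of `ψ`, and the bound carried through the iterations
  -- gives at most `k`.
  exact (inj₂ (max , le)) (ψ , eq) = trans (value-net φ) (ℤ.≤-antisym le (subst (ℤ._≤ _) eq (max ψ)))
  maximum : net (flowOf r) s ≡ + k ⊎ (MaximumNet (flowOf r) × net (flowOf r) s ℤ.≤ + k) →
    ¬ (∃[ ψ ] (value {G = G} ψ ≡ + k)) → Maximum {G = G} φ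
  maximum (inj₁ eq)        none   = contradiction (φ , trans (value-net φ) eq) none
  maximum (inj₂ (max , _)) none ψ = subst (value ψ ℤ.≤_) (≡-sym (value-net φ)) (max ψ)

maxFlow-parameter : ∀ w k → proj₂ (maxFlow (w , k)) ≤ k
maxFlow-parameter w k = decreasing (1 * suc k) (initialize (w , k))
  where
  step : ∀ z → proj₂ (iterator z) ≤ proj₂ z
  step (w , zero)  = z≤n
  step (w , suc k) = n≤1+n k
  decreasing : ∀ j z → proj₂ (power (Word × ℕ) iterator j z) ≤ proj₂ z
  decreasing zero    z = ≤-refl
  decreasing (suc j) z = ≤-trans (step _) (decreasing j z)

theorem4p7 : ∃[ F ] (ParaFNL↑ F ×
    (∀ n (G : Network n) (k : ℕ) →
    ∃[ φ ] (proj₁ (F (encodeNetwork G , k)) ≡ encodeMatrix (flow φ)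
    × ((∃[ ψ ] (value {G = G} ψ ≡ + k)) → value {G = G} φ ≡ + k)
    × (¬ (∃[ ψ ] (value {G = G} ψ ≡ + k)) → Maximum {G = G} φ))))
theorem4p7 = maxFlow ,
  ((id , maxFlow-parameter) , initialize , iterator , (λ k → 1 * suc k) ,
    initialize-paraFNL , iterator-paraFNL , iterator-linear , computable-multiple 0 , (λ w k → refl)) ,
  maxFlow-correct
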